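{- The linear map $F\colon G_0(\mathbf{\Pi},\wedge)\to\mathsf{NCSym}$ defined by $F(V_A)=\mathbf{x}_A$ for every $A\in\Pi_n$, $n\ge 0$, is an isomorphism of bialgebras, where $G_0(\mathbf{\Pi},\wedge)$ carries the induction product and the internal comultiplication $\Delta^{\odot}$, and $\mathsf{NCSym}$ carries its product and its internal comultiplication $\Delta^{\odot}$.
   Context: $\Bbbk$ is a field of characteristic zero. $\Pi_n$ is the set of set partitions of $[n]=\{1,\dots,n\}$ ($\Pi_0$ consists only of the empty set partition), ordered by $A\le B$ iff every part of $A$ is contained in a part of $B$. It is a lattice with meet $\wedge$, join $\vee$, minimal element $\mathbf{0}_n=\{\{1\},\dots,\{n\}\}$, maximal element $\mathbf{1}_n=\{[n]\}$, and Möbius function $\mu$. For $A\in\Pi_n$, $B\in\Pi_m$, the set partition $A|B\in\Pi_{n+m}$ consists of the parts of $A$ together with the parts of $B$ with every element shifted by $n$. **Modules.** $(\Bbbk\Pi_n,\wedge)$ is the $\Bbbk$-algebra with basis $\Pi_n$ and product extending $\wedge$ bilinearly (unit $\mathbf{1}_n$); it is commutative and semisimple, with primitive orthogonal idempotents $e_A=\sum_{B\le A}\mu(B,A)B$, $A\in\Pi_n$, and simple modules the one-dimensional spaces $V_A=\Bbbk\Pi_n\wedge e_A$ (left multiplication). $G_0(\Bbbk\Pi_n,\wedge)$ is the Grothendieck group of finite dimensional modules, regarded as the $\Bbbk$-vector space with basis the isomorphism classes of the simple modules $V_A$, $A\in\Pi_n$; and $G_0(\mathbf{\Pi},\wedge)=\bigoplus_{n\ge0}G_0(\Bbbk\Pi_n,\wedge)$.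 The product on $G_0(\mathbf{\Pi},\wedge)$ is given by induction: for $A\in\Pi_n,B\in\Pi_m$, $V_A\cdot V_B=\mathrm{Ind}_{n,m}V_A\otimes V_B=\Bbbk\Pi_{n+m}\otimes_{\Bbbk\Pi_n\otimes\Bbbk\Pi_m}(V_A\otimes V_B)$, where $\Bbbk\Pi_n\otimes\Bbbk\Pi_m$ is embedded (non-unitally) in $\Bbbk\Pi_{n+m}$ via $\rho_{n,m}(C\otimes D)=C|D$; one has $V_A\cdot V_B=V_{A|B}$. The internal comultiplication is dual to the tensor product of modules with diagonal action, and is given by $\Delta^{\odot}(V_C)=\sum_{A\vee B=C}V_A\otimes V_B$ for $C\in\Pi_n$ (sum over pairs $(A,B)\in\Pi_n\times\Pi_n$). With these, $G_0(\mathbf{\Pi},\wedge)$ is a bialgebra. **$\mathsf{NCSym}$.** $\mathsf{NCSym}=\bigoplus_{d\ge0}\mathsf{NCSym}_d$ is the $\Bbbk$-algebra of symmetric functions in noncommutative variables $x_1,x_2,\dots$. The space $\mathsf{NCSym}_d$ has basis $\{\mathbf{m}_A\}_{A\in\Pi_d}$, where $\mathbf{m}_A=\sum x_{i_1}\cdots x_{i_d}$ is the formal sum over all sequences of positive integers such that $i_a=i_b$ iff $a,b$ are in the same part of $A$ (and $\mathbf{m}_\emptyset=1$). The product is, for $A\in\Pi_d$, $B\in\Pi_m$, $\mathbf{m}_A\mathbf{m}_B=\sum_{C\in\Pi_{d+m},\,C\wedge(\mathbf{1}_d|\mathbf{1}_m)=A|B}\mathbf{m}_C$, and the internal comultiplication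 is $\Delta^{\odot}(\mathbf{m}_A)=\sum_{B\wedge C=A}\mathbf{m}_B\otimes\mathbf{m}_C$. With these, $\mathsf{NCSym}$ is a bialgebra. **The basis $\mathbf{x}_A$.** Put $\mathbf{p}_A=\sum_{B\ge A}\mathbf{m}_B$ and $\mathbf{x}_A=\sum_{B\le A}\mu(B,A)\,\mathbf{p}_B$ for $A\in\Pi_n$; the $\mathbf{x}_A$ form a basis of $\mathsf{NCSym}$. -}

module Defs where

open import Algebra.Apartness.Bundles using (HeytingField; HeytingCommutativeRing)
open import Algebra.Bundles using (CommutativeRing)
open import Algebra.Module.Bundles.Raw using (RawLeftModule; RawBimodule; RawModule)
open import Algebra.Module.Morphism.Structures using (module LeftModuleMorphisms; module ModuleMorphisms)
import Algebra.Definitions.RawMonoid as RawMonoidDefinitions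
open import Data.Bool using (if_then_else_)
open import Data.Bool.Properties using () renaming (_≟_ to _≟ᵇ_)
open import Data.Fin using (Fin; _↑ˡ_; _↑ʳ_; splitAt)
open import Data.Fin.Properties using (all?; any?; splitAt⁻¹-↑ˡ; splitAt⁻¹-↑ʳ)
open import Data.Fin.Subset using (Subset; inside; outside; ⊥; ⊤; ⁅_⁆; _∩_; _∈_; _⊆_) renaming (∣_∣ to size)
open import Data.Fin.Subset.Properties using
  (_∈?_; _⊆?_; ∈⊤; x∈⁅x⁆; x∈⁅y⁆⇒x≡y; x∈p∩q⁺; x∈p∩q⁻; ∉⊥; drop-∷-⊆)
open import Data.List using (List; []; _∷_; [_]; _++_; map; filter; foldr; mapMaybe; cartesianProduct; cartesianProductWith)
open import Data.Maybe using () renaming (map to mapᴹ)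
open import Data.Nat as ℕ using (ℕ; zero; suc; s≤s)
import Data.Nat.Properties as ℕ
open import Data.Nat.Induction using () renaming (<-wellFounded to ℕ-<-wellFounded)
open import Data.Product using (Σ; ∃; _×_; _,_; proj₁; proj₂)
open import Data.Sum using (_⊎_; inj₁; inj₂)
open import Data.Vec using (Vec; []; _∷_; lookup; tabulate; replicate; zipWith; sum)
  renaming (_++_ to _++ᵛ_; map to mapᵛ)
open import Data.Vec.Properties using
  (lookup∘tabulate; lookup-replicate; lookup-zipWith; lookup-map; lookup-++ˡ; lookup-++ʳ; ≡-dec; []=⇒lookup; lookup⇒[]=)
open import Function using (_on_)
open import Induction.WellFounded using (WellFounded; Acc; acc; module Subrelation)
open import Level using (Level; _⊔_) renaming (suc to lsuc)
import Relation.Binary.Construct.On as On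
open import Relation.Binary using (Rel; DecidableEquality; Decidable)
open import Relation.Binary.PropositionalEquality using (_≡_; _≢_; refl; sym; trans; cong; cong₂; subst; subst₂)
open import Relation.Nullary using (¬_; Dec; yes; no; does; ¬?; _×-dec_; _→-dec_; recompute; contradiction; dec⇒maybe)
open import Relation.Nullary.Decidable using (map′)

private variable
  n m : ℕ

IsSetPartition : Vec (Subset n) n → Set
IsSetPartition v =
  (∀ i → i ∈ lookup v i) × (∀ i j → j ∈ lookup v i → lookup v j ≡ lookup v i)

-- The i-th entry of `part` is the part containing i, so the parts are
-- the entries of `part`.  The proof is irrelevant: two set partitions
-- are propositionally equal as soon as they have the same parts.
record SetPartition (n : ℕ) : Set where
  constructor mkSetPartition
  field
    part            : Vec (Subset n) n
    .isSetPartition : IsSetPartition part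

open SetPartition public using (part)

_≟ˢ_ : DecidableEquality (Subset n)
_≟ˢ_ = ≡-dec _≟ᵇ_

isSetPartition? : (v : Vec (Subset n) n) → Dec (IsSetPartition v)
isSetPartition? v =
  all? (λ i → i ∈? lookup v i) ×-dec
  all? (λ i → all? (λ j → (j ∈? lookup v i) →-dec (lookup v j ≟ˢ lookup v i)))

isPartition : (A : SetPartition n) → IsSetPartition (part A)
isPartition (mkSetPartition v p) = recompute (isSetPartition? v) p

part-injective : {A B : SetPartition n} → part A ≡ part B → A ≡ B
part-injective refl = refl

infix 4 _≟_ _≤_ _≤?_ _<_ _<?_

_≟_ : DecidableEquality (SetPartition n)
A ≟ B = map′ part-injective (cong part) (≡-dec _≟ˢ_ (part A) (part B))

_≤_ : Rel (SetPartition n) _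
A ≤ B = ∀ i → ∃ λ j → lookup (part A) i ⊆ lookup (part B) j

_≤?_ : Decidable (_≤_ {n})
A ≤? B = all? λ i → any? λ j → lookup (part A) i ⊆? lookup (part B) j

_<_ : Rel (SetPartition n) _
A < B = A ≤ B × A ≢ B

_<?_ : Decidable (_<_ {n})
A <? B = (A ≤? B) ×-dec ¬? (A ≟ B)

vecs : {X : Set} → List X → (n : ℕ) → List (Vec X n)
vecs xs zero    = [ [] ]
vecs xs (suc n) = cartesianProductWith _∷_ xs (vecs xs n)

-- Every set partition of [n] occurs exactly once in this list.
partitions : (n : ℕ) → List (SetPartition n)
partitions n = mapMaybe
  (λ v → mapᴹ (λ p → mkSetPartition v p) (dec⇒maybe (isSetPartition? v)))
  (vecs (vecs (inside ∷ outside ∷ []) n) n)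

𝟎 : SetPartition n
𝟎 {n} = mkSetPartition (tabulate ⁅_⁆) (self , coherent)
  where
  self : ∀ i → i ∈ lookup (tabulate ⁅_⁆) i
  self i rewrite lookup∘tabulate ⁅_⁆ i = x∈⁅x⁆ i
  coherent : ∀ (i j : Fin n) → j ∈ lookup (tabulate ⁅_⁆) i →
             lookup (tabulate ⁅_⁆) j ≡ lookup (tabulate ⁅_⁆) i
  coherent i j j∈ rewrite lookup∘tabulate ⁅_⁆ i | x∈⁅y⁆⇒x≡y i j∈ = lookup∘tabulate ⁅_⁆ i

𝟏 : SetPartition n
𝟏 {n} = mkSetPartition (replicate n ⊤) (self , coherent)
  where
  self : ∀ i → i ∈ lookup (replicate n ⊤) i
  self i rewrite lookup-replicate i (⊤ {n}) = ∈⊤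
  coherent : ∀ i j → j ∈ lookup (replicate n ⊤) i →
             lookup (replicate n ⊤) j ≡ lookup (replicate n ⊤) i
  coherent i j _ = trans (lookup-replicate j ⊤) (sym (lookup-replicate i ⊤))

infixr 7 _∧_
infixr 6 _∨_
infixr 5 _∣_

_∧_ : SetPartition n → SetPartition n → SetPartition n
A ∧ B = mkSetPartition (zipWith _∩_ (part A) (part B)) (self , coherent)
  where
  self : ∀ i → i ∈ lookup (zipWith _∩_ (part A) (part B)) i
  self i rewrite lookup-zipWith _∩_ i (part A) (part B) =
    x∈p∩q⁺ (proj₁ (isPartition A) i , proj₁ (isPartition B) i)
  coherent : ∀ i j → j ∈ lookup (zipWith _∩_ (part A) (part B)) i →
             lookup (zipWith _∩_ (part A) (part B)) j ≡ lookup (zipWith _∩_ (part A) (part B)) i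
  coherent i j j∈
    rewrite lookup-zipWith _∩_ i (part A) (part B)
          | lookup-zipWith _∩_ j (part A) (part B)
    with x∈p∩q⁻ _ _ j∈
  ... | j∈A , j∈B = cong₂ _∩_ (proj₂ (isPartition A) i j j∈A) (proj₂ (isPartition B) i j j∈B)

-- The least upper bound, as the meet of all upper bounds.
_∨_ : SetPartition n → SetPartition n → SetPartition n
_∨_ {n} A B = foldr _∧_ 𝟏 (filter (λ C → (A ≤? C) ×-dec (B ≤? C)) (partitions n))

-- Elements of [n] and shifted elements of [m] are the two halves of
-- Fin (n + m).
_∣_ : SetPartition n → SetPartition m → SetPartition (n ℕ.+ m)
_∣_ {n} {m} A B = mkSetPartition v (self , coherent)
  where
  vˡ : Vec (Subset (n ℕ.+ m)) n
  vˡ = mapᵛ (_++ᵛ ⊥ {m}) (part A)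

  vʳ : Vec (Subset (n ℕ.+ m)) m
  vʳ = mapᵛ (⊥ {n} ++ᵛ_) (part B)

  v : Vec (Subset (n ℕ.+ m)) (n ℕ.+ m)
  v = vˡ ++ᵛ vʳ

  eˡ : ∀ i → lookup v (i ↑ˡ m) ≡ lookup (part A) i ++ᵛ ⊥
  eˡ i = trans (lookup-++ˡ vˡ vʳ i) (lookup-map i _ (part A))

  eʳ : ∀ i → lookup v (n ↑ʳ i) ≡ ⊥ ++ᵛ lookup (part B) i
  eʳ i = trans (lookup-++ʳ vˡ vʳ i) (lookup-map i _ (part B))

  ∈ˡ⁺ : ∀ {i} {p : Subset n} {q : Subset m} → i ∈ p → i ↑ˡ m ∈ p ++ᵛ q
  ∈ˡ⁺ {i} {p} {q} i∈ = lookup⇒[]= _ _ (trans (lookup-++ˡ p q i) ([]=⇒lookup i∈))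

  ∈ˡ⁻ : ∀ {i} {p : Subset n} {q : Subset m} → i ↑ˡ m ∈ p ++ᵛ q → i ∈ p
  ∈ˡ⁻ {i} {p} {q} i∈ = lookup⇒[]= _ _ (trans (sym (lookup-++ˡ p q i)) ([]=⇒lookup i∈))

  ∈ʳ⁺ : ∀ {i} {p : Subset n} {q : Subset m} → i ∈ q → n ↑ʳ i ∈ p ++ᵛ q
  ∈ʳ⁺ {i} {p} {q} i∈ = lookup⇒[]= _ _ (trans (lookup-++ʳ p q i) ([]=⇒lookup i∈))

  ∈ʳ⁻ : ∀ {i} {p : Subset n} {q : Subset m} → n ↑ʳ i ∈ p ++ᵛ q → i ∈ q
  ∈ʳ⁻ {i} {p} {q} i∈ = lookup⇒[]= _ _ (trans (sym (lookup-++ʳ p q i)) ([]=⇒lookup i∈))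

  data Half : Fin (n ℕ.+ m) → Set where
    left  : ∀ i → Half (i ↑ˡ m)
    right : ∀ i → Half (n ↑ʳ i)

  half : ∀ i → Half i
  half i with splitAt n i in eq
  ... | inj₁ j = subst Half (splitAt⁻¹-↑ˡ eq) (left j)
  ... | inj₂ j = subst Half (splitAt⁻¹-↑ʳ eq) (right j)

  self : ∀ i → i ∈ lookup v i
  self i with half i
  ... | left  j = subst (j ↑ˡ m ∈_) (sym (eˡ j)) (∈ˡ⁺ (proj₁ (isPartition A) j))
  ... | right j = subst (n ↑ʳ j ∈_) (sym (eʳ j)) (∈ʳ⁺ (proj₁ (isPartition B) j))

  coherent : ∀ i j → j ∈ lookup v i → lookup v j ≡ lookup v i
  coherent i j j∈ with half i | half j
  ... | left i  | left j  = trans (eˡ j) (trans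
        (cong (_++ᵛ ⊥) (proj₂ (isPartition A) i j (∈ˡ⁻ (subst (_ ∈_) (eˡ i) j∈)))) (sym (eˡ i)))
  ... | left i  | right j = contradiction (∈ʳ⁻ {p = lookup (part A) i} (subst (_ ∈_) (eˡ i) j∈)) ∉⊥
  ... | right i | left j  = contradiction (∈ˡ⁻ {q = lookup (part B) i} (subst (_ ∈_) (eʳ i) j∈)) ∉⊥
  ... | right i | right j = trans (eʳ j) (trans
        (cong (⊥ ++ᵛ_) (proj₂ (isPartition B) i j (∈ʳ⁻ (subst (_ ∈_) (eʳ i) j∈)))) (sym (eʳ i)))

≤⇒⊆ : {A B : SetPartition n} → A ≤ B → ∀ i → lookup (part A) i ⊆ lookup (part B) i
≤⇒⊆ {A = A} {B} A≤B i x∈ with A≤B i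
... | j , A⊆B = subst (_ ∈_) (sym (proj₂ (isPartition B) j i (A⊆B (proj₁ (isPartition A) i)))) (A⊆B x∈)

weight : SetPartition n → ℕ
weight A = sum (mapᵛ size (part A))

private
  ⊆-size : {p q : Subset n} → p ⊆ q → p ≡ q ⊎ size p ℕ.< size q
  ⊆-size {p = []} {[]} _ = inj₁ refl
  ⊆-size {p = s ∷ p} {t ∷ q} sp⊆tq with ⊆-size (drop-∷-⊆ sp⊆tq)
  ⊆-size {p = inside  ∷ p} {inside  ∷ q} _ | inj₁ p≡q = inj₁ (cong (inside ∷_) p≡q)
  ⊆-size {p = inside  ∷ p} {inside  ∷ q} _ | inj₂ p<q = inj₂ (s≤s p<q)
  ⊆-size {p = outside ∷ p} {outside ∷ q} _ | inj₁ p≡q = inj₁ (cong (outside ∷_) p≡q)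
  ⊆-size {p = outside ∷ p} {outside ∷ q} _ | inj₂ p<q = inj₂ p<q
  ⊆-size {p = outside ∷ p} {inside  ∷ q} _ | inj₁ refl = inj₂ ℕ.≤-refl
  ⊆-size {p = outside ∷ p} {inside  ∷ q} _ | inj₂ p<q = inj₂ (ℕ.m<n⇒m<1+n p<q)
  ⊆-size {p = inside  ∷ p} {outside ∷ q} sp⊆tq | _ with sp⊆tq Data.Vec.here
  ... | ()

  sum-size : ∀ {k} (u v : Vec (Subset n) k) → (∀ i → lookup u i ⊆ lookup v i) →
             u ≡ v ⊎ sum (mapᵛ size u) ℕ.< sum (mapᵛ size v)
  sum-size [] [] _ = inj₁ refl
  sum-size (p ∷ u) (q ∷ v) u⊆v
    with ⊆-size {p = p} {q} (u⊆v Fin.zero) | sum-size u v (λ i → u⊆v (Fin.suc i))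
  ... | inj₁ refl | inj₁ refl = inj₁ refl
  ... | inj₁ refl | inj₂ u<v  = inj₂ (ℕ.+-monoʳ-< (size p) u<v)
  ... | inj₂ p<q  | inj₁ refl = inj₂ (ℕ.+-monoˡ-< _ p<q)
  ... | inj₂ p<q  | inj₂ u<v  = inj₂ (ℕ.+-mono-< p<q u<v)

<⇒weight< : {A B : SetPartition n} → A < B → weight A ℕ.< weight B
<⇒weight< {A = A} {B} (A≤B , A≢B) with sum-size (part A) (part B) (≤⇒⊆ {A = A} {B} A≤B)
... | inj₁ A≡B = contradiction (part-injective A≡B) A≢B
... | inj₂ A<B = A<B

<-wellFounded : WellFounded (_<_ {n})
<-wellFounded = Subrelation.wellFounded (λ {A} {B} → <⇒weight< {A = A} {B})
  (On.wellFounded weight ℕ-<-wellFounded)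

private variable
  g r s t u ℓ m₁ m₂ ℓm₁ ℓm₂ : Level

-- A list is the formal sum of its entries; this is equality of formal
-- sums subject to the relations ∼.
data Presented {G : Set g} (_∼_ : Rel (List G) r) : Rel (List G) (g ⊔ r) where
  relation : ∀ {x y} → x ∼ y → Presented _∼_ x y
  ≋-refl   : ∀ {x} → Presented _∼_ x x
  ≋-sym    : ∀ {x y} → Presented _∼_ x y → Presented _∼_ y x
  ≋-trans  : ∀ {x y z} → Presented _∼_ x y → Presented _∼_ y z → Presented _∼_ x z
  ++-cong  : ∀ {x x′ y y′} → Presented _∼_ x x′ → Presented _∼_ y y′ →
             Presented _∼_ (x ++ y) (x′ ++ y′)
  ++-comm  : ∀ x y → Presented _∼_ (x ++ y) (y ++ x)

module _ {R : Set r} {S : Set s} {T : Set t}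
         (M : RawBimodule R S m₁ ℓm₁) (N : RawBimodule S T m₂ ℓm₂) where
  private
    module M = RawBimodule M
    module N = RawBimodule N

  -- Tensor product over an arbitrary middle ring S.
  data TensorRelation : Rel (List (M.Carrierᴹ × N.Carrierᴹ)) (s ⊔ m₁ ⊔ ℓm₁ ⊔ m₂ ⊔ ℓm₂) where
    ⊗-cong     : ∀ {x x′ y y′} → x M.≈ᴹ x′ → y N.≈ᴹ y′ →
                 TensorRelation [ x , y ] [ x′ , y′ ]
    ⊗-addˡ     : ∀ x x′ y → TensorRelation [ x M.+ᴹ x′ , y ] ((x , y) ∷ (x′ , y) ∷ [])
    ⊗-addʳ     : ∀ x y y′ → TensorRelation [ x , y N.+ᴹ y′ ] ((x , y) ∷ (x , y′) ∷ [])
    ⊗-zeroˡ    : ∀ y → TensorRelation [ M.0ᴹ , y ] []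
    ⊗-zeroʳ    : ∀ x → TensorRelation [ x , N.0ᴹ ] []
    ⊗-balanced : ∀ x a y → TensorRelation [ x M.*ᵣ a , y ] [ x , a N.*ₗ y ]

  infixr 7 _⊗_

  _⊗_ : RawBimodule R T (m₁ ⊔ m₂) (s ⊔ m₁ ⊔ ℓm₁ ⊔ m₂ ⊔ ℓm₂)
  _⊗_ = record
    { Carrierᴹ = List (M.Carrierᴹ × N.Carrierᴹ)
    ; _≈ᴹ_     = Presented TensorRelation
    ; _+ᴹ_     = _++_
    ; _*ₗ_     = λ a → map (λ (x , y) → a M.*ₗ x , y)
    ; _*ᵣ_     = λ z a → map (λ (x , y) → x , y N.*ᵣ a) z
    ; 0ᴹ       = []
    ; -ᴹ_      = map (λ (x , y) → M.-ᴹ x , y)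
    }

infix 4 _≅_

_≅_ : ∀ {R : Set r} {T : Set t} {U : Set u} →
      RawBimodule R T m₁ ℓm₁ → RawBimodule R U m₂ ℓm₂ → Set (r ⊔ m₁ ⊔ m₂ ⊔ ℓm₁ ⊔ ℓm₂)
M ≅ N = ∃ (LeftModuleMorphisms.IsLeftModuleIsomorphism
             (RawBimodule.rawLeftModule M) (RawBimodule.rawLeftModule N))

-- As for the raw bundles of the library, the laws are not part of the
-- structure.
record RawBialgebra (k : Set r) m ℓ : Set (r ⊔ lsuc (m ⊔ ℓ)) where
  field
    rawModule : RawModule k m ℓ

  open RawBimodule rawModule public

  field
    _·_ : Carrierᴹ → Carrierᴹ → Carrierᴹ
    𝟙   : Carrierᴹ
    Δ   : Carrierᴹ → RawBimodule.Carrierᴹ (rawModule ⊗ rawModule)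
    ε   : Carrierᴹ → k

module _ {c ℓ₁ ℓ₂} (K : HeytingField c ℓ₁ ℓ₂) where
  open HeytingField K using (_≈_; _+_; _*_; -_; 0#; 1#; heytingCommutativeRing) renaming (Carrier to k)
  open HeytingCommutativeRing heytingCommutativeRing using (commutativeRing)
  open CommutativeRing commutativeRing using (+-rawMonoid)

  CharacteristicZero : Set ℓ₁
  CharacteristicZero = ∀ n → ¬ (RawMonoidDefinitions._×_ +-rawMonoid (suc n) 1# ≈ 0#)

  record IsBialgebraIsomorphism
    (P : RawBialgebra k m₁ ℓm₁) (Q : RawBialgebra k m₂ ℓm₂)
    (f : RawBialgebra.Carrierᴹ P → RawBialgebra.Carrierᴹ Q) : Set (c ⊔ ℓ₁ ⊔ m₁ ⊔ m₂ ⊔ ℓm₁ ⊔ ℓm₂) where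
    private
      module P = RawBialgebra P
      module Q = RawBialgebra Q
      module Q⊗Q = RawBimodule (Q.rawModule ⊗ Q.rawModule)
    field
      isModuleIsomorphism : ModuleMorphisms.IsModuleIsomorphism P.rawModule Q.rawModule f
      ·-homo : ∀ x y → f (x P.· y) Q.≈ᴹ (f x Q.· f y)
      𝟙-homo : f P.𝟙 Q.≈ᴹ Q.𝟙
      Δ-homo : ∀ x → Q.Δ (f x) Q⊗Q.≈ᴹ map (λ (y , z) → f y , f z) (P.Δ x)
      ε-homo : ∀ x → Q.ε (f x) ≈ P.ε x

  module _ {X : Set} (_≃_ : Rel X ℓ) where

    data FreeRelation : Rel (List (k × X)) (c ⊔ ℓ₁ ⊔ ℓ) where
      term-cong : ∀ {a b x y} → a ≈ b → x ≃ y → FreeRelation [ a , x ] [ b , y ]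
      term-add  : ∀ a b x → FreeRelation [ a + b , x ] ((a , x) ∷ (b , x) ∷ [])
      term-zero : ∀ x → FreeRelation [ 0# , x ] []

    Free : RawModule k c (c ⊔ ℓ₁ ⊔ ℓ)
    Free = record
      { Carrierᴹ = List (k × X)
      ; _≈ᴹ_     = Presented FreeRelation
      ; _+ᴹ_     = _++_
      ; _*ₗ_     = λ a → map (λ (b , x) → a * b , x)
      ; _*ᵣ_     = λ f a → map (λ (b , x) → b * a , x) f
      ; 0ᴹ       = []
      ; -ᴹ_      = map (λ (b , x) → - b , x)
      }

  basis : {X : Set} → X → List (k × X)
  basis x = [ 1# , x ]

  module _ (M : RawModule k m₁ ℓm₁) where
    open RawBimodule M

    ∑ : {I : Set g} → List I → (I → Carrierᴹ) → Carrierᴹ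
    ∑ is φ = foldr (λ i z → φ i +ᴹ z) 0ᴹ is

    linear : {X : Set} → (X → Carrierᴹ) → List (k × X) → Carrierᴹ
    linear φ = foldr (λ (a , x) z → a *ₗ φ x +ᴹ z) 0ᴹ

    bilinear : {X Y : Set} → (X → Y → Carrierᴹ) → List (k × X) → List (k × Y) → Carrierᴹ
    bilinear φ f g = linear (λ x → linear (φ x) g) f

  scalars : RawModule k c ℓ₁
  scalars = record
    { Carrierᴹ = k ; _≈ᴹ_ = _≈_ ; _+ᴹ_ = _+_ ; _*ₗ_ = _*_ ; _*ᵣ_ = _*_ ; 0ᴹ = 0# ; -ᴹ_ = -_ }

  -- The Möbius function, by μ(A,B) = -Σ_{A ≤ C < B} μ(A,C), taken in k.
  möbius-acc : (A B : SetPartition n) → Acc _<_ B → k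
  möbius-acc {n} A B (acc rs) with A ≟ B
  ... | yes _ = 1#
  ... | no  _ = - ∑ scalars (partitions n) term
    where
    term : SetPartition n → k
    term C with (A ≤? C) ×-dec (C <? B)
    ... | yes (_ , C<B) = möbius-acc A C (rs C<B)
    ... | no  _         = 0#

  μ : (A B : SetPartition n) → k
  μ A B = möbius-acc A B (<-wellFounded B)

  kΠ : ℕ → RawModule k c (c ⊔ ℓ₁)
  kΠ n = Free (_≡_ {A = SetPartition n})

  ∣kΠ∣ : ℕ → Set c
  ∣kΠ∣ n = RawBimodule.Carrierᴹ (kΠ n)

  infixr 7 _∧ₖ_

  _∧ₖ_ : ∣kΠ∣ n → ∣kΠ∣ n → ∣kΠ∣ n
  _∧ₖ_ {n} = bilinear (kΠ n) (λ A B → basis (A ∧ B))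

  e : SetPartition n → ∣kΠ∣ n
  e {n} A = ∑ (kΠ n) (filter (_≤? A) (partitions n)) (λ B → [ μ B A , B ])

  -- A module over the k-algebra kΠ_n is presented as a (kΠ_n , k)-bimodule,
  -- the right action being that of the scalars.
  Moduleᵖ : ℕ → ∀ m ℓ → Set (c ⊔ lsuc (m ⊔ ℓ))
  Moduleᵖ n m ℓ = RawBimodule (∣kΠ∣ n) k m ℓ

  vectorSpace : Moduleᵖ n m₁ ℓm₁ → RawModule k m₁ ℓm₁
  vectorSpace M = record
    { Carrierᴹ = Carrierᴹ ; _≈ᴹ_ = _≈ᴹ_ ; _+ᴹ_ = _+ᴹ_ ; _*ₗ_ = λ a x → x *ᵣ a ; _*ᵣ_ = _*ᵣ_
    ; 0ᴹ = 0ᴹ ; -ᴹ_ = -ᴹ_ }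
    where open RawBimodule M

  -- V A = kΠ_n ∧ e_A as the image of x ↦ x ∧ e_A: the element x ∧ e_A is
  -- represented by x, and equality is that of the images in kΠ_n.
  V : SetPartition n → Moduleᵖ n c (c ⊔ ℓ₁)
  V {n} A = record
    { Carrierᴹ = ∣kΠ∣ n
    ; _≈ᴹ_     = λ x y → (x ∧ₖ e A) ≈ᴹ (y ∧ₖ e A)
    ; _+ᴹ_     = _+ᴹ_
    ; _*ₗ_     = _∧ₖ_
    ; _*ᵣ_     = _*ᵣ_
    ; 0ᴹ       = 0ᴹ
    ; -ᴹ_      = -ᴹ_
    }
    where open RawBimodule (kΠ n)

  kΠ⊗kΠ : ℕ → ℕ → Set c
  kΠ⊗kΠ n m = RawBimodule.Carrierᴹ (kΠ n ⊗ kΠ m)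

  ρ : kΠ⊗kΠ n m → ∣kΠ∣ (n ℕ.+ m)
  ρ {n} {m} z = ∑ (kΠ (n ℕ.+ m)) z
    (λ (x , y) → bilinear (kΠ (n ℕ.+ m)) (λ C D → basis (C ∣ D)) x y)

  -- M ⊗ N over k, as a (kΠ_n ⊗ kΠ_m)-module.
  infixr 7 _⊠_

  _⊠_ : Moduleᵖ n m₁ ℓm₁ → Moduleᵖ m m₂ ℓm₂ →
        RawBimodule (kΠ⊗kΠ n m) k (m₁ ⊔ m₂) (c ⊔ m₁ ⊔ ℓm₁ ⊔ m₂ ⊔ ℓm₂)
  M ⊠ N = record
    { RawBimodule (vectorSpace M ⊗ vectorSpace N)
    ; _*ₗ_ = cartesianProductWith (λ (x , y) (v , w) → x M.*ₗ v , y N.*ₗ w)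
    }
    where
    module M = RawBimodule M
    module N = RawBimodule N

  -- kΠ_{n+m} as a right module over kΠ_n ⊗ kΠ_m along ρ.
  restricted : ∀ n m → RawBimodule (∣kΠ∣ (n ℕ.+ m)) (kΠ⊗kΠ n m) c (c ⊔ ℓ₁)
  restricted n m = record
    { Carrierᴹ = Carrierᴹ ; _≈ᴹ_ = _≈ᴹ_ ; _+ᴹ_ = _+ᴹ_
    ; _*ₗ_ = _∧ₖ_
    ; _*ᵣ_ = λ x z → x ∧ₖ ρ z
    ; 0ᴹ = 0ᴹ ; -ᴹ_ = -ᴹ_ }
    where open RawBimodule (kΠ (n ℕ.+ m))

  Ind : ∀ n m → RawBimodule (kΠ⊗kΠ n m) k m₁ ℓm₁ → Moduleᵖ (n ℕ.+ m) (c ⊔ m₁) (c ⊔ ℓ₁ ⊔ m₁ ⊔ ℓm₁)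
  Ind n m M = restricted n m ⊗ M

  -- M ⊗ N over k with the diagonal action C · (v ⊗ w) = (C · v) ⊗ (C · w).
  infixr 7 _⊗ᵈ_

  _⊗ᵈ_ : Moduleᵖ n m₁ ℓm₁ → Moduleᵖ n m₂ ℓm₂ →
         Moduleᵖ n (m₁ ⊔ m₂) (c ⊔ m₁ ⊔ ℓm₁ ⊔ m₂ ⊔ ℓm₂)
  M ⊗ᵈ N = record
    { RawBimodule (M ⊠ N)
    ; _*ₗ_ = λ x → RawBimodule._*ₗ_ (M ⊠ N) (map (λ (a , C) → [ a , C ] , basis C) x)
    }

  data _≃_ : Rel (∃ SetPartition) (c ⊔ ℓ₁) where
    iso : {A B : SetPartition n} → V A ≅ V B → (n , A) ≃ (n , B)

  -- The basis consists of the isomorphism classes of the modules V A.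
  -- The product and the comultiplication are given by the classes of
  -- Ind n m (V A ⊠ V B) ≅ V (A ∣ B) and of V A ⊗ᵈ V B ≅ V (A ∨ B); the
  -- counit is the one determined by the comultiplication.
  G₀ : RawBialgebra k c (c ⊔ ℓ₁)
  G₀ = record
    { rawModule = G
    ; _·_ = bilinear G λ (n , A) (m , B) → basis (n ℕ.+ m , A ∣ B)
    ; 𝟙   = basis (0 , 𝟎)
    ; Δ   = linear (G ⊗ G) λ (n , C) →
              ∑ (G ⊗ G)
                (filter (λ (A , B) → (A ∨ B) ≟ C) (cartesianProduct (partitions n) (partitions n)))
                (λ (A , B) → [ basis (n , A) , basis (n , B) ])
    ; ε   = linear scalars λ (n , A) → if does (A ≟ 𝟎) then 1# else 0#
    }
    where G = Free _≃_

  -- Whether the word x_{i_1} ⋯ x_{i_d} occurs in 𝐦_A: i_a = i_b iff a and b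
  -- are in the same part of A.
  Occurs : Vec ℕ n → SetPartition n → Set
  Occurs w A = ∀ a b →
    (lookup w a ≡ lookup w b → b ∈ lookup (part A) a) ×
    (b ∈ lookup (part A) a → lookup w a ≡ lookup w b)

  occurs? : (w : Vec ℕ n) (A : SetPartition n) → Dec (Occurs w A)
  occurs? w A = all? λ a → all? λ b →
    ((lookup w a ℕ.≟ lookup w b) →-dec (b ∈? lookup (part A) a)) ×-dec
    ((b ∈? lookup (part A) a) →-dec (lookup w a ℕ.≟ lookup w b))

  𝐦-coefficient : Vec ℕ n → ∃ SetPartition → k
  𝐦-coefficient {n} w (d , A) with d ℕ.≟ n
  ... | yes refl = if does (occurs? w A) then 1# else 0#
  ... | no  _    = 0#

  coefficient : Vec ℕ n → List (k × ∃ SetPartition) → k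
  coefficient w = linear scalars (𝐦-coefficient w)

  -- Elements are linear combinations of the formal series 𝐦_A, identified
  -- when they are equal as formal series in noncommuting variables
  -- indexed by ℕ.
  NCSymModule : RawModule k c ℓ₁
  NCSymModule = record
    { RawBimodule (Free (_≡_ {A = ∃ SetPartition}))
    ; _≈ᴹ_ = λ f g → ∀ {n} (w : Vec ℕ n) → coefficient w f ≈ coefficient w g
    }

  NCSym : RawBialgebra k c ℓ₁
  NCSym = record
    { rawModule = N
    ; _·_ = bilinear N λ (d , A) (m , B) →
              ∑ N (filter (λ C → (C ∧ (𝟏 {d} ∣ 𝟏 {m})) ≟ (A ∣ B)) (partitions (d ℕ.+ m)))
                  (λ C → basis (d ℕ.+ m , C))
    ; 𝟙   = basis (0 , 𝟎)
    ; Δ   = linear (N ⊗ N) λ (d , A) →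
              ∑ (N ⊗ N)
                (filter (λ (B , C) → (B ∧ C) ≟ A) (cartesianProduct (partitions d) (partitions d)))
                (λ (B , C) → [ basis (d , B) , basis (d , C) ])
    ; ε   = linear scalars λ (d , A) → if does (A ≟ 𝟏) then 1# else 0#
    }
    where N = NCSymModule

  private
    module G₀    = RawBialgebra G₀
    module NCSym = RawBialgebra NCSym

  𝐦 : SetPartition n → NCSym.Carrierᴹ
  𝐦 {n} A = basis (n , A)

  𝐩 : SetPartition n → NCSym.Carrierᴹ
  𝐩 {n} A = ∑ NCSym.rawModule (filter (A ≤?_) (partitions n)) 𝐦

  𝐱 : SetPartition n → NCSym.Carrierᴹ
  𝐱 {n} A = ∑ NCSym.rawModule (filter (_≤? A) (partitions n)) (λ B → μ B A NCSym.*ₗ 𝐩 B)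

  F : G₀.Carrierᴹ → NCSym.Carrierᴹ
  F = linear NCSym.rawModule (λ (n , A) → 𝐱 A)

-- The simple module V A affords the character χ A of kΠ_n with χ A (B) = [A ≤ B],
-- and the characters separate the points of kΠ_n because ζ is invertible.  A
-- module is isomorphic to V A as soon as it has a bijective linear functional on
-- which kΠ_n acts through χ A.  So induction rests on the equivalence
-- A ∣ B ≤ C ∣ D ⇔ A ≤ C, B ≤ D, and the diagonal action on A ∨ B ≤ C ⇔ A ≤ C, B ≤ C.
--
-- F (V A) = 𝐱 A is the image of e A under the linear map B ↦ 𝐩 B.  This map is
-- multiplicative along ρ since 𝐩 C · 𝐩 D = 𝐩 (C ∣ D), and ρ (e A ⊗ e B) = e (A ∣ B).
-- Moreover Δ (𝐩 B) = 𝐩 B ⊗ 𝐩 B and 𝐩 B = Σ_{E ≤ B} 𝐱 E, so that the coefficient of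
-- 𝐱 D ⊗ 𝐱 E in Δ (𝐱 C) is Σ_B μ(B,C) [D ∨ E ≤ B] = [D ∨ E = C].  Two Möbius
-- inversions, from 𝐱 to 𝐩 and from 𝐩 to 𝐦, make F bijective.

module Submission where

open import Defs
open import Algebra.Apartness.Bundles using (HeytingField; HeytingCommutativeRing)
open import Algebra.Bundles using (CommutativeRing)
open import Algebra.Module.Bundles.Raw using (RawBimodule; RawModule)
open import Algebra.Module.Morphism.Structures using (module LeftModuleMorphisms; module ModuleMorphisms)
open import Algebra.Module.Structures using (IsLeftSemimodule)
open import Algebra.Structures using (IsCommutativeMonoid)
open import Data.Bool using (Bool; true; false; if_then_else_)
open import Data.Empty using (⊥-elim)
open import Data.Fin using (Fin; _↑ˡ_; _↑ʳ_; splitAt)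
open import Data.Fin.Properties using (splitAt⁻¹-↑ˡ; splitAt⁻¹-↑ʳ)
open import Data.Fin.Subset using (Subset; inside; outside; ⊥; ⊤; _∩_; _∈_)
open import Data.Fin.Subset.Properties using (_∈?_; ∈⊤; x∈⁅y⁆⇒x≡y; x∈p∩q⁺; x∈p∩q⁻; ∉⊥; ⊆-antisym)
open import Data.List using
  (List; []; _∷_; [_]; _++_; map; filter; foldr; mapMaybe; cartesianProduct; cartesianProductWith; deduplicate)
open import Data.List.Membership.Propositional using () renaming (_∈_ to _∈ᴸ_; _∉_ to _∉ᴸ_)
open import Data.List.Membership.Propositional.Properties using
  (∈-cartesianProductWith⁺; ∈-filter⁺; ∈-++⁺ˡ; ∈-++⁺ʳ; ∈-deduplicate⁺)
import Data.List.Properties as List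
open import Data.List.Relation.Unary.All as All using (All; []; _∷_)
import Data.List.Relation.Unary.All.Properties as All
open import Data.List.Relation.Unary.AllPairs using ([]; _∷_)
open import Data.List.Relation.Unary.Any as Any using (here; there)
import Data.List.Relation.Unary.Any.Properties as Any
open import Data.List.Relation.Unary.Unique.DecPropositional.Properties using (deduplicate-!)
open import Data.List.Relation.Unary.Unique.Propositional using (Unique)
import Data.List.Relation.Unary.Unique.Propositional.Properties as Unique
open import Data.Maybe using (Maybe; just; nothing) renaming (map to mapᴹ)
import Data.Maybe.Relation.Unary.All as Maybe
import Data.Maybe.Relation.Unary.Any as MaybeAny
open import Data.Nat as ℕ using (ℕ; zero; suc)
import Data.Nat.Properties as ℕ
open import Data.Product using (∃; _×_; _,_; proj₁; proj₂)
open import Data.Product.Properties using (≡-dec)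
open import Data.Sum using (inj₁; inj₂)
open import Data.Vec using (Vec; []; _∷_; lookup; tabulate) renaming (_++_ to _++ᵛ_; map to mapᵛ)
import Data.Vec.Properties as Vec
open import Function using (_∘_; id)
open import Function.Bundles using (_⇔_; mk⇔; module Equivalence)
open import Induction.WellFounded using (Acc; acc)
open import Level using (Level; 0ℓ)
open import Relation.Binary using (Rel; IsDecEquivalence; IsEquivalence; DecidableEquality)
open import Relation.Binary.PropositionalEquality using (_≡_; _≢_; refl; sym; trans; cong; cong₂; subst)
import Relation.Binary.Reasoning.Setoid as SetoidReasoning
open import Relation.Nullary using (¬_; Dec; yes; no; does; _×-dec_; contradiction; dec⇒maybe)
open import Relation.Nullary.Decidable using (dec-true; dec-false; does-⇔; map′)

-- Equality of scalars in a Heyting field need not be decidable, and the modules here are types of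
-- formal sums under a generated equality, so no normal form can be computed by discarding zero
-- terms. Equality is instead reduced to scalar-valued functionals: all characters in `kΠ`, one
-- character in `V A`, coefficients of words in `NCSym`. Conditions on summation indices become
-- brackets with values 0 and 1, and the identities become computations in the incidence algebra of
-- the partition lattice. Three points need more than this. The basis of `G₀` consists of
-- isomorphism classes, so for `F` to be well defined `V A ≅ V B` must force `A ≡ B`; this is where
-- `1# ≉ 0#` enters. Elements of `NCSym` are compared as series, so recovering the coefficient at
-- `𝐦 A` takes a word whose kernel is `A`. Finally, `ρ` is not unital and the left factor of an
-- induced module is compared in all of `kΠ`, where one character does not suffice; hence an induced
-- module is normalised at `e (A ∣ B)` and not at `𝟏`.

private variable
  n m : ℕ

-- Set partitions as equivalence relations

-- A record, so that i, A and j can be inferred from i ∼[ A ] j.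
record _∼[_]_ (i : Fin n) (A : SetPartition n) (j : Fin n) : Set where
  constructor mk∼
  field ∈part : j ∈ lookup (part A) i

open _∼[_]_

infix 4 _∼[_]_

∼-refl : (A : SetPartition n) → ∀ {i} → i ∼[ A ] i
∼-refl A = mk∼ (proj₁ (isPartition A) _)

∼-part : (A : SetPartition n) → ∀ {i j} → i ∼[ A ] j → lookup (part A) j ≡ lookup (part A) i
∼-part A (mk∼ j∈) = proj₂ (isPartition A) _ _ j∈

∼-sym : (A : SetPartition n) → ∀ {i j} → i ∼[ A ] j → j ∼[ A ] i
∼-sym A i∼j = mk∼ (subst (_ ∈_) (sym (∼-part A i∼j)) (∈part (∼-refl A)))

∼-trans : (A : SetPartition n) → ∀ {i j l} → i ∼[ A ] j → j ∼[ A ] l → i ∼[ A ] l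
∼-trans A i∼j (mk∼ l∈) = mk∼ (subst (_ ∈_) (∼-part A i∼j) l∈)

≤⁺ : (A B : SetPartition n) → (∀ {i j} → i ∼[ A ] j → i ∼[ B ] j) → A ≤ B
≤⁺ A B A⇒B i = i , λ j∈ → ∈part (A⇒B (mk∼ j∈))

≤⁻ : (A B : SetPartition n) → A ≤ B → ∀ {i j} → i ∼[ A ] j → i ∼[ B ] j
≤⁻ A B A≤B {i} (mk∼ j∈) = mk∼ (≤⇒⊆ {A = A} {B} A≤B i j∈)

≤-refl : (A : SetPartition n) → A ≤ A
≤-refl A = ≤⁺ A A id

≤-trans : (A B C : SetPartition n) → A ≤ B → B ≤ C → A ≤ C
≤-trans A B C A≤B B≤C = ≤⁺ A C (≤⁻ B C B≤C ∘ ≤⁻ A B A≤B)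

≤-antisym : (A B : SetPartition n) → A ≤ B → B ≤ A → A ≡ B
≤-antisym A B A≤B B≤A = part-injective (lookup-injective λ i →
  ⊆-antisym (λ j∈ → ∈part (≤⁻ A B A≤B (mk∼ j∈))) (λ j∈ → ∈part (≤⁻ B A B≤A (mk∼ j∈))))
  where
  lookup-injective : ∀ {k} {X : Set} {u v : Vec X k} → (∀ i → lookup u i ≡ lookup v i) → u ≡ v
  lookup-injective {u = u} {v} u≗v =
    trans (sym (Vec.tabulate∘lookup u)) (trans (Vec.tabulate-cong u≗v) (Vec.tabulate∘lookup v))

∼-∧⁺ : (A B : SetPartition n) → ∀ {i j} → i ∼[ A ] j → i ∼[ B ] j → i ∼[ A ∧ B ] j
∼-∧⁺ A B {i} (mk∼ j∈A) (mk∼ j∈B) =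
  mk∼ (subst (_ ∈_) (sym (Vec.lookup-zipWith _∩_ i (part A) (part B))) (x∈p∩q⁺ (j∈A , j∈B)))

∼-∧⁻ : (A B : SetPartition n) → ∀ {i j} → i ∼[ A ∧ B ] j → i ∼[ A ] j × i ∼[ B ] j
∼-∧⁻ A B {i} (mk∼ j∈) =
  let j∈A , j∈B = x∈p∩q⁻ _ _ (subst (_ ∈_) (Vec.lookup-zipWith _∩_ i (part A) (part B)) j∈)
  in mk∼ j∈A , mk∼ j∈B

≤∧⇔ : (A B C : SetPartition n) → C ≤ A ∧ B ⇔ (C ≤ A × C ≤ B)
≤∧⇔ A B C = mk⇔
  (λ C≤ → ≤⁺ C A (proj₁ ∘ ∼-∧⁻ A B ∘ ≤⁻ C (A ∧ B) C≤) , ≤⁺ C B (proj₂ ∘ ∼-∧⁻ A B ∘ ≤⁻ C (A ∧ B) C≤))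
  (λ (C≤A , C≤B) → ≤⁺ C (A ∧ B) λ i∼j → ∼-∧⁺ A B (≤⁻ C A C≤A i∼j) (≤⁻ C B C≤B i∼j))

∧≤ : (A B : SetPartition n) → A ∧ B ≤ A × A ∧ B ≤ B
∧≤ A B = Equivalence.to (≤∧⇔ A B (A ∧ B)) (≤-refl (A ∧ B))

≤𝟏 : (A : SetPartition n) → A ≤ 𝟏
≤𝟏 A = ≤⁺ A 𝟏 λ {i} _ → mk∼ (subst (_ ∈_) (sym (Vec.lookup-replicate i ⊤)) ∈⊤)

𝟎≤ : (A : SetPartition n) → 𝟎 ≤ A
𝟎≤ A = ≤⁺ 𝟎 A λ {i} {j} (mk∼ j∈) →
  subst (i ∼[ A ]_) (sym (x∈⁅y⁆⇒x≡y i (subst (j ∈_) (Vec.lookup∘tabulate _ i) j∈))) (∼-refl A)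

-- Enumeration of the set partitions

mapMaybe-unique : ∀ {X Y : Set} {f : X → Maybe Y} →
  (∀ {x x′ y} → f x ≡ just y → f x′ ≡ just y → x ≡ x′) →
  ∀ {xs} → Unique xs → Unique (mapMaybe f xs)
mapMaybe-unique f-inj [] = []
mapMaybe-unique {f = f} f-inj {x ∷ xs} (x∉ ∷ xs!) with f x in fx
... | nothing = mapMaybe-unique f-inj xs!
... | just y  = All.mapMaybe⁺ (All.map⁺ (All.map fresh x∉)) ∷ mapMaybe-unique f-inj xs!
  where
  fresh : ∀ {x′} → x ≢ x′ → Maybe.All (y ≢_) (f x′)
  fresh {x′} x≢x′ with f x′ in fx′
  ... | nothing = Maybe.nothing
  ... | just y′ = Maybe.just λ { refl → x≢x′ (f-inj fx fx′) }

vecs-unique : ∀ {X : Set} {xs : List X} → Unique xs → ∀ k → Unique (vecs xs k)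
vecs-unique xs! zero    = [] ∷ []
vecs-unique xs! (suc k) =
  Unique.cartesianProductWith⁺ _∷_ Vec.∷-injective xs! (vecs-unique xs! k)

vecs-complete : ∀ {X : Set} {xs : List X} → (∀ x → x ∈ᴸ xs) → ∀ {k} (v : Vec X k) → v ∈ᴸ vecs xs k
vecs-complete xs∋ []      = here refl
vecs-complete xs∋ (x ∷ v) = ∈-cartesianProductWith⁺ _∷_ (xs∋ x) (vecs-complete xs∋ v)

-- The proof field is irrelevant, so a set partition determines the vector it came from, and the
-- candidate vectors are distinct. With completeness this makes a sum over `partitions n` a sum over
-- the set of partitions.
partitions-unique : ∀ n → Unique (partitions n)
partitions-unique n = mapMaybe-unique justified
  (vecs-unique (vecs-unique (((λ ()) ∷ []) ∷ [] ∷ []) n) n)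
  where
  justified : ∀ {v v′ : Vec (Subset n) n} {A} →
    mapᴹ (λ p → mkSetPartition v p) (dec⇒maybe (isSetPartition? v)) ≡ just A →
    mapᴹ (λ p → mkSetPartition v′ p) (dec⇒maybe (isSetPartition? v′)) ≡ just A → v ≡ v′
  justified {v} {v′} eq eq′ with isSetPartition? v | isSetPartition? v′
  justified refl refl | yes _ | yes _ = refl

partitions-complete : (A : SetPartition n) → A ∈ᴸ partitions n
partitions-complete {n} A = Any.mapMaybe⁺ _ _
  (Any.map⁺ (Any.map found (vecs-complete (vecs-complete booleans) (part A))))
  where
  booleans : ∀ b → b ∈ᴸ (inside ∷ outside ∷ [])
  booleans true  = here refl
  booleans false = there (here refl)
  found : ∀ {v} → part A ≡ v →
    MaybeAny.Any (A ≡_) (mapᴹ (λ p → mkSetPartition v p) (dec⇒maybe (isSetPartition? v)))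
  found refl with isSetPartition? (part A)
  -- The decided proof need not be the one stored in `A`; irrelevance makes the two records equal.
  ... | yes _ = MaybeAny.just refl
  ... | no ¬p = contradiction (isPartition A) ¬p

-- `A` and `B` lie below every entry of the list whose meet is `A ∨ B`, hence below that meet;
-- conversely an upper bound `C` is itself an entry, as the enumeration is complete.
∨≤⇔ : (A B C : SetPartition n) → A ∨ B ≤ C ⇔ (A ≤ C × B ≤ C)
∨≤⇔ {n} A B C = mk⇔
  (λ ∨≤C → ≤-trans A (A ∨ B) C (lower-bound A (All.map proj₁ bounds)) ∨≤C
         , ≤-trans B (A ∨ B) C (lower-bound B (All.map proj₂ bounds)) ∨≤C)
  (λ C≥ → meet≤ (∈-filter⁺ bound? (partitions-complete C) C≥))
  where
  bound? : ∀ D → Dec (A ≤ D × B ≤ D)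
  bound? D = (A ≤? D) ×-dec (B ≤? D)
  bounds : All (λ D → A ≤ D × B ≤ D) (filter bound? (partitions n))
  bounds = All.all-filter bound? (partitions n)
  ⋀ : List (SetPartition n) → SetPartition n
  ⋀ = foldr _∧_ 𝟏
  lower-bound : ∀ D {Es} → All (D ≤_) Es → D ≤ ⋀ Es
  lower-bound D []                  = ≤𝟏 D
  lower-bound D {E ∷ Es} (D≤E ∷ D≤) = Equivalence.from (≤∧⇔ E (⋀ Es) D) (D≤E , lower-bound D D≤)
  meet≤ : ∀ {Es} → C ∈ᴸ Es → ⋀ Es ≤ C
  meet≤ {E ∷ Es} (here refl) = proj₁ (∧≤ E (⋀ Es))
  meet≤ {E ∷ Es} (there C∈) =
    ≤-trans (⋀ (E ∷ Es)) (⋀ Es) C (proj₂ (∧≤ E (⋀ Es))) (meet≤ C∈)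

-- Set partitions from decidable equivalence relations

module _ {R : Rel (Fin n) 0ℓ} (isDec : IsDecEquivalence R) where
  private
    module R = IsDecEquivalence isDec
    row : Fin n → Subset n
    row i = tabulate λ j → does (i R.≟ j)
    row⇔ : ∀ {i j} → j ∈ row i ⇔ R i j
    row⇔ {i} {j} = mk⇔ to from
      where
      to : j ∈ row i → R i j
      to j∈ with i R.≟ j | trans (sym (Vec.lookup∘tabulate (λ j → does (i R.≟ j)) j)) (Vec.[]=⇒lookup j∈)
      ... | yes r | _ = r
      from : R i j → j ∈ row i
      from r = Vec.lookup⇒[]= _ _ (trans (Vec.lookup∘tabulate _ j) (dec-true (i R.≟ j) r))

  -- Common source of the kernels of words and of the restrictions along maps of indices.
  fromEquivalence : SetPartition n
  fromEquivalence = mkSetPartition (tabulate row) (self , coherent)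
    where
    self : ∀ i → i ∈ lookup (tabulate row) i
    self i rewrite Vec.lookup∘tabulate row i = Equivalence.from row⇔ R.refl
    coherent : ∀ i j → j ∈ lookup (tabulate row) i → lookup (tabulate row) j ≡ lookup (tabulate row) i
    coherent i j j∈ rewrite Vec.lookup∘tabulate row i | Vec.lookup∘tabulate row j =
      Vec.tabulate-cong λ l → does-⇔ (mk⇔ (R.trans Rij) (R.trans (R.sym Rij))) (j R.≟ l) (i R.≟ l)
      where Rij = Equivalence.to row⇔ j∈

  ∼-fromEquivalence : ∀ {i j} → i ∼[ fromEquivalence ] j ⇔ R i j
  ∼-fromEquivalence {i} {j} = mk⇔
    (λ (mk∼ j∈) → Equivalence.to row⇔ (subst (j ∈_) (Vec.lookup∘tabulate row i) j∈))
    (λ Rij → mk∼ (subst (j ∈_) (sym (Vec.lookup∘tabulate row i)) (Equivalence.from row⇔ Rij)))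

-- Words and their kernels

private
  same-letter : (w : Vec ℕ n) → IsDecEquivalence (λ i j → lookup w i ≡ lookup w j)
  same-letter w = record
    { isEquivalence = record { refl = refl ; sym = sym ; trans = trans }
    ; _≟_ = λ i j → lookup w i ℕ.≟ lookup w j }

-- The one set partition `A` such that the word occurs in `𝐦 A`.
kernel : Vec ℕ n → SetPartition n
kernel w = fromEquivalence (same-letter w)

∼-kernel : (w : Vec ℕ n) → ∀ {i j} → i ∼[ kernel w ] j ⇔ lookup w i ≡ lookup w j
∼-kernel w = ∼-fromEquivalence (same-letter w)

kernel-unique : (w : Vec ℕ n) (A : SetPartition n) →
  (∀ i j → lookup w i ≡ lookup w j ⇔ i ∼[ A ] j) → kernel w ≡ A
kernel-unique w A same = ≤-antisym (kernel w) A
  (≤⁺ (kernel w) A (Equivalence.to (same _ _) ∘ Equivalence.to (∼-kernel w)))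
  (≤⁺ A (kernel w) (Equivalence.from (∼-kernel w) ∘ Equivalence.from (same _ _)))

-- Binary expansion of the characteristic vector, lowest digit first; it lets parts serve as
-- letters.
code : Subset n → ℕ
code []          = 0
code (true  ∷ p) = suc (2 ℕ.* code p)
code (false ∷ p) = 2 ℕ.* code p

code-injective : (p q : Subset n) → code p ≡ code q → p ≡ q
code-injective []          []          _  = refl
code-injective (true  ∷ p) (true  ∷ q) eq =
  cong (true ∷_) (code-injective p q (ℕ.*-cancelˡ-≡ _ _ 2 (ℕ.suc-injective eq)))
code-injective (false ∷ p) (false ∷ q) eq =
  cong (false ∷_) (code-injective p q (ℕ.*-cancelˡ-≡ _ _ 2 eq))
code-injective (true  ∷ p) (false ∷ q) eq = contradiction (sym eq) (ℕ.even≢odd (code q) (code p))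
code-injective (false ∷ p) (true  ∷ q) eq = contradiction eq (ℕ.even≢odd (code p) (code q))

-- The letter at `i` is the code of the part containing `i`, so equal letters mean equal parts.
kernel-surjective : (A : SetPartition n) → ∃ λ w → kernel w ≡ A
kernel-surjective A = w , kernel-unique w A λ i j → mk⇔
    (λ eq → mk∼ (subst (j ∈_) (code-injective _ _ (trans (sym (letter j)) (trans (sym eq) (letter i)))) (∈part
        (∼-refl A))))
  (λ i∼j → trans (letter i) (trans (cong code (sym (∼-part A i∼j))) (sym (letter j))))
  where
  w = mapᵛ code (part A)
  letter : ∀ i → lookup w i ≡ code (lookup (part A) i)
  letter i = Vec.lookup-map i code (part A)

-- Juxtaposition and its adjoint, the restriction to the two halves

data Half (n m : ℕ) : Fin (n ℕ.+ m) → Set where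
  left  : (i : Fin n) → Half n m (i ↑ˡ m)
  right : (i : Fin m) → Half n m (n ↑ʳ i)

half : ∀ n m (i : Fin (n ℕ.+ m)) → Half n m i
half n m i with splitAt n i in eq
... | inj₁ j = subst (Half n m) (splitAt⁻¹-↑ˡ eq) (left j)
... | inj₂ j = subst (Half n m) (splitAt⁻¹-↑ʳ eq) (right j)

module _ (A : SetPartition n) (B : SetPartition m) where
  private
    eˡ : ∀ i → lookup (part (A ∣ B)) (i ↑ˡ m) ≡ lookup (part A) i ++ᵛ ⊥
    eˡ i = trans (Vec.lookup-++ˡ (mapᵛ (_++ᵛ ⊥) (part A)) _ i) (Vec.lookup-map i _ (part A))

    eʳ : ∀ i → lookup (part (A ∣ B)) (n ↑ʳ i) ≡ ⊥ {n} ++ᵛ lookup (part B) i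
    eʳ i = trans (Vec.lookup-++ʳ (mapᵛ (_++ᵛ ⊥) (part A)) _ i) (Vec.lookup-map i _ (part B))

    ∈-++ˡ : ∀ {i} (p : Subset n) (q : Subset m) → (i ↑ˡ m ∈ p ++ᵛ q) ⇔ i ∈ p
    ∈-++ˡ {i} p q = mk⇔
      (λ i∈ → Vec.lookup⇒[]= _ _ (trans (sym (Vec.lookup-++ˡ p q i)) (Vec.[]=⇒lookup i∈)))
      (λ i∈ → Vec.lookup⇒[]= _ _ (trans (Vec.lookup-++ˡ p q i) (Vec.[]=⇒lookup i∈)))

    ∈-++ʳ : ∀ {i} (p : Subset n) (q : Subset m) → (n ↑ʳ i ∈ p ++ᵛ q) ⇔ i ∈ q
    ∈-++ʳ {i} p q = mk⇔
      (λ i∈ → Vec.lookup⇒[]= _ _ (trans (sym (Vec.lookup-++ʳ p q i)) (Vec.[]=⇒lookup i∈)))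
      (λ i∈ → Vec.lookup⇒[]= _ _ (trans (Vec.lookup-++ʳ p q i) (Vec.[]=⇒lookup i∈)))

  ∼-∣ˡˡ : ∀ {i j} → (i ↑ˡ m) ∼[ A ∣ B ] (j ↑ˡ m) ⇔ i ∼[ A ] j
  ∼-∣ˡˡ {i} {j} = mk⇔
    (λ (mk∼ j∈) → mk∼ (Equivalence.to (∈-++ˡ _ ⊥) (subst (_ ∈_) (eˡ i) j∈)))
    (λ (mk∼ j∈) → mk∼ (subst (_ ∈_) (sym (eˡ i)) (Equivalence.from (∈-++ˡ _ ⊥) j∈)))

  ∼-∣ʳʳ : ∀ {i j} → (n ↑ʳ i) ∼[ A ∣ B ] (n ↑ʳ j) ⇔ i ∼[ B ] j
  ∼-∣ʳʳ {i} {j} = mk⇔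
    (λ (mk∼ j∈) → mk∼ (Equivalence.to (∈-++ʳ ⊥ _) (subst (_ ∈_) (eʳ i) j∈)))
    (λ (mk∼ j∈) → mk∼ (subst (_ ∈_) (sym (eʳ i)) (Equivalence.from (∈-++ʳ ⊥ _) j∈)))

  ∼-∣ˡʳ : ∀ {i j} → ¬ (i ↑ˡ m) ∼[ A ∣ B ] (n ↑ʳ j)
  ∼-∣ˡʳ {i} (mk∼ j∈) = ∉⊥ (Equivalence.to (∈-++ʳ (lookup (part A) i) ⊥) (subst (_ ∈_) (eˡ i) j∈))

  ∼-∣ʳˡ : ∀ {i j} → ¬ (n ↑ʳ i) ∼[ A ∣ B ] (j ↑ˡ m)
  ∼-∣ʳˡ {i} (mk∼ j∈) = ∉⊥ (Equivalence.to (∈-++ˡ ⊥ (lookup (part B) i)) (subst (_ ∈_) (eʳ i) j∈))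

private
  pulled-back : ∀ {k l} (f : Fin k → Fin l) (E : SetPartition l) →
    IsDecEquivalence (λ i j → f i ∼[ E ] f j)
  pulled-back f E = record
    { isEquivalence = record
        { refl = ∼-refl E ; sym = ∼-sym E ; trans = ∼-trans E }
    ; _≟_ = λ i j → map′ mk∼ ∈part (f j ∈? lookup (part E) (f i)) }

pullback : ∀ {k l} → (Fin k → Fin l) → SetPartition l → SetPartition k
pullback f E = fromEquivalence (pulled-back f E)

∼-pullback : ∀ {k l} (f : Fin k → Fin l) (E : SetPartition l) → ∀ {i j} →
  i ∼[ pullback f E ] j ⇔ f i ∼[ E ] f j
∼-pullback f E = ∼-fromEquivalence (pulled-back f E)

resˡ : ∀ n m → SetPartition (n ℕ.+ m) → SetPartition n
resˡ n m = pullback (_↑ˡ m)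

resʳ : ∀ n m → SetPartition (n ℕ.+ m) → SetPartition m
resʳ n m = pullback (n ↑ʳ_)

module _ (A : SetPartition n) (B : SetPartition m) where

  resˡ-∣ : resˡ n m (A ∣ B) ≡ A
  resˡ-∣ = ≤-antisym _ A
    (≤⁺ _ A (Equivalence.to (∼-∣ˡˡ A B) ∘ Equivalence.to (∼-pullback (_↑ˡ m) (A ∣ B))))
    (≤⁺ A _ (Equivalence.from (∼-pullback (_↑ˡ m) (A ∣ B)) ∘ Equivalence.from (∼-∣ˡˡ A B)))

  resʳ-∣ : resʳ n m (A ∣ B) ≡ B
  resʳ-∣ = ≤-antisym _ B
    (≤⁺ _ B (Equivalence.to (∼-∣ʳʳ A B) ∘ Equivalence.to (∼-pullback (n ↑ʳ_) (A ∣ B))))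
    (≤⁺ B _ (Equivalence.from (∼-pullback (n ↑ʳ_) (A ∣ B)) ∘ Equivalence.from (∼-∣ʳʳ A B)))

  module _ (E : SetPartition (n ℕ.+ m)) where

    -- The adjunction: no part of `A ∣ B` crosses the two halves, so only pairs within one half have
    -- to be related in `E`.
    ∣≤⇔ : A ∣ B ≤ E ⇔ (A ≤ resˡ n m E × B ≤ resʳ n m E)
    ∣≤⇔ = mk⇔
      (λ ≤E → ≤⁺ A _ (Equivalence.from (∼-pullback (_↑ˡ m) E) ∘ ≤⁻ (A ∣ B) E ≤E ∘ Equivalence.from (∼-∣ˡˡ A B))
            , ≤⁺ B _ (Equivalence.from (∼-pullback (n ↑ʳ_) E) ∘ ≤⁻ (A ∣ B) E ≤E ∘ Equivalence.from (∼-∣ʳʳ A B)))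
      (λ (A≤ , B≤) → ≤⁺ (A ∣ B) E λ {i} {j} → below A≤ B≤ (half n m i) (half n m j))
      where
      below : A ≤ resˡ n m E → B ≤ resʳ n m E →
        ∀ {i j} → Half n m i → Half n m j → i ∼[ A ∣ B ] j → i ∼[ E ] j
      below A≤ B≤ (left i) (left j) =
        Equivalence.to (∼-pullback (_↑ˡ m) E) ∘ ≤⁻ A _ A≤ ∘ Equivalence.to (∼-∣ˡˡ A B)
      below A≤ B≤ (right i) (right j) =
        Equivalence.to (∼-pullback (n ↑ʳ_) E) ∘ ≤⁻ B _ B≤ ∘ Equivalence.to (∼-∣ʳʳ A B)
      below A≤ B≤ (left i) (right j) = ⊥-elim ∘ ∼-∣ˡʳ A B
      below A≤ B≤ (right i) (left j) = ⊥-elim ∘ ∼-∣ʳˡ A B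

    -- Lying below `A ∣ B` also forbids relations across the halves. This is the extra condition
    -- `E ≤ 𝟏 ∣ 𝟏`, which reappears as the value of a character at the image of the unit under `ρ`.
    ≤∣⇔ : E ≤ A ∣ B ⇔ (E ≤ 𝟏 {n} ∣ 𝟏 {m} × resˡ n m E ≤ A × resʳ n m E ≤ B)
    ≤∣⇔ = mk⇔
      (λ E≤ → ≤⁺ E (𝟏 {n} ∣ 𝟏 {m}) (λ {i} {j} → split E≤ (half n m i) (half n m j))
            , ≤⁺ _ A (Equivalence.to (∼-∣ˡˡ A B) ∘ ≤⁻ E (A ∣ B) E≤ ∘ Equivalence.to (∼-pullback (_↑ˡ m) E))
            , ≤⁺ _ B (Equivalence.to (∼-∣ʳʳ A B) ∘ ≤⁻ E (A ∣ B) E≤ ∘ Equivalence.to (∼-pullback (n ↑ʳ_) E)))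
      (λ (E≤𝟏𝟏 , ≤A , ≤B) → ≤⁺ E (A ∣ B) λ {i} {j} → above E≤𝟏𝟏 ≤A ≤B (half n m i) (half n m j))
      where
      split : E ≤ A ∣ B → ∀ {i j} → Half n m i → Half n m j → i ∼[ E ] j → i ∼[ 𝟏 {n} ∣ 𝟏 {m} ] j
      split E≤ (left i) (left j) i∼j = Equivalence.from (∼-∣ˡˡ 𝟏 𝟏) (≤⁻ A 𝟏 (≤𝟏 A) (Equivalence.to (∼-∣ˡˡ A B)
          (≤⁻ E (A ∣ B) E≤ i∼j)))
      split E≤ (right i) (right j) i∼j = Equivalence.from (∼-∣ʳʳ 𝟏 𝟏) (≤⁻ B 𝟏 (≤𝟏 B) (Equivalence.to
          (∼-∣ʳʳ A B) (≤⁻ E (A ∣ B) E≤ i∼j)))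
      split E≤ (left i) (right j) i∼j = ⊥-elim (∼-∣ˡʳ A B (≤⁻ E (A ∣ B) E≤ i∼j))
      split E≤ (right i) (left j) i∼j = ⊥-elim (∼-∣ʳˡ A B (≤⁻ E (A ∣ B) E≤ i∼j))
      above : E ≤ 𝟏 {n} ∣ 𝟏 {m} → resˡ n m E ≤ A → resʳ n m E ≤ B →
        ∀ {i j} → Half n m i → Half n m j → i ∼[ E ] j → i ∼[ A ∣ B ] j
      above E≤ ≤A ≤B (left i) (left j) =
        Equivalence.from (∼-∣ˡˡ A B) ∘ ≤⁻ _ A ≤A ∘ Equivalence.from (∼-pullback (_↑ˡ m) E)
      above E≤ ≤A ≤B (right i) (right j) =
        Equivalence.from (∼-∣ʳʳ A B) ∘ ≤⁻ _ B ≤B ∘ Equivalence.from (∼-pullback (n ↑ʳ_) E)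
      above E≤ ≤A ≤B (left i) (right j) = ⊥-elim ∘ ∼-∣ˡʳ 𝟏 𝟏 ∘ ≤⁻ E (𝟏 {n} ∣ 𝟏 {m}) E≤
      above E≤ ≤A ≤B (right i) (left j) = ⊥-elim ∘ ∼-∣ʳˡ 𝟏 𝟏 ∘ ≤⁻ E (𝟏 {n} ∣ 𝟏 {m}) E≤

≡∣⇔ : (E : SetPartition (n ℕ.+ m)) (A : SetPartition n) (B : SetPartition m) →
  E ≡ A ∣ B ⇔ (E ≤ 𝟏 {n} ∣ 𝟏 {m} × resˡ n m E ≡ A × resʳ n m E ≡ B)
≡∣⇔ {n} {m} E A B = mk⇔
  (λ { refl → proj₁ (Equivalence.to (≤∣⇔ A B E) (≤-refl E)) , resˡ-∣ A B , resʳ-∣ A B })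
  λ { (E≤ , refl , refl) → ≤-antisym E (A ∣ B)
    (Equivalence.from (≤∣⇔ A B E) (E≤ , ≤-refl A , ≤-refl B))
    (Equivalence.from (∣≤⇔ A B E) (≤-refl A , ≤-refl B)) }

-- Meeting `E` with `𝟏 ∣ 𝟏` cuts it into the juxtaposition of its restrictions, and restriction
-- recovers both sides of a juxtaposition. The index set of the product in `NCSym` is thereby given
-- by two independent conditions.
∧𝟏∣𝟏≡∣⇔ : (E : SetPartition (n ℕ.+ m)) (A : SetPartition n) (B : SetPartition m) →
  E ∧ (𝟏 {n} ∣ 𝟏 {m}) ≡ A ∣ B ⇔ (resˡ n m E ≡ A × resʳ n m E ≡ B)
∧𝟏∣𝟏≡∣⇔ {n} {m} E A B = mk⇔
  (λ eq → trans (sym (resˡ-∣ E₁ E₂)) (trans (cong (resˡ n m) (trans (sym restriction) eq)) (resˡ-∣ A B))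
        , trans (sym (resʳ-∣ E₁ E₂)) (trans (cong (resʳ n m) (trans (sym restriction) eq)) (resʳ-∣ A B)))
  λ { (refl , refl) → restriction }
  where
  E₁ = resˡ n m E
  E₂ = resʳ n m E
  U = 𝟏 {n} ∣ 𝟏 {m}
  restriction : E ∧ U ≡ E₁ ∣ E₂
  restriction = ≤-antisym (E ∧ U) (E₁ ∣ E₂)
    (Equivalence.from (≤∣⇔ E₁ E₂ (E ∧ U))
      ( proj₂ (∧≤ E U)
      , ≤⁺ _ E₁ (Equivalence.from (∼-pullback (_↑ˡ m) E) ∘ ≤⁻ (E ∧ U) E (proj₁ (∧≤ E U))
                 ∘ Equivalence.to (∼-pullback (_↑ˡ m) (E ∧ U)))
      , ≤⁺ _ E₂ (Equivalence.from (∼-pullback (n ↑ʳ_) E) ∘ ≤⁻ (E ∧ U) E (proj₁ (∧≤ E U))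
                 ∘ Equivalence.to (∼-pullback (n ↑ʳ_) (E ∧ U)))))
    (Equivalence.from (≤∧⇔ E U (E₁ ∣ E₂))
      ( Equivalence.from (∣≤⇔ E₁ E₂ E) (≤-refl E₁ , ≤-refl E₂)
      , proj₁ (Equivalence.to (≤∣⇔ E₁ E₂ (E₁ ∣ E₂)) (≤-refl (E₁ ∣ E₂)))))

-- Finite sums and linear extension

module LinearAlgebra {c ℓ₁ ℓ₂} (K : HeytingField c ℓ₁ ℓ₂) where

  open HeytingField K using (_≈_; _+_; _*_; -_; 0#; 1#; heytingCommutativeRing) renaming (Carrier to k) public
  open HeytingCommutativeRing heytingCommutativeRing using (commutativeRing) public
  module R = CommutativeRing commutativeRing
  open import Algebra.Properties.Ring R.ring using (-0#≈0#; -‿+-comm; -‿distribˡ-*) public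
  open import Algebra.Properties.CommutativeSemigroup R.*-commutativeSemigroup using (x∙yz≈y∙xz) public

  private variable
    a b ℓ r s : Level
    X Y : Set
    I J : Set a
    P Q : Set a

  -- Iverson bracket with values in the field; as coefficients, conditions on indices can be
  -- multiplied and moved through exchanges of summation.
  ⟦_⟧ : Dec P → k
  ⟦ P? ⟧ = if does P? then 1# else 0#

  ⟦⟧-yes : (P? : Dec P) → P → ⟦ P? ⟧ ≡ 1#
  ⟦⟧-yes P? p rewrite dec-true P? p = refl

  ⟦⟧-no : (P? : Dec P) → ¬ P → ⟦ P? ⟧ ≡ 0#
  ⟦⟧-no P? ¬p rewrite dec-false P? ¬p = refl

  ⟦⟧-⇔ : P ⇔ Q → (P? : Dec P) (Q? : Dec Q) → ⟦ P? ⟧ ≡ ⟦ Q? ⟧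
  ⟦⟧-⇔ P⇔Q P? Q? rewrite does-⇔ P⇔Q P? Q? = refl

  ⟦⟧-× : (P? : Dec P) (Q? : Dec Q) → ⟦ P? ×-dec Q? ⟧ ≈ ⟦ P? ⟧ * ⟦ Q? ⟧
  ⟦⟧-× P? Q? with does P? | does Q?
  ... | true  | true  = R.sym (R.*-identityˡ 1#)
  ... | true  | false = R.sym (R.*-identityˡ 0#)
  ... | false | _     = R.sym (R.zeroˡ _)

  IsVectorSpace : RawModule k a ℓ → Set _
  IsVectorSpace M = IsLeftSemimodule R.semiring _≈ᴹ_ _+ᴹ_ 0ᴹ _*ₗ_
    where open RawBimodule M

  module Sums (M : RawModule k a ℓ) (isVectorSpace : IsVectorSpace M) where
    open RawBimodule M
    open IsLeftSemimodule isVectorSpace public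
    open SetoidReasoning ≈ᴹ-setoid

    ∑-cong : {φ ψ : I → Carrierᴹ} → (∀ i → φ i ≈ᴹ ψ i) → ∀ is → ∑ K M is φ ≈ᴹ ∑ K M is ψ
    ∑-cong φ≈ψ []       = ≈ᴹ-refl
    ∑-cong φ≈ψ (i ∷ is) = +ᴹ-cong (φ≈ψ i) (∑-cong φ≈ψ is)

    ∑-0 : (is : List I) → ∑ K M is (λ _ → 0ᴹ) ≈ᴹ 0ᴹ
    ∑-0 []       = ≈ᴹ-refl
    ∑-0 (i ∷ is) = ≈ᴹ-trans (+ᴹ-identityˡ _) (∑-0 is)

    ∑-++ : (is js : List I) (φ : I → Carrierᴹ) → ∑ K M (is ++ js) φ ≈ᴹ ∑ K M is φ +ᴹ ∑ K M js φ
    ∑-++ []       js φ = ≈ᴹ-sym (+ᴹ-identityˡ _)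
    ∑-++ (i ∷ is) js φ = ≈ᴹ-trans (+ᴹ-congˡ (∑-++ is js φ)) (≈ᴹ-sym (+ᴹ-assoc _ _ _))

    ∑-map : (f : I → J) (is : List I) (φ : J → Carrierᴹ) → ∑ K M (map f is) φ ≡ ∑ K M is (φ ∘ f)
    ∑-map f []       φ = refl
    ∑-map f (i ∷ is) φ = cong (φ (f i) +ᴹ_) (∑-map f is φ)

    +ᴹ-interchange : ∀ u v w z → (u +ᴹ v) +ᴹ (w +ᴹ z) ≈ᴹ (u +ᴹ w) +ᴹ (v +ᴹ z)
    +ᴹ-interchange u v w z = begin
      (u +ᴹ v) +ᴹ (w +ᴹ z)   ≈⟨ +ᴹ-assoc _ _ _ ⟩
      u +ᴹ (v +ᴹ (w +ᴹ z))   ≈⟨ +ᴹ-congˡ (+ᴹ-assoc _ _ _) ⟨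
      u +ᴹ ((v +ᴹ w) +ᴹ z)   ≈⟨ +ᴹ-congˡ (+ᴹ-congʳ (+ᴹ-comm _ _)) ⟩
      u +ᴹ ((w +ᴹ v) +ᴹ z)   ≈⟨ +ᴹ-congˡ (+ᴹ-assoc _ _ _) ⟩
      u +ᴹ (w +ᴹ (v +ᴹ z))   ≈⟨ +ᴹ-assoc _ _ _ ⟨
      (u +ᴹ w) +ᴹ (v +ᴹ z)   ∎

    ∑-+ : (is : List I) (φ ψ : I → Carrierᴹ) →
      ∑ K M is (λ i → φ i +ᴹ ψ i) ≈ᴹ ∑ K M is φ +ᴹ ∑ K M is ψ
    ∑-+ []       φ ψ = ≈ᴹ-sym (+ᴹ-identityˡ _)
    ∑-+ (i ∷ is) φ ψ = ≈ᴹ-trans (+ᴹ-congˡ (∑-+ is φ ψ)) (+ᴹ-interchange _ _ _ _)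

    *ₗ-∑ : ∀ x (is : List I) (φ : I → Carrierᴹ) → x *ₗ ∑ K M is φ ≈ᴹ ∑ K M is (λ i → x *ₗ φ i)
    *ₗ-∑ x []       φ = *ₗ-zeroʳ x
    *ₗ-∑ x (i ∷ is) φ = ≈ᴹ-trans (*ₗ-distribˡ _ _ _) (+ᴹ-congˡ (*ₗ-∑ x is φ))

    *ₗ-*ₗ-comm : ∀ x y v → x *ₗ (y *ₗ v) ≈ᴹ y *ₗ (x *ₗ v)
    *ₗ-*ₗ-comm x y v = ≈ᴹ-trans (≈ᴹ-sym (*ₗ-assoc x y v))
      (≈ᴹ-trans (*ₗ-cong (R.*-comm x y) ≈ᴹ-refl) (*ₗ-assoc y x v))

    ∑-*ₗ : (is : List I) (φ : I → k) (v : Carrierᴹ) →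
      ∑ K (scalars K) is φ *ₗ v ≈ᴹ ∑ K M is (λ i → φ i *ₗ v)
    ∑-*ₗ []       φ v = *ₗ-zeroˡ v
    ∑-*ₗ (i ∷ is) φ v = ≈ᴹ-trans (*ₗ-distribʳ _ _ _) (+ᴹ-congˡ (∑-*ₗ is φ v))

    ∑-swap : (is : List I) (js : List J) (φ : I → J → Carrierᴹ) →
      ∑ K M is (λ i → ∑ K M js (φ i)) ≈ᴹ ∑ K M js (λ j → ∑ K M is (λ i → φ i j))
    ∑-swap []       js φ = ≈ᴹ-sym (∑-0 js)
    ∑-swap (i ∷ is) js φ = ≈ᴹ-trans (+ᴹ-congˡ (∑-swap is js φ)) (≈ᴹ-sym (∑-+ js _ _))

    ∑-cartesianProduct : (is : List I) (js : List J) (φ : I × J → Carrierᴹ) →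
      ∑ K M (cartesianProduct is js) φ ≈ᴹ ∑ K M is (λ i → ∑ K M js (λ j → φ (i , j)))
    ∑-cartesianProduct []       js φ = ≈ᴹ-refl
    ∑-cartesianProduct (i ∷ is) js φ = begin
      ∑ K M (map (i ,_) js ++ cartesianProduct is js) φ
        ≈⟨ ∑-++ (map (i ,_) js) _ φ ⟩
      ∑ K M (map (i ,_) js) φ +ᴹ ∑ K M (cartesianProduct is js) φ
        ≡⟨ cong (_+ᴹ _) (∑-map (i ,_) js φ) ⟩
      ∑ K M js (λ j → φ (i , j)) +ᴹ ∑ K M (cartesianProduct is js) φ
        ≈⟨ +ᴹ-congˡ (∑-cartesianProduct is js φ) ⟩
      ∑ K M js (λ j → φ (i , j)) +ᴹ ∑ K M is (λ i → ∑ K M js (λ j → φ (i , j))) ∎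

    ∑-filter : {P : I → Set r} (P? : ∀ i → Dec (P i)) (is : List I) (φ : I → Carrierᴹ) →
      ∑ K M (filter P? is) φ ≈ᴹ ∑ K M is (λ i → ⟦ P? i ⟧ *ₗ φ i)
    ∑-filter P? []       φ = ≈ᴹ-refl
    ∑-filter P? (i ∷ is) φ with does (P? i)
    ... | true  = +ᴹ-cong (≈ᴹ-sym (*ₗ-identityˡ _)) (∑-filter P? is φ)
    ... | false = ≈ᴹ-trans (∑-filter P? is φ)
                    (≈ᴹ-trans (≈ᴹ-sym (+ᴹ-identityˡ _)) (+ᴹ-congʳ (≈ᴹ-sym (*ₗ-zeroˡ _))))

    ∑-δ∉ : (_≟′_ : DecidableEquality X) (φ : X → Carrierᴹ) → ∀ {x is} → x ∉ᴸ is →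
      ∑ K M is (λ y → ⟦ x ≟′ y ⟧ *ₗ φ y) ≈ᴹ 0ᴹ
    ∑-δ∉ _≟′_ φ {is = []}     x∉ = ≈ᴹ-refl
    ∑-δ∉ _≟′_ φ {x} {y ∷ is} x∉ rewrite ⟦⟧-no (x ≟′ y) (x∉ ∘ here) =
      ≈ᴹ-trans (+ᴹ-cong (*ₗ-zeroˡ _) (∑-δ∉ _≟′_ φ (x∉ ∘ there))) (+ᴹ-identityˡ _)

    ∑-δ : (_≟′_ : DecidableEquality X) (φ : X → Carrierᴹ) → ∀ {x is} → Unique is → x ∈ᴸ is →
      ∑ K M is (λ y → ⟦ x ≟′ y ⟧ *ₗ φ y) ≈ᴹ φ x
    ∑-δ _≟′_ φ {x} (x∉ ∷ _) (here refl) rewrite ⟦⟧-yes (x ≟′ x) refl =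
      ≈ᴹ-trans (+ᴹ-cong (*ₗ-identityˡ _) (∑-δ∉ _≟′_ φ (All.All¬⇒¬Any x∉))) (+ᴹ-identityʳ _)
    ∑-δ _≟′_ φ {x} {y ∷ _} (y∉ ∷ is!) (there x∈) rewrite ⟦⟧-no (x ≟′ y) (λ { refl → All.All¬⇒¬Any y∉ x∈ }) =
      ≈ᴹ-trans (+ᴹ-cong (*ₗ-zeroˡ _) (∑-δ _≟′_ φ is! x∈)) (+ᴹ-identityˡ _)

    ∑-partitions-δ : (A : SetPartition n) (φ : SetPartition n → Carrierᴹ) →
      ∑ K M (partitions n) (λ B → ⟦ A ≟ B ⟧ *ₗ φ B) ≈ᴹ φ A
    ∑-partitions-δ A φ = ∑-δ _≟_ φ (partitions-unique _) (partitions-complete A)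

    -- The sum is additive under concatenation and the target is commutative, so only the generating
    -- relations have to be checked.
    ∑-respects : {_∼_ : Rel (List I) r} (φ : I → Carrierᴹ) →
      (∀ {x y} → x ∼ y → ∑ K M x φ ≈ᴹ ∑ K M y φ) →
      ∀ {x y} → Presented _∼_ x y → ∑ K M x φ ≈ᴹ ∑ K M y φ
    ∑-respects φ resp (relation p)  = resp p
    ∑-respects φ resp ≋-refl        = ≈ᴹ-refl
    ∑-respects φ resp (≋-sym p)     = ≈ᴹ-sym (∑-respects φ resp p)
    ∑-respects φ resp (≋-trans p q) = ≈ᴹ-trans (∑-respects φ resp p) (∑-respects φ resp q)
    ∑-respects φ resp (++-cong {x} {x′} p q) = ≈ᴹ-trans (∑-++ x _ φ)
      (≈ᴹ-trans (+ᴹ-cong (∑-respects φ resp p) (∑-respects φ resp q)) (≈ᴹ-sym (∑-++ x′ _ φ)))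
    ∑-respects φ resp (++-comm x y) =
      ≈ᴹ-trans (∑-++ x y φ) (≈ᴹ-trans (+ᴹ-comm _ _) (≈ᴹ-sym (∑-++ y x φ)))

    linear-cong : {φ ψ : X → Carrierᴹ} → (∀ x → φ x ≈ᴹ ψ x) → ∀ f → linear K M φ f ≈ᴹ linear K M ψ f
    linear-cong φ≈ψ = ∑-cong λ (a , x) → *ₗ-cong R.refl (φ≈ψ x)

    bilinear-cong : {φ ψ : X → Y → Carrierᴹ} → (∀ x y → φ x y ≈ᴹ ψ x y) →
      ∀ f g → bilinear K M φ f g ≈ᴹ bilinear K M ψ f g
    bilinear-cong φ≈ψ f g = linear-cong (λ x → linear-cong (φ≈ψ x) g) f

    linear-basis : (φ : X → Carrierᴹ) (x : X) → linear K M φ (basis K x) ≈ᴹ φ x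
    linear-basis φ x = ≈ᴹ-trans (+ᴹ-identityʳ _) (*ₗ-identityˡ _)

    linear-++ : (φ : X → Carrierᴹ) → ∀ f g → linear K M φ (f ++ g) ≈ᴹ linear K M φ f +ᴹ linear K M φ g
    linear-++ φ f g = ∑-++ f g _

    linear-*ₗ : (φ : X → Carrierᴹ) → ∀ a f →
      linear K M φ (map (λ (b , x) → a * b , x) f) ≈ᴹ a *ₗ linear K M φ f
    linear-*ₗ φ a f = begin
      linear K M φ (map (λ (b , x) → a * b , x) f) ≡⟨ ∑-map _ f _ ⟩
      ∑ K M f (λ (b , x) → (a * b) *ₗ φ x)         ≈⟨ ∑-cong (λ _ → *ₗ-assoc _ _ _) f ⟩
      ∑ K M f (λ (b , x) → a *ₗ (b *ₗ φ x))        ≈⟨ *ₗ-∑ a f _ ⟨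
      a *ₗ linear K M φ f                          ∎

    linear-∑-index : (φ : J → X → Carrierᴹ) (js : List J) → ∀ f →
      linear K M (λ x → ∑ K M js (λ j → φ j x)) f ≈ᴹ ∑ K M js (λ j → linear K M (φ j) f)
    linear-∑-index φ js f = begin
      linear K M (λ x → ∑ K M js (λ j → φ j x)) f           ≈⟨ ∑-cong (λ (a , x) → *ₗ-∑ a js _) f ⟩
      ∑ K M f (λ (a , x) → ∑ K M js (λ j → a *ₗ φ j x))     ≈⟨ ∑-swap f js _ ⟩
      ∑ K M js (λ j → linear K M (φ j) f)                   ∎

    linear-swap : (φ : X → Y → Carrierᴹ) → ∀ f g →
      linear K M (λ x → linear K M (φ x) g) f ≈ᴹ linear K M (λ y → linear K M (λ x → φ x y) f) g
    linear-swap φ f g = begin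
      ∑ K M f (λ (a , x) → a *ₗ ∑ K M g (λ (b , y) → b *ₗ φ x y))
        ≈⟨ ∑-cong (λ (a , x) → *ₗ-∑ a g _) f ⟩
      ∑ K M f (λ (a , x) → ∑ K M g (λ (b , y) → a *ₗ (b *ₗ φ x y)))
        ≈⟨ ∑-swap f g _ ⟩
      ∑ K M g (λ (b , y) → ∑ K M f (λ (a , x) → a *ₗ (b *ₗ φ x y)))
        ≈⟨ ∑-cong (λ (b , y) → ∑-cong (λ (a , x) → *ₗ-*ₗ-comm a b (φ x y)) f) g ⟩
      ∑ K M g (λ (b , y) → ∑ K M f (λ (a , x) → b *ₗ (a *ₗ φ x y)))
        ≈⟨ ∑-cong (λ (b , y) → *ₗ-∑ b f _) g ⟨
      ∑ K M g (λ (b , y) → b *ₗ ∑ K M f (λ (a , x) → a *ₗ φ x y)) ∎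

    -- An extension is determined on formal sums by their coefficients,
    -- because the indices that occur form a finite list without repetition.
    module _ (_≟′_ : DecidableEquality X) (φ : X → Carrierᴹ) where

      linear-support : ∀ {is} → Unique is → ∀ f → (∀ {x} → x ∈ᴸ map proj₂ f → x ∈ᴸ is) →
        linear K M φ f ≈ᴹ ∑ K M is (λ y → linear K (scalars K) (λ x → ⟦ x ≟′ y ⟧) f *ₗ φ y)
      linear-support {is} is! [] ⊆is =
        ≈ᴹ-sym (≈ᴹ-trans (∑-cong (λ _ → *ₗ-zeroˡ _) is) (∑-0 is))
      linear-support {is} is! ((a , x) ∷ f) ⊆is = begin
        a *ₗ φ x +ᴹ linear K M φ f
          ≈⟨ +ᴹ-cong (*ₗ-cong R.refl (≈ᴹ-sym (∑-δ _≟′_ φ is! (⊆is (here refl)))))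
                     (linear-support is! f (⊆is ∘ there)) ⟩
        a *ₗ ∑ K M is (λ y → ⟦ x ≟′ y ⟧ *ₗ φ y) +ᴹ ∑ K M is (λ y → coef y f *ₗ φ y)
          ≈⟨ +ᴹ-congʳ (≈ᴹ-trans (*ₗ-∑ a is _) (∑-cong (λ _ → ≈ᴹ-sym (*ₗ-assoc _ _ _)) is)) ⟩
        ∑ K M is (λ y → (a * ⟦ x ≟′ y ⟧) *ₗ φ y) +ᴹ ∑ K M is (λ y → coef y f *ₗ φ y)
          ≈⟨ ∑-+ is _ _ ⟨
        ∑ K M is (λ y → (a * ⟦ x ≟′ y ⟧) *ₗ φ y +ᴹ coef y f *ₗ φ y)
          ≈⟨ ∑-cong (λ _ → *ₗ-distribʳ _ _ _) is ⟨
        ∑ K M is (λ y → coef y ((a , x) ∷ f) *ₗ φ y) ∎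
        where
        coef : X → List (k × X) → k
        coef y = linear K (scalars K) (λ x → ⟦ x ≟′ y ⟧)

      linear-coefficients : ∀ f g →
        (∀ y → linear K (scalars K) (λ x → ⟦ x ≟′ y ⟧) f ≈ linear K (scalars K) (λ x → ⟦ x ≟′ y ⟧) g) →
        linear K M φ f ≈ᴹ linear K M φ g
      linear-coefficients f g f≈g = begin
        linear K M φ f ≈⟨ linear-support (deduplicate-! _≟′_ support) f
                            (∈-deduplicate⁺ _≟′_ ∘ ∈-++⁺ˡ) ⟩
        ∑ K M is (λ y → linear K (scalars K) (λ x → ⟦ x ≟′ y ⟧) f *ₗ φ y)
          ≈⟨ ∑-cong (λ y → *ₗ-cong (f≈g y) ≈ᴹ-refl) is ⟩
        ∑ K M is (λ y → linear K (scalars K) (λ x → ⟦ x ≟′ y ⟧) g *ₗ φ y)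
          ≈⟨ linear-support (deduplicate-! _≟′_ support) g
               (∈-deduplicate⁺ _≟′_ ∘ ∈-++⁺ʳ (map proj₂ f)) ⟨
        linear K M φ g ∎
        where
        support is : List X
        support = map proj₂ f ++ map proj₂ g
        is      = deduplicate _≟′_ support

    module _ {_≃′_ : Rel X r} where

      linear-∑ : (φ : X → Carrierᴹ) (is : List I) (ψ : I → List (k × X)) →
        linear K M φ (∑ K (Free K _≃′_) is ψ) ≈ᴹ ∑ K M is (λ i → linear K M φ (ψ i))
      linear-∑ φ []       ψ = ≈ᴹ-refl
      linear-∑ φ (i ∷ is) ψ = ≈ᴹ-trans (linear-++ φ (ψ i) _) (+ᴹ-congˡ (linear-∑ φ is ψ))

      linear-linear : (φ : X → Carrierᴹ) (ψ : Y → List (k × X)) → ∀ f →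
        linear K M φ (linear K (Free K _≃′_) ψ f) ≈ᴹ linear K M (λ y → linear K M φ (ψ y)) f
      linear-linear φ ψ f = ≈ᴹ-trans (linear-∑ φ f _) (∑-cong (λ (a , y) → linear-*ₗ φ a (ψ y)) f)

      linear-bilinearᴹ : ∀ {W : Set} (φ : X → Carrierᴹ) (ψ : Y → W → List (k × X)) → ∀ f g →
        linear K M φ (bilinear K (Free K _≃′_) ψ f g) ≈ᴹ bilinear K M (λ y w → linear K M φ (ψ y w)) f g
      linear-bilinearᴹ φ ψ f g = ≈ᴹ-trans (linear-linear φ _ f)
        (linear-cong (λ y → linear-linear φ (ψ y) g) f)

      bilinear-linear : ∀ {W : Set} (θ : X → X → Carrierᴹ) (α : Y → List (k × X)) (β : W → List (k × X)) → ∀ f g →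
        bilinear K M θ (linear K (Free K _≃′_) α f) (linear K (Free K _≃′_) β g) ≈ᴹ
        bilinear K M (λ y w → bilinear K M θ (α y) (β w)) f g
      bilinear-linear θ α β f g = ≈ᴹ-trans (linear-linear _ α f) (linear-cong (λ y → ≈ᴹ-trans
        (linear-cong (λ x → linear-linear (θ x) β g) (α y))
        (linear-swap (λ x w → linear K M (θ x) (β w)) (α y) g)) f)

      linear-respects : (φ : X → Carrierᴹ) → (∀ {x y} → x ≃′ y → φ x ≈ᴹ φ y) →
        ∀ {f g} → Presented (FreeRelation K _≃′_) f g → linear K M φ f ≈ᴹ linear K M φ g
      linear-respects φ φ-resp = ∑-respects _ λ where
        (term-cong a≈b x≃y) → +ᴹ-congʳ (*ₗ-cong a≈b (φ-resp x≃y))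
        (term-add a b x)    → ≈ᴹ-trans (+ᴹ-congʳ (*ₗ-distribʳ _ _ _)) (+ᴹ-assoc _ _ _)
        (term-zero x)       → ≈ᴹ-trans (+ᴹ-identityʳ _) (*ₗ-zeroˡ _)

  scalars-isVectorSpace : IsVectorSpace (scalars K)
  scalars-isVectorSpace = record
    { +ᴹ-isCommutativeMonoid = R.+-isCommutativeMonoid
    ; isPreleftSemimodule = record
      { *ₗ-cong = R.*-cong ; *ₗ-zeroˡ = R.zeroˡ ; *ₗ-distribʳ = λ x a b → R.distribʳ x a b
      ; *ₗ-identityˡ = R.*-identityˡ ; *ₗ-assoc = R.*-assoc ; *ₗ-zeroʳ = R.zeroʳ ; *ₗ-distribˡ = R.distribˡ } }

  module Scalars = Sums (scalars K) scalars-isVectorSpace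

  -‿∑ : (is : List I) (φ : I → k) → ∑ K (scalars K) is (λ i → - φ i) ≈ - ∑ K (scalars K) is φ
  -‿∑ []       φ = R.sym -0#≈0#
  -‿∑ (i ∷ is) φ = R.trans (R.+-congˡ (-‿∑ is φ)) (-‿+-comm _ _)

  linear-*ˡ : (a : k) (φ : X → k) → ∀ f →
    linear K (scalars K) (λ x → a * φ x) f ≈ a * linear K (scalars K) φ f
  linear-*ˡ a φ f = R.trans (Scalars.∑-cong (λ (b , x) → x∙yz≈y∙xz b a (φ x)) f) (R.sym (Scalars.*ₗ-∑ a f _))

  linear-*ʳ : (a : k) (φ : X → k) → ∀ f →
    linear K (scalars K) (λ x → φ x * a) f ≈ linear K (scalars K) φ f * a
  linear-*ʳ a φ f = R.trans (Scalars.linear-cong (λ x → R.*-comm (φ x) a) f)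
    (R.trans (linear-*ˡ a φ f) (R.*-comm a _))

  linear-neg : (φ : X → k) → ∀ f →
    linear K (scalars K) φ (map (λ (b , x) → - b , x) f) ≈ - linear K (scalars K) φ f
  linear-neg φ f = R.trans (R.reflexive (Scalars.∑-map _ f _))
    (R.trans (Scalars.∑-cong (λ (b , x) → R.sym (-‿distribˡ-* b (φ x))) f) (-‿∑ f _))

  -- By bilinearity a product formula needs checking on pairs of basis elements only. It makes
  -- characters multiplicative for `_∧ₖ_` and splits them along `_∣_`.
  linear-bilinear : ∀ {Z : Set} {_≃′_ : Rel Z r} (ψ : Z → k) (φ : X → Y → List (k × Z)) (α : X → k) (β : Y → k) →
    (∀ x y → linear K (scalars K) ψ (φ x y) ≈ α x * β y) →
    ∀ f g → linear K (scalars K) ψ (bilinear K (Free K _≃′_) φ f g) ≈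
            linear K (scalars K) α f * linear K (scalars K) β g
  linear-bilinear {_≃′_ = _≃′_} ψ φ α β ψφ f g = begin
    L ψ (bilinear K (Free K _≃′_) φ f g)
      ≈⟨ Scalars.linear-linear {_≃′_ = _≃′_} ψ (λ x → linear K (Free K _≃′_) (φ x) g) f ⟩
    L (λ x → L ψ (linear K (Free K _≃′_) (φ x) g)) f
      ≈⟨ Scalars.linear-cong (λ x → R.trans (Scalars.linear-linear {_≃′_ = _≃′_} ψ (φ x) g)
           (R.trans (Scalars.linear-cong (ψφ x) g) (linear-*ˡ (α x) β g))) f ⟩
    L (λ x → α x * L β g) f
      ≈⟨ linear-*ʳ (L β g) α f ⟩
    L α f * L β g ∎
    where
    open SetoidReasoning R.setoid
    L : ∀ {W : Set} → (W → k) → List (k × W) → k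
    L = linear K (scalars K)

  -- Formal sums modulo relations

  module _ {G : Set a} {_∼_ : Rel (List G) r} where

    presented-isEquivalence : IsEquivalence (Presented _∼_)
    presented-isEquivalence = record { refl = ≋-refl ; sym = ≋-sym ; trans = ≋-trans }

    presented-isCommutativeMonoid : IsCommutativeMonoid (Presented _∼_) _++_ []
    presented-isCommutativeMonoid = record
      { isMonoid = record
        { isSemigroup = record
          { isMagma = record { isEquivalence = presented-isEquivalence ; ∙-cong = ++-cong }
          ; assoc = λ x y z → ≡⇒≋ (List.++-assoc x y z) }
        ; identity = (λ _ → ≋-refl) , λ x → ≡⇒≋ (List.++-identityʳ x) }
      ; comm = ++-comm }
      where
      ≡⇒≋ : ∀ {x y} → x ≡ y → Presented _∼_ x y
      ≡⇒≋ refl = ≋-refl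

    map≋map : (f g : G → G) → (∀ x → Presented _∼_ [ f x ] [ g x ]) → ∀ z → Presented _∼_ (map f z) (map g z)
    map≋map f g f≋g []      = ≋-refl
    map≋map f g f≋g (x ∷ z) = ++-cong (f≋g x) (map≋map f g f≋g z)

    map≋[] : (f : G → G) → (∀ x → Presented _∼_ [ f x ] []) → ∀ z → Presented _∼_ (map f z) []
    map≋[] f f≋[] []      = ≋-refl
    map≋[] f f≋[] (x ∷ z) = ++-cong (f≋[] x) (map≋[] f f≋[] z)

    map≋++ : (f g h : G → G) → (∀ x → Presented _∼_ [ f x ] (g x ∷ h x ∷ [])) →
      ∀ z → Presented _∼_ (map f z) (map g z ++ map h z)
    map≋++ f g h f≋ []      = ≋-refl
    map≋++ f g h f≋ (x ∷ z) = ≋-trans (++-cong (f≋ x) (map≋++ f g h f≋ z))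
      (++-cong {x = [ g x ]} ≋-refl (≋-trans (≋-sym (assoc [ h x ] (map g z) (map h z)))
        (≋-trans (++-cong (++-comm [ h x ] (map g z)) ≋-refl) (assoc (map g z) [ h x ] (map h z)))))
      where open IsCommutativeMonoid presented-isCommutativeMonoid using (assoc)

    presented-mono : ∀ {s} {_∼′_ : Rel (List G) s} → (∀ {x y} → x ∼ y → Presented _∼′_ x y) →
      ∀ {x y} → Presented _∼_ x y → Presented _∼′_ x y
    presented-mono mono (relation p)   = mono p
    presented-mono mono ≋-refl         = ≋-refl
    presented-mono mono (≋-sym p)      = ≋-sym (presented-mono mono p)
    presented-mono mono (≋-trans p q)  = ≋-trans (presented-mono mono p) (presented-mono mono q)
    presented-mono mono (++-cong p q)  = ++-cong (presented-mono mono p) (presented-mono mono q)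
    presented-mono mono (++-comm x y)  = ++-comm x y

    map-respects : ∀ {b} {s} {H : Set b} {_∼′_ : Rel (List H) s} (f : G → H) →
      (∀ {x y} → x ∼ y → Presented _∼′_ (map f x) (map f y)) →
      ∀ {x y} → Presented _∼_ x y → Presented _∼′_ (map f x) (map f y)
    map-respects f f-resp (relation p)  = f-resp p
    map-respects f f-resp ≋-refl        = ≋-refl
    map-respects f f-resp (≋-sym p)     = ≋-sym (map-respects f f-resp p)
    map-respects f f-resp (≋-trans p q) = ≋-trans (map-respects f f-resp p) (map-respects f f-resp q)
    map-respects f f-resp (++-cong {x} {x′} {y} {y′} p q)
      rewrite List.map-++ f x y | List.map-++ f x′ y′ =
      ++-cong (map-respects f f-resp p) (map-respects f f-resp q)
    map-respects f f-resp (++-comm x y)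
      rewrite List.map-++ f x y | List.map-++ f y x = ++-comm (map f x) (map f y)

  -- Free modules as vector spaces

  module _ {_≃′_ : Rel X r} (≃-refl : ∀ {x} → x ≃′ x) where

    free-isVectorSpace : IsVectorSpace (Free K _≃′_)
    free-isVectorSpace = record
      { +ᴹ-isCommutativeMonoid = presented-isCommutativeMonoid
      ; isPreleftSemimodule = record
        { *ₗ-cong = λ {a} {b} {f} {g} a≈b f≋g → ≋-trans
            (map≋map _ _ (λ _ → relation (term-cong (R.*-congʳ a≈b) ≃-refl)) f)
            (map-respects _ scale f≋g)
        ; *ₗ-zeroˡ = map≋[] _ λ (b , x) → ≋-trans (relation (term-cong (R.zeroˡ b) ≃-refl)) (relation (term-zero x))
        ; *ₗ-distribʳ = λ f a b → map≋++ _ _ _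
            (λ (_ , x) → ≋-trans (relation (term-cong (R.distribʳ _ a b) ≃-refl)) (relation (term-add _ _ x))) f
        ; *ₗ-identityˡ = λ f → ≋-trans
            (map≋map _ id (λ (b , x) → relation (term-cong (R.*-identityˡ b) ≃-refl)) f)
            (≡⇒≋ (List.map-id f))
        ; *ₗ-assoc = λ a b f → ≋-trans
            (map≋map _ _ (λ (_ , x) → relation (term-cong (R.*-assoc a b _) ≃-refl)) f)
            (≡⇒≋ (List.map-∘ f))
        ; *ₗ-zeroʳ = λ _ → ≋-refl
        ; *ₗ-distribˡ = λ a f g → ≡⇒≋ (List.map-++ _ f g) } }
      where
      ≡⇒≋ : ∀ {x y} → x ≡ y → Presented (FreeRelation K _≃′_) x y
      ≡⇒≋ refl = ≋-refl
      scale : ∀ {a f g} → FreeRelation K _≃′_ f g →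
        Presented (FreeRelation K _≃′_) (map (λ (b , x) → a * b , x) f) (map (λ (b , x) → a * b , x) g)
      scale (term-cong b≈c x≃y) = relation (term-cong (R.*-congˡ b≈c) x≃y)
      scale (term-add b c x) =
        ≋-trans (relation (term-cong (R.distribˡ _ b c) ≃-refl)) (relation (term-add _ _ x))
      scale {a} (term-zero x) = ≋-trans (relation (term-cong (R.zeroʳ a) ≃-refl)) (relation (term-zero x))

    *ᵣ≋*ₗ : ∀ a (f : List (k × X)) →
      Presented (FreeRelation K _≃′_) (map (λ (b , x) → b * a , x) f) (map (λ (b , x) → a * b , x) f)
    *ᵣ≋*ₗ a = map≋map _ _ λ (b , x) → relation (term-cong (R.*-comm b a) ≃-refl)

    linear-basis-identity : ∀ f → Presented (FreeRelation K _≃′_) (linear K (Free K _≃′_) (basis K) f) f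
    linear-basis-identity []            = ≋-refl
    linear-basis-identity ((a , x) ∷ f) =
      ++-cong (relation (term-cong (R.*-identityʳ a) ≃-refl)) (linear-basis-identity f)

-- Möbius inversion

module Möbius {c ℓ₁ ℓ₂} (K : HeytingField c ℓ₁ ℓ₂) where
  open LinearAlgebra K
  open SetoidReasoning R.setoid

  private variable
    p : Level
    P : Set p

  ζ δ : SetPartition n → SetPartition n → k
  ζ A B = ⟦ A ≤? B ⟧
  δ A B = ⟦ A ≟ B ⟧

  δ-sym : (A B : SetPartition n) → δ A B ≡ δ B A
  δ-sym A B = ⟦⟧-⇔ (mk⇔ sym sym) (A ≟ B) (B ≟ A)

  Σ[_] : (SetPartition n → k) → k
  Σ[_] {n} = ∑ K (scalars K) (partitions n)

  Σ-cong : {φ ψ : SetPartition n → k} → (∀ A → φ A ≈ ψ A) → Σ[ φ ] ≈ Σ[ ψ ]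
  Σ-cong φ≈ψ = Scalars.∑-cong φ≈ψ (partitions _)

  Σ-δˡ : (A : SetPartition n) (φ : SetPartition n → k) → Σ[ (λ B → δ A B * φ B) ] ≈ φ A
  Σ-δˡ = Scalars.∑-partitions-δ

  Σ-δʳ : (A : SetPartition n) (φ : SetPartition n → k) → Σ[ (λ B → φ B * δ B A) ] ≈ φ A
  Σ-δʳ A φ = R.trans (Σ-cong λ B → R.trans (R.*-comm _ _) (R.*-congʳ (R.reflexive (δ-sym B A)))) (Σ-δˡ A φ)

  ∑-≡ : ∀ {a} {I : Set a} {φ ψ : I → k} → (∀ i → φ i ≡ ψ i) → ∀ is → ∑ K (scalars K) is φ ≡ ∑ K (scalars K) is ψ
  ∑-≡ φ≡ψ []       = refl
  ∑-≡ φ≡ψ (i ∷ is) = cong₂ _+_ (φ≡ψ i) (∑-≡ φ≡ψ is)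

  -- The summands of möbius-acc are local to its definition: the endpoints of
  -- the equations between them can only be inferred from their uses.
  mutual
    möbius-irrelevant : (A B : SetPartition n) (p q : Acc _<_ B) → möbius-acc K A B p ≡ möbius-acc K A B q
    möbius-irrelevant {n} A B (acc rs) (acc rs′) with A ≟ B
    ... | yes _ = refl
    ... | no A≢B = cong -_ (∑-≡ (λ C → term-irrelevant A B rs rs′ A≢B C) (partitions n))

    term-irrelevant : (A B : SetPartition n) (rs rs′ : ∀ {C} → C < B → Acc _<_ C) (A≢B : A ≢ B) → ∀ C → _ ≡ _
    term-irrelevant A B rs rs′ A≢B C with (A ≤? C) ×-dec (C <? B)
    ... | yes (_ , C<B) = möbius-irrelevant A C (rs C<B) (rs′ C<B)
    ... | no  _         = refl

  -- Mirrors the case split in the summands of `möbius-acc`, so that the unfolded recursion can be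
  -- stated.
  restrict : Dec P → k → k
  restrict (yes _) x = x
  restrict (no  _) x = 0#

  restrict≈* : (P? : Dec P) (x : k) → restrict P? x ≈ ⟦ P? ⟧ * x
  restrict≈* (yes _) x = R.sym (R.*-identityˡ x)
  restrict≈* (no  _) x = R.sym (R.zeroˡ x)

  mutual
    -- The recursive calls carry accessibility proofs inherited from `B`; irrelevance replaces them
    -- by the canonical ones, so that the summands become values of `μ`.
    möbius-unfold : (A B : SetPartition n) (p : Acc _<_ B) → A ≢ B →
      möbius-acc K A B p ≡ - Σ[ (λ C → restrict ((A ≤? C) ×-dec (C <? B)) (μ K A C)) ]
    möbius-unfold {n} A B (acc rs) A≢B with A ≟ B
    ... | yes A≡B = contradiction A≡B A≢B
    ... | no A≢B′ = cong -_ (∑-≡ (λ C → term-unfold A B rs A≢B′ C) (partitions n))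

    term-unfold : (A B : SetPartition n) (rs : ∀ {C} → C < B → Acc _<_ C) (A≢B : A ≢ B) → ∀ C → _ ≡ _
    term-unfold A B rs A≢B C with (A ≤? C) ×-dec (C <? B)
    ... | yes (_ , C<B) = möbius-irrelevant A C (rs C<B) (<-wellFounded C)
    ... | no  _         = refl

  μ-unfold : (A B : SetPartition n) → A ≢ B → μ K A B ≈ - Σ[ (λ C → ⟦ (A ≤? C) ×-dec (C <? B) ⟧ * μ K A C) ]
  μ-unfold A B A≢B = R.trans (R.reflexive (möbius-unfold A B (<-wellFounded B) A≢B))
    (R.-‿cong (Σ-cong λ C → restrict≈* ((A ≤? C) ×-dec (C <? B)) (μ K A C)))

  μ-diagonal : (A : SetPartition n) → μ K A A ≡ 1#
  μ-diagonal A with <-wellFounded A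
  ... | acc rs with A ≟ A
  ...   | yes _  = refl
  ...   | no A≢A = contradiction refl A≢A

  ζ-diagonal : (A : SetPartition n) → ζ A A ≡ 1#
  ζ-diagonal A = ⟦⟧-yes (A ≤? A) (≤-refl A)

  -- `A ≤ C < B` would give `A ≤ B`, so the recursion sums over an empty interval.
  μ-zero : (A B : SetPartition n) → ¬ A ≤ B → μ K A B ≈ 0#
  μ-zero {n} A B A≰B = begin
    μ K A B                                                  ≈⟨ μ-unfold A B (λ { refl → A≰B (≤-refl A) }) ⟩
    - Σ[ (λ C → ⟦ (A ≤? C) ×-dec (C <? B) ⟧ * μ K A C) ]     ≈⟨ R.-‿cong (Σ-cong empty) ⟩
    - Σ[ (λ (_ : SetPartition n) → 0#) ]                     ≈⟨ R.-‿cong (Scalars.∑-0 (partitions n)) ⟩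
    - 0#                                                     ≈⟨ -0≈0 ⟩
    0#                                                       ∎
    where
    -0≈0 : - 0# ≈ 0#
    -0≈0 = R.trans (R.sym (R.+-identityˡ _)) (R.-‿inverseʳ 0#)
    empty : ∀ C → ⟦ (A ≤? C) ×-dec (C <? B) ⟧ * μ K A C ≈ 0#
    empty C = R.trans (R.*-congʳ (R.reflexive (⟦⟧-no ((A ≤? C) ×-dec (C <? B))
      λ (A≤C , C≤B , _) → A≰B (≤-trans A C B A≤C C≤B)))) (R.zeroˡ _)

  ζ-split : (A B : SetPartition n) → ζ A B ≈ δ A B + ⟦ A <? B ⟧
  ζ-split A B = split (A ≟ B)
    where
    split : Dec (A ≡ B) → ζ A B ≈ δ A B + ⟦ A <? B ⟧
    split (yes refl) = R.trans (R.reflexive (ζ-diagonal A)) (R.trans (R.sym (R.+-identityʳ 1#))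
      (R.reflexive (sym (cong₂ _+_ (⟦⟧-yes (A ≟ A) refl) (⟦⟧-no (A <? A) λ (_ , A≢A) → A≢A refl)))))
    split (no A≢B) = R.trans (R.reflexive (⟦⟧-⇔ (mk⇔ (_, A≢B) proj₁) (A ≤? B) (A <? B)))
      (R.trans (R.sym (R.+-identityˡ _)) (R.+-congʳ (R.reflexive (sym (⟦⟧-no (A ≟ B) A≢B)))))

  -- Unitriangularity of `ζ`: the term at `B` has coefficient 1, all others come from strictly
  -- below.
  Σ-ζ : (φ : SetPartition n → k) (B : SetPartition n) →
    Σ[ (λ C → φ C * ζ C B) ] ≈ φ B + Σ[ (λ C → φ C * ⟦ C <? B ⟧) ]
  Σ-ζ {n} φ B = begin
    Σ[ (λ C → φ C * ζ C B) ]
      ≈⟨ Σ-cong (λ C → R.trans (R.*-congˡ (ζ-split C B)) (R.distribˡ _ _ _)) ⟩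
    Σ[ (λ C → φ C * δ C B + φ C * ⟦ C <? B ⟧) ]
      ≈⟨ Scalars.∑-+ (partitions n) _ _ ⟩
    Σ[ (λ C → φ C * δ C B) ] + Σ[ (λ C → φ C * ⟦ C <? B ⟧) ]
      ≈⟨ R.+-congʳ (Σ-δʳ B φ) ⟩
    φ B + Σ[ (λ C → φ C * ⟦ C <? B ⟧) ] ∎

  -- For `A ≢ B` this is the defining recursion. For `A ≡ B` only the term at `A` survives, since
  -- `μ K A C` needs `A ≤ C` and `ζ C A` needs `C ≤ A`.
  μζ≈δ : (A B : SetPartition n) → Σ[ (λ C → μ K A C * ζ C B) ] ≈ δ A B
  μζ≈δ A B = split (A ≟ B)
    where
    concentrated : ∀ C → Dec (A ≡ C) → μ K A C * ζ C A ≈ δ A C * 1#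
    concentrated C (yes refl) = R.trans
      (R.*-cong (R.reflexive (μ-diagonal A)) (R.reflexive (ζ-diagonal A)))
      (R.*-congʳ (R.reflexive (sym (⟦⟧-yes (A ≟ A) refl))))
    concentrated C (no A≢C) = R.trans (vanishing (A ≤? C))
      (R.sym (R.trans (R.*-congʳ (R.reflexive (⟦⟧-no (A ≟ C) A≢C))) (R.zeroˡ _)))
      where
      vanishing : Dec (A ≤ C) → μ K A C * ζ C A ≈ 0#
      vanishing (no A≰C)  = R.trans (R.*-congʳ (μ-zero A C A≰C)) (R.zeroˡ _)
      vanishing (yes A≤C) = R.trans
        (R.*-congˡ (R.reflexive (⟦⟧-no (C ≤? A) λ C≤A → A≢C (≤-antisym A C A≤C C≤A)))) (R.zeroʳ _)
    between : _ → k
    between C = ⟦ (A ≤? C) ×-dec (C <? B) ⟧ * μ K A C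
    interval : ∀ C → Dec (A ≤ C) → μ K A C * ⟦ C <? B ⟧ ≈ between C
    interval C (yes A≤C) = R.trans (R.*-comm _ _) (R.*-congʳ (R.reflexive
      (⟦⟧-⇔ (mk⇔ (A≤C ,_) proj₂) (C <? B) ((A ≤? C) ×-dec (C <? B)))))
    interval C (no A≰C) = R.trans (R.trans (R.*-congʳ (μ-zero A C A≰C)) (R.zeroˡ _))
      (R.sym (R.trans (R.*-congˡ (μ-zero A C A≰C)) (R.zeroʳ _)))
    split : Dec (A ≡ B) → Σ[ (λ C → μ K A C * ζ C B) ] ≈ δ A B
    split (yes refl) = R.trans (Σ-cong λ C → concentrated C (A ≟ C)) (R.trans (Σ-δˡ A (λ _ → 1#))
      (R.reflexive (sym (⟦⟧-yes (A ≟ A) refl))))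
    split (no A≢B) = begin
      Σ[ (λ C → μ K A C * ζ C B) ]                  ≈⟨ Σ-ζ (μ K A) B ⟩
      μ K A B + Σ[ (λ C → μ K A C * ⟦ C <? B ⟧) ]   ≈⟨ R.+-cong (μ-unfold A B A≢B) (Σ-cong λ C → interval C
          (A ≤? C)) ⟩
      - Σ[ between ] + Σ[ between ]                 ≈⟨ R.-‿inverseˡ _ ⟩
      0#                                            ≡⟨ ⟦⟧-no (A ≟ B) A≢B ⟨
      δ A B                                         ∎

  -- By unitriangularity the value at `B` is determined by the sum and the values strictly below
  -- `B`, so well-founded induction applies.
  ζ-cancel : (φ ψ : SetPartition n → k) →
    (∀ B → Σ[ (λ C → φ C * ζ C B) ] ≈ Σ[ (λ C → ψ C * ζ C B) ]) → ∀ B → φ B ≈ ψ B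
  ζ-cancel φ ψ φζ≈ψζ B = by-induction B (<-wellFounded B)
    where
    open import Algebra.Properties.Group R.+-group using (∙-cancelʳ)
    by-induction : ∀ B → Acc _<_ B → φ B ≈ ψ B
    by-induction B (acc rs) = ∙-cancelʳ Σ[ (λ C → ψ C * ⟦ C <? B ⟧) ] _ _ (begin
      φ B + Σ[ (λ C → ψ C * ⟦ C <? B ⟧) ]   ≈⟨ R.+-congˡ (Σ-cong λ C → smaller C (C <? B)) ⟨
      φ B + Σ[ (λ C → φ C * ⟦ C <? B ⟧) ]   ≈⟨ Σ-ζ φ B ⟨
      Σ[ (λ C → φ C * ζ C B) ]              ≈⟨ φζ≈ψζ B ⟩
      Σ[ (λ C → ψ C * ζ C B) ]              ≈⟨ Σ-ζ ψ B ⟩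
      ψ B + Σ[ (λ C → ψ C * ⟦ C <? B ⟧) ]   ∎)
      where
      smaller : ∀ C → Dec (C < B) → φ C * ⟦ C <? B ⟧ ≈ ψ C * ⟦ C <? B ⟧
      smaller C (yes C<B) = R.*-congʳ (by-induction C (rs C<B))
      smaller C (no  C≮B) rewrite ⟦⟧-no (C <? B) C≮B = R.trans (R.zeroʳ _) (R.sym (R.zeroʳ _))

  infixl 7 _⊙_

  -- Product of the incidence algebra, summed over all partitions; the supports of `ζ` and `μ` cut
  -- the range down to intervals.
  _⊙_ : (M N : SetPartition n → SetPartition n → k) → SetPartition n → SetPartition n → k
  (M ⊙ N) A B = Σ[ (λ C → M A C * N C B) ]

  ⊙-assoc : (L M N : SetPartition n → SetPartition n → k) → ∀ A B → ((L ⊙ M) ⊙ N) A B ≈ (L ⊙ (M ⊙ N)) A B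
  ⊙-assoc {n} L M N A B = begin
    Σ[ (λ D → Σ[ (λ C → L A C * M C D) ] * N D B) ]
      ≈⟨ Σ-cong (λ D → Scalars.∑-*ₗ (partitions n) (λ C → L A C * M C D) (N D B)) ⟩
    Σ[ (λ D → Σ[ (λ C → L A C * M C D * N D B) ]) ]
      ≈⟨ Scalars.∑-swap (partitions n) (partitions n) _ ⟩
    Σ[ (λ C → Σ[ (λ D → L A C * M C D * N D B) ]) ]
      ≈⟨ Σ-cong (λ C → R.trans (Scalars.*ₗ-∑ (L A C) (partitions n) (λ D → M C D * N D B)) (Σ-cong λ D → R.sym
          (R.*-assoc (L A C) (M C D) (N D B)))) ⟨
    Σ[ (λ C → L A C * Σ[ (λ D → M C D * N D B) ]) ] ∎

  -- The recursion makes `μ` a left inverse of `ζ`. That it is a right inverse follows by cancelling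
  -- `ζ` from `(ζ ⊙ μ) ⊙ ζ = ζ ⊙ (μ ⊙ ζ) = ζ = δ ⊙ ζ`.
  ζμ≈δ : (A B : SetPartition n) → (ζ ⊙ μ K) A B ≈ δ A B
  ζμ≈δ A = ζ-cancel ((ζ ⊙ μ K) A) (δ A) λ D → begin
    ((ζ ⊙ μ K) ⊙ ζ) A D   ≈⟨ ⊙-assoc ζ (μ K) ζ A D ⟩
    (ζ ⊙ (μ K ⊙ ζ)) A D   ≈⟨ Σ-cong (λ C → R.*-congˡ (μζ≈δ C D)) ⟩
    (ζ ⊙ δ) A D           ≈⟨ Σ-δʳ D (ζ A) ⟩
    ζ A D                 ≈⟨ Σ-δˡ A (λ C → ζ C D) ⟨
    (δ ⊙ ζ) A D           ∎

-- Characters of kΠ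

module Characters {c ℓ₁ ℓ₂} (K : HeytingField c ℓ₁ ℓ₂) where
  open LinearAlgebra K
  open Möbius K
  open SetoidReasoning R.setoid

  infix 4 _≋_

  _≋_ : Rel (∣kΠ∣ K n) _
  _≋_ {n} = RawBimodule._≈ᴹ_ (kΠ K n)

  χ : SetPartition n → ∣kΠ∣ K n → k
  χ A = linear K (scalars K) (ζ A)

  χ-cong : (A : SetPartition n) → ∀ {x y} → x ≋ y → χ A x ≈ χ A y
  χ-cong A = Scalars.linear-respects (ζ A) λ { refl → R.refl }

  χ-basis : (A C : SetPartition n) → χ A (basis K C) ≈ ζ A C
  χ-basis A = Scalars.linear-basis (ζ A)

  -- Every partition lies below `𝟏`, so one-term sums at `𝟏` realise each scalar under every
  -- character; they serve as representatives in `V A`.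
  χ-𝟏 : (A : SetPartition n) (a : k) → χ A [ a , 𝟏 ] ≈ a
  χ-𝟏 A a = R.trans (R.+-identityʳ _)
    (R.trans (R.*-congˡ (R.reflexive (⟦⟧-yes (A ≤? 𝟏) (≤𝟏 A)))) (R.*-identityʳ a))

  χ-*ᵣ : (A : SetPartition n) → ∀ a x → χ A (map (λ (b , C) → b * a , C) x) ≈ χ A x * a
  χ-*ᵣ A a x = R.trans (χ-cong A (*ᵣ≋*ₗ refl a x)) (R.trans (Scalars.linear-*ₗ (ζ A) a x) (R.*-comm a _))

  -- The universal property of the meet makes `A ≤ B ∧ C` a conjunction, and the bracket of a
  -- conjunction is a product.
  χ-∧ : (A : SetPartition n) → ∀ x y → χ A (_∧ₖ_ K x y) ≈ χ A x * χ A y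
  χ-∧ A = linear-bilinear {_≃′_ = _≡_} (ζ A) (λ B C → basis K (B ∧ C)) (ζ A) (ζ A) λ B C →
    R.trans (χ-basis A (B ∧ C))
      (R.trans (R.reflexive (⟦⟧-⇔ (≤∧⇔ B C A) (A ≤? B ∧ C) ((A ≤? B) ×-dec (A ≤? C))))
               (⟦⟧-× (A ≤? B) (A ≤? C)))

  -- Lets the condition `A ≤ B` be dropped from sums weighted by `μ`.
  ζ*μ≈μ : (A B : SetPartition n) → ζ A B * μ K A B ≈ μ K A B
  ζ*μ≈μ A B = split (A ≤? B)
    where
    split : Dec (A ≤ B) → ζ A B * μ K A B ≈ μ K A B
    split (yes A≤B) = R.trans (R.*-congʳ (R.reflexive (⟦⟧-yes (A ≤? B) A≤B))) (R.*-identityˡ _)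
    split (no  A≰B) = R.trans (R.*-congˡ (μ-zero A B A≰B)) (R.trans (R.zeroʳ _) (R.sym (μ-zero A B A≰B)))

  -- The value is an entry of `ζ ⊙ μ`. When `kΠ` is viewed through its characters as an algebra of
  -- functions on the partitions, `e A` is the indicator of the point `A`.
  χ-e : (E A : SetPartition n) → χ E (e K A) ≈ δ E A
  χ-e {n} E A = begin
    χ E (e K A)
      ≈⟨ Scalars.linear-∑ {_≃′_ = _≡_} (ζ E) (filter (_≤? A) (partitions n)) (λ B → [ μ K B A , B ]) ⟩
    ∑ K (scalars K) (filter (_≤? A) (partitions n)) (λ B → χ E [ μ K B A , B ])
      ≈⟨ Scalars.∑-filter (_≤? A) (partitions n) _ ⟩
    Σ[ (λ B → ζ B A * χ E [ μ K B A , B ]) ]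
      ≈⟨ Σ-cong (λ B → R.*-congˡ {ζ B A} (R.+-identityʳ (μ K B A * ζ E B))) ⟩
    Σ[ (λ B → ζ B A * (μ K B A * ζ E B)) ]
      ≈⟨ Σ-cong (λ B → R.trans (R.sym (R.*-assoc (ζ B A) (μ K B A) (ζ E B)))
           (R.trans (R.*-congʳ (ζ*μ≈μ B A)) (R.*-comm (μ K B A) (ζ E B)))) ⟩
    (ζ ⊙ μ K) E A
      ≈⟨ ζμ≈δ E A ⟩
    δ E A ∎

  χ-e-self : (A : SetPartition n) → χ A (e K A) ≈ 1#
  χ-e-self A = R.trans (χ-e A A) (R.reflexive (⟦⟧-yes (A ≟ A) refl))

  -- The character table is `ζ`, so `μ` turns character values back into coefficients.
  coefficient-χ : (B : SetPartition n) → ∀ x →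
    linear K (scalars K) (λ C → δ C B) x ≈ Σ[ (λ A → μ K B A * χ A x) ]
  coefficient-χ {n} B x = begin
    linear K (scalars K) (λ C → δ C B) x
      ≈⟨ Scalars.linear-cong (λ C → R.trans (μζ≈δ B C) (R.reflexive (δ-sym B C))) x ⟨
    linear K (scalars K) (λ C → Σ[ (λ A → μ K B A * ζ A C) ]) x
      ≈⟨ Scalars.linear-∑-index (λ A C → μ K B A * ζ A C) (partitions n) x ⟩
    Σ[ (λ A → linear K (scalars K) (λ C → μ K B A * ζ A C) x) ]
      ≈⟨ Σ-cong (λ A → linear-*ˡ (μ K B A) (ζ A) x) ⟩
    Σ[ (λ A → μ K B A * χ A x) ] ∎

  -- Equal character values give equal coefficients, and coefficients determine a linear extension;
  -- here the extension of `basis` is the identity up to equality.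
  χ-separates : (x y : ∣kΠ∣ K n) → (∀ A → χ A x ≈ χ A y) → x ≋ y
  χ-separates {n} x y χx≈χy = ≋-trans (≋-sym (linear-basis-identity refl x)) (≋-trans
    (kΠ.linear-coefficients _≟_ (basis K) x y λ B →
      R.trans (coefficient-χ B x) (R.trans (Σ-cong λ A → R.*-congˡ (χx≈χy A)) (R.sym (coefficient-χ B y))))
    (linear-basis-identity refl y))
    where module kΠ = Sums (kΠ K n) (free-isVectorSpace refl)

  -- Simple modules

  module _ (A : SetPartition n) (x y : ∣kΠ∣ K n) where

    -- Multiplication by `e A` kills every character except `χ A`, so `V A` is a line with
    -- coordinate `χ A`.
    V-≈⁺ : χ A x ≈ χ A y → RawBimodule._≈ᴹ_ (V K A) x y
    V-≈⁺ χx≈χy = χ-separates _ _ λ E → R.trans (χ-∧ E x (e K A)) (R.trans (agree E (E ≟ A)) (R.sym (χ-∧ E y (e K A))))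
      where
      agree : ∀ E → Dec (E ≡ A) → χ E x * χ E (e K A) ≈ χ E y * χ E (e K A)
      agree E (yes refl) = R.*-congʳ χx≈χy
      agree E (no E≢A)   = R.trans (R.*-congˡ χ≈0) (R.trans (R.zeroʳ _) (R.sym (R.trans (R.*-congˡ χ≈0) (R.zeroʳ _))))
        where
        χ≈0 : χ E (e K A) ≈ 0#
        χ≈0 = R.trans (χ-e E A) (R.reflexive (⟦⟧-no (E ≟ A) E≢A))

    V-≈⁻ : RawBimodule._≈ᴹ_ (V K A) x y → χ A x ≈ χ A y
    V-≈⁻ x≈y = R.trans (χ∧e x) (R.trans (χ-cong A x≈y) (R.sym (χ∧e y)))
      where
      χ∧e : ∀ z → χ A z ≈ χ A (_∧ₖ_ K z (e K A))
      χ∧e z = R.sym (R.trans (χ-∧ A z (e K A)) (R.trans (R.*-congˡ (χ-e-self A)) (R.*-identityʳ _)))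

  -- The isomorphism sends `u` to the multiple `φ u` of `𝟏`. Its coordinate in `V A` is `φ u`, so
  -- each condition on the map becomes an identity of scalars.
  ≅V⁺ : ∀ {a ℓ} (M : Moduleᵖ K n a ℓ) (A : SetPartition n) → let open RawBimodule M in
    (φ : Carrierᴹ → k) →
    (∀ {u v} → u ≈ᴹ v → φ u ≈ φ v) →
    (∀ u v → φ (u +ᴹ v) ≈ φ u + φ v) →
    φ 0ᴹ ≈ 0# →
    (∀ u → φ (-ᴹ u) ≈ - φ u) →
    (∀ x u → φ (x *ₗ u) ≈ χ A x * φ u) →
    (∀ {u v} → φ u ≈ φ v → u ≈ᴹ v) →
    (∀ a → ∃ λ u → φ u ≈ a) →
    M ≅ V K A
  ≅V⁺ M A φ φ-cong φ-+ φ-0 φ-neg φ-* φ-injective φ-surjective = f , record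
    { isLeftModuleMonomorphism = record
      { isLeftModuleHomomorphism = record
        { +ᴹ-isGroupHomomorphism = record
          { isMonoidHomomorphism = record
            { isMagmaHomomorphism = record
              { isRelHomomorphism = record
                { cong = λ {u} {v} u≈v → into u (f v) (R.trans (φ-cong u≈v) (R.sym (χf v))) }
              ; homo = λ u v → into _ (f u ++ f v) (R.trans (φ-+ u v) (R.sym
                  (R.trans (Scalars.linear-++ (ζ A) (f u) (f v)) (R.+-cong (χf u) (χf v))))) }
            ; ε-homo = into _ [] φ-0 }
          ; ⁻¹-homo = λ u → into _ (map (λ (a , C) → - a , C) (f u))
              (R.trans (φ-neg u) (R.sym (R.trans (linear-neg (ζ A) (f u)) (R.-‿cong (χf u))))) }
        ; *ₗ-homo = λ x u → into _ (_∧ₖ_ K x (f u))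
            (R.trans (φ-* x u) (R.sym (R.trans (χ-∧ A x (f u)) (R.*-congˡ (χf u))))) }
      ; injective = λ {u} {v} fu≈fv →
          φ-injective (R.trans (R.sym (χf u)) (R.trans (V-≈⁻ A (f u) (f v) fu≈fv) (χf v))) }
    ; surjective = λ y → proj₁ (φ-surjective (χ A y)) ,
        λ {u} u≈ → into u y (R.trans (φ-cong u≈) (proj₂ (φ-surjective (χ A y)))) }
    where
    f : RawBimodule.Carrierᴹ M → ∣kΠ∣ K _
    f u = [ φ u , 𝟏 ]
    χf : ∀ u → χ A (f u) ≈ φ u
    χf u = χ-𝟏 A (φ u)
    into : ∀ u y → φ u ≈ χ A y → RawBimodule._≈ᴹ_ (V K A) (f u) y
    into u y φu≈ = V-≈⁺ A (f u) y (R.trans (χf u) φu≈)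

-- Induction and the diagonal action

module Modules {c ℓ₁ ℓ₂} (K : HeytingField c ℓ₁ ℓ₂) where
  open LinearAlgebra K
  open Möbius K
  open Characters K
  open SetoidReasoning R.setoid

  private variable
    a b r s t ℓ ℓ′ : Level

  *-interchange : ∀ w x y z → (w * x) * (y * z) ≈ (w * y) * (x * z)
  *-interchange = interchange
    where open import Algebra.Properties.CommutativeSemigroup R.*-commutativeSemigroup using (interchange)

  ∑-cartesianProductWith : ∀ {I : Set a} {J : Set b} {L : Set s} (f : I → J → L)
    (α : I → k) (β : J → k) (φ : L → k) → (∀ i j → φ (f i j) ≈ α i * β j) → ∀ is js →
    ∑ K (scalars K) (cartesianProductWith f is js) φ ≈ ∑ K (scalars K) is α * ∑ K (scalars K) js β
  ∑-cartesianProductWith f α β φ φf []       js = R.sym (R.zeroˡ _)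
  ∑-cartesianProductWith f α β φ φf (i ∷ is) js = begin
    ∑ K (scalars K) (map (f i) js ++ cartesianProductWith f is js) φ
      ≈⟨ Scalars.∑-++ (map (f i) js) _ φ ⟩
    ∑ K (scalars K) (map (f i) js) φ + ∑ K (scalars K) (cartesianProductWith f is js) φ
      ≈⟨ R.+-cong (R.trans (R.reflexive (Scalars.∑-map (f i) js φ))
                    (R.trans (Scalars.∑-cong (φf i) js) (R.sym (Scalars.*ₗ-∑ (α i) js β))))
                  (∑-cartesianProductWith f α β φ φf is js) ⟩
    α i * ∑ K (scalars K) js β + ∑ K (scalars K) is α * ∑ K (scalars K) js β
      ≈⟨ R.distribʳ _ _ _ ⟨
    ∑ K (scalars K) (i ∷ is) α * ∑ K (scalars K) js β ∎

  module _ {G : Set a} {_∼_ : Rel (List G) r} (ψ : G → k) (nf : k → List G)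
    (nf-0 : Presented _∼_ [] (nf 0#)) (nf-+ : ∀ x y → Presented _∼_ (nf x ++ nf y) (nf (x + y)))
    (nf-generator : ∀ g → Presented _∼_ [ g ] (nf (ψ g))) where

    -- If each generator reduces to a multiple of one fixed element, so does each formal sum, the
    -- multiple being its value under the additive extension of `ψ`. Injectivity of functionals on
    -- tensor products is obtained this way, as equality there is known only through a presentation.
    normal-form : ∀ z → Presented _∼_ z (nf (∑ K (scalars K) z ψ))
    normal-form []      = nf-0
    normal-form (g ∷ z) = ≋-trans (++-cong (nf-generator g) (normal-form z)) (nf-+ _ _)

  module Tensor {S : Set s} {T : Set t}
    (M : RawBimodule T S a ℓ) (N : RawBimodule S k b ℓ′)
    (α : RawBimodule.Carrierᴹ M → k) (β : RawBimodule.Carrierᴹ N → k) where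
    private
      module M = RawBimodule M
      module N = RawBimodule N

    pairing : RawBimodule.Carrierᴹ (M ⊗ N) → k
    pairing z = ∑ K (scalars K) z (λ (u , v) → α u * β v)

    module _
      (α-cong : ∀ {u v} → u M.≈ᴹ v → α u ≈ α v) (α-+ : ∀ u v → α (u M.+ᴹ v) ≈ α u + α v) (α-0 : α M.0ᴹ ≈ 0#)
      (β-cong : ∀ {u v} → u N.≈ᴹ v → β u ≈ β v) (β-+ : ∀ u v → β (u N.+ᴹ v) ≈ β u + β v) (β-0 : β N.0ᴹ ≈ 0#)
      (balanced : ∀ u x v → α (u M.*ᵣ x) * β v ≈ α u * β (x N.*ₗ v)) where

      pairing-cong : ∀ {y z} → RawBimodule._≈ᴹ_ (M ⊗ N) y z → pairing y ≈ pairing z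
      pairing-cong = Scalars.∑-respects _ λ where
        (⊗-cong p q)         → R.+-congʳ (R.*-cong (α-cong p) (β-cong q))
        (⊗-addˡ u u′ v)      → R.trans (R.+-congʳ (R.trans (R.*-congʳ (α-+ u u′)) (R.distribʳ _ _ _)))
            (R.+-assoc _ _ _)
        (⊗-addʳ u v v′)      → R.trans (R.+-congʳ (R.trans (R.*-congˡ (β-+ v v′)) (R.distribˡ _ _ _)))
            (R.+-assoc _ _ _)
        (⊗-zeroˡ v)          → R.trans (R.+-identityʳ _) (R.trans (R.*-congʳ α-0) (R.zeroˡ _))
        (⊗-zeroʳ u)          → R.trans (R.+-identityʳ _) (R.trans (R.*-congˡ β-0) (R.zeroʳ _))
        (⊗-balanced u x v)   → R.+-congʳ (balanced u x v)

    pairing-++ : ∀ y z → pairing (y ++ z) ≈ pairing y + pairing z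
    pairing-++ y z = Scalars.∑-++ y z _

    pairing-neg : (∀ u → α (M.-ᴹ u) ≈ - α u) → ∀ z → pairing (RawBimodule.-ᴹ_ (M ⊗ N) z) ≈ - pairing z
    pairing-neg α-neg z = R.trans (R.reflexive (Scalars.∑-map _ z _)) (R.trans
      (Scalars.∑-cong (λ (u , v) → R.trans (R.*-congʳ (α-neg u)) (R.sym (-‿distribˡ-* (α u) (β v)))) z)
      (-‿∑ z _))

    pairing-*ₗ : ∀ x {y} → (∀ u → α (x M.*ₗ u) ≈ y * α u) → ∀ z →
      pairing (RawBimodule._*ₗ_ (M ⊗ N) x z) ≈ y * pairing z
    pairing-*ₗ x {y} α-* z = R.trans (R.reflexive (Scalars.∑-map _ z _)) (R.trans
      (Scalars.∑-cong (λ (u , v) → R.trans (R.*-congʳ (α-* u)) (R.*-assoc y (α u) (β v))) z)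
      (R.sym (Scalars.*ₗ-∑ y z _)))

  -- Also a functional on V A ⊗ V B, whose elements are the same formal sums.
  χ² : SetPartition n → SetPartition m → kΠ⊗kΠ K n m → k
  χ² A B z = ∑ K (scalars K) z (λ (x , y) → χ A x * χ B y)

  module External (A : SetPartition n) (B : SetPartition m) where
    open RawBimodule (_⊠_ K (V K A) (V K B)) using (_≈ᴹ_; -ᴹ_; _*ₗ_)
    private module T = Tensor (vectorSpace K (V K A)) (vectorSpace K (V K B)) (χ A) (χ B)

    χ²-cong : ∀ {y z} → y ≈ᴹ z → χ² A B y ≈ χ² A B z
    χ²-cong = T.pairing-cong
      (λ {u} {v} → V-≈⁻ A u v) (Scalars.linear-++ (ζ A)) R.refl
      (λ {u} {v} → V-≈⁻ B u v) (Scalars.linear-++ (ζ B)) R.refl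
      λ u x v → begin
        χ A (map (λ (b , C) → b * x , C) u) * χ B v   ≈⟨ R.*-congʳ (χ-*ᵣ A x u) ⟩
        (χ A u * x) * χ B v                           ≈⟨ R.*-assoc _ _ _ ⟩
        χ A u * (x * χ B v)                           ≈⟨ R.*-congˡ (R.*-comm _ _) ⟩
        χ A u * (χ B v * x)                           ≈⟨ R.*-congˡ (χ-*ᵣ B x v) ⟨
        χ A u * χ B (map (λ (b , C) → b * x , C) v)   ∎

    χ²-++ : ∀ y z → χ² A B (y ++ z) ≈ χ² A B y + χ² A B z
    χ²-++ = T.pairing-++

    χ²-neg : ∀ z → χ² A B (-ᴹ z) ≈ - χ² A B z
    χ²-neg = T.pairing-neg (linear-neg (ζ A))

    χ²-*ₗ : ∀ y z → χ² A B (y *ₗ z) ≈ χ² A B y * χ² A B z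
    χ²-*ₗ = ∑-cartesianProductWith _ _ _ _ λ (x , y) (u , v) →
      R.trans (R.*-cong (χ-∧ A x u) (χ-∧ B y v)) (*-interchange _ _ _ _)

    -- The multiple `x` of `𝟏 ⊗ 𝟏`, to which every tensor will be reduced.
    unit : k → kΠ⊗kΠ K n m
    unit x = [ [ x , 𝟏 ] , basis K 𝟏 ]

    χ²-unit : ∀ x → χ² A B (unit x) ≈ x
    χ²-unit x = R.trans (R.+-identityʳ _)
      (R.trans (R.*-cong (χ-𝟏 A x) (χ-𝟏 B 1#)) (R.*-identityʳ x))

    private
      unit-cong : ∀ {u x} → χ A u ≈ x → [ u , basis K 𝟏 ] ≈ᴹ unit x
      unit-cong {u} {x} χu≈x = relation
        (⊗-cong (V-≈⁺ A u [ x , 𝟏 ] (R.trans χu≈x (R.sym (χ-𝟏 A x)))) (V-≈⁺ B (basis K 𝟏) (basis K 𝟏) R.refl))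

      -- In `V B` the factor `v` is a scalar multiple of `𝟏`; balancing carries that scalar over to
      -- the left factor.
      unit-generator : ∀ g → [ g ] ≈ᴹ unit (χ A (proj₁ g) * χ B (proj₂ g))
      unit-generator (u , v) = ≋-trans
        (relation (⊗-cong (V-≈⁺ A u u R.refl)
          (V-≈⁺ B v [ 1# * χ B v , 𝟏 ] (R.sym (R.trans (χ-𝟏 B _) (R.*-identityˡ _))))))
        (≋-trans (≋-sym (relation (⊗-balanced u (χ B v) (basis K 𝟏)))) (unit-cong (χ-*ᵣ A (χ B v) u)))

    ≈ᴹ-unit : ∀ z → z ≈ᴹ unit (χ² A B z)
    ≈ᴹ-unit = normal-form _ unit
      (≋-trans (≋-sym (relation (⊗-zeroˡ (basis K 𝟏)))) (unit-cong R.refl))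
      (λ x y → ≋-trans (≋-sym (relation (⊗-addˡ [ x , 𝟏 ] [ y , 𝟏 ] (basis K 𝟏)))) (unit-cong
        (R.trans (Scalars.linear-++ (ζ A) [ x , 𝟏 ] [ y , 𝟏 ]) (R.+-cong (χ-𝟏 A x) (χ-𝟏 A y)))))
      unit-generator

    χ²-injective : ∀ {y z} → χ² A B y ≈ χ² A B z → y ≈ᴹ z
    χ²-injective {y} {z} eq = ≋-trans (≈ᴹ-unit y) (≋-trans
      (unit-cong (R.trans (χ-𝟏 A _) eq)) (≋-sym (≈ᴹ-unit z)))

  -- The underlying space and its functional are those of the external product; only the character
  -- through which `kΠ` acts along `C ↦ C ⊗ C` has to be computed.
  diagonal : (A B : SetPartition n) → _⊗ᵈ_ K (V K A) (V K B) ≅ V K (A ∨ B)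
  diagonal A B = ≅V⁺ (_⊗ᵈ_ K (V K A) (V K B)) (A ∨ B) (χ² A B)
    χ²-cong χ²-++ R.refl χ²-neg
    (λ x z → R.trans (χ²-*ₗ (map (λ (a , C) → [ a , C ] , basis K C) x) z) (R.*-congʳ (χ²-diagonal x)))
    χ²-injective (λ x → unit x , χ²-unit x)
    where
    open External A B
    χ²-diagonal : ∀ x → χ² A B (map (λ (a , C) → [ a , C ] , basis K C) x) ≈ χ (A ∨ B) x
    χ²-diagonal x = R.trans (R.reflexive (Scalars.∑-map _ x _)) (Scalars.∑-cong (λ (a , C) → begin
      χ A [ a , C ] * χ B (basis K C)   ≈⟨ R.*-cong (R.+-identityʳ (a * ζ A C)) (χ-basis B C) ⟩
      a * ζ A C * ζ B C                 ≈⟨ R.*-assoc _ _ _ ⟩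
      a * (ζ A C * ζ B C)               ≈⟨ R.*-congˡ (⟦⟧-× (A ≤? C) (B ≤? C)) ⟨
      a * ⟦ (A ≤? C) ×-dec (B ≤? C) ⟧   ≡⟨ cong (a *_) (⟦⟧-⇔ (∨≤⇔ A B C) (A ∨ B ≤? C) ((A ≤? C) ×-dec (B ≤? C))) ⟨
      a * ζ (A ∨ B) C                   ∎) x)

  -- The first factor is the value of `χ E` at `𝟏 ∣ 𝟏`, the image of the unit. Along `ρ` a character
  -- becomes the product of the characters of the restrictions if `E ≤ 𝟏 ∣ 𝟏`, and zero otherwise.
  χ-ρ : (E : SetPartition (n ℕ.+ m)) (z : kΠ⊗kΠ K n m) →
    χ E (ρ K z) ≈ ζ E (𝟏 {n} ∣ 𝟏 {m}) * χ² (resˡ n m E) (resʳ n m E) z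
  χ-ρ {n} {m} E z = begin
    χ E (ρ K z)
      ≈⟨ Scalars.linear-∑ {_≃′_ = _≡_} (ζ E) z (λ (x , y) → juxtapose x y) ⟩
    ∑ K (scalars K) z (λ (x , y) → χ E (juxtapose x y))
      ≈⟨ Scalars.∑-cong (λ (x , y) → R.trans
           (linear-bilinear {_≃′_ = _≡_} (ζ E) (λ C D → basis K (C ∣ D)) (λ C → u * ζ E₁ C) (ζ E₂) split x y)
           (R.trans (R.*-congʳ (linear-*ˡ u (ζ E₁) x)) (R.*-assoc _ _ _))) z ⟩
    ∑ K (scalars K) z (λ (x , y) → u * (χ E₁ x * χ E₂ y))
      ≈⟨ Scalars.*ₗ-∑ u z _ ⟨
    u * χ² E₁ E₂ z ∎
    where
    u  = ζ E (𝟏 {n} ∣ 𝟏 {m})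
    E₁ = resˡ n m E
    E₂ = resʳ n m E
    juxtapose : ∣kΠ∣ K n → ∣kΠ∣ K m → ∣kΠ∣ K (n ℕ.+ m)
    juxtapose = bilinear K (kΠ K (n ℕ.+ m)) (λ C D → basis K (C ∣ D))
    split : ∀ C D → χ E (basis K (C ∣ D)) ≈ (u * ζ E₁ C) * ζ E₂ D
    split C D = begin
      χ E (basis K (C ∣ D))
        ≈⟨ χ-basis E (C ∣ D) ⟩
      ζ E (C ∣ D)
        ≡⟨ ⟦⟧-⇔ (≤∣⇔ C D E) (E ≤? C ∣ D) ((E ≤? 𝟏 {n} ∣ 𝟏 {m}) ×-dec ((E₁ ≤? C) ×-dec (E₂ ≤? D))) ⟩
      ⟦ (E ≤? 𝟏 {n} ∣ 𝟏 {m}) ×-dec ((E₁ ≤? C) ×-dec (E₂ ≤? D)) ⟧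
        ≈⟨ R.trans (⟦⟧-× (E ≤? 𝟏 {n} ∣ 𝟏 {m}) ((E₁ ≤? C) ×-dec (E₂ ≤? D))) (R.*-congˡ (⟦⟧-× (E₁ ≤? C) (E₂ ≤? D))) ⟩
      u * (ζ E₁ C * ζ E₂ D)
        ≈⟨ R.*-assoc _ _ _ ⟨
      (u * ζ E₁ C) * ζ E₂ D ∎

  χ-∣-ρ : (A : SetPartition n) (B : SetPartition m) → ∀ z → χ (A ∣ B) (ρ K z) ≈ χ² A B z
  χ-∣-ρ {n} {m} A B z = begin
    χ (A ∣ B) (ρ K z)
      ≈⟨ χ-ρ (A ∣ B) z ⟩
    ζ (A ∣ B) (𝟏 {n} ∣ 𝟏 {m}) * χ² (resˡ n m (A ∣ B)) (resʳ n m (A ∣ B)) z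
      ≡⟨ cong₂ _*_ (⟦⟧-yes (A ∣ B ≤? 𝟏 {n} ∣ 𝟏 {m}) (proj₁ (Equivalence.to (≤∣⇔ A B (A ∣ B)) (≤-refl (A ∣ B)))))
           (cong₂ (λ C D → χ² C D z) (resˡ-∣ A B) (resʳ-∣ A B)) ⟩
    1# * χ² A B z
      ≈⟨ R.*-identityˡ _ ⟩
    χ² A B z ∎

  χ-ρ-*ₗ : (E : SetPartition (n ℕ.+ m)) → ∀ x u v →
    χ E (ρ K {n} {m} [ map (λ (a , C) → x * a , C) u , v ]) ≈ x * χ E (ρ K {n} {m} [ u , v ])
  χ-ρ-*ₗ {n} {m} E x u v = begin
    χ E (ρ K {n} {m} [ map (λ (a , C) → x * a , C) u , v ])
      ≈⟨ χ-ρ E [ map (λ (a , C) → x * a , C) u , v ] ⟩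
    ζ E (𝟏 {n} ∣ 𝟏 {m}) * (χ E₁ (map (λ (a , C) → x * a , C) u) * χ E₂ v + 0#)
      ≈⟨ R.*-congˡ (R.trans (R.+-identityʳ _)
           (R.trans (R.*-congʳ (Scalars.linear-*ₗ (ζ E₁) x u)) (R.*-assoc _ _ _))) ⟩
    ζ E (𝟏 {n} ∣ 𝟏 {m}) * (x * (χ E₁ u * χ E₂ v))
      ≈⟨ x∙yz≈y∙xz _ _ _ ⟩
    x * (ζ E (𝟏 {n} ∣ 𝟏 {m}) * (χ E₁ u * χ E₂ v))
      ≈⟨ R.*-congˡ (R.trans (χ-ρ E [ u , v ]) (R.*-congˡ (R.+-identityʳ _))) ⟨
    x * χ E (ρ K {n} {m} [ u , v ]) ∎
    where
    E₁ = resˡ n m E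
    E₂ = resʳ n m E

  -- All characters agree: the idempotents fix both restrictions of `E`, and the factor
  -- `ζ E (𝟏 ∣ 𝟏)` excludes those `E` with these restrictions that join the two halves.
  ρ-e : (A : SetPartition n) (B : SetPartition m) → ρ K [ e K A , e K B ] ≋ e K (A ∣ B)
  ρ-e {n} {m} A B = χ-separates (ρ K [ e K A , e K B ]) (e K (A ∣ B)) λ E →
    let E₁ = resˡ n m E ; E₂ = resʳ n m E in begin
    χ E (ρ K [ e K A , e K B ])
      ≈⟨ χ-ρ E [ e K A , e K B ] ⟩
    ζ E (𝟏 {n} ∣ 𝟏 {m}) * χ² E₁ E₂ [ e K A , e K B ]
      ≈⟨ R.*-congˡ (R.trans (R.+-identityʳ _) (R.*-cong (χ-e E₁ A) (χ-e E₂ B))) ⟩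
    ζ E (𝟏 {n} ∣ 𝟏 {m}) * (δ E₁ A * δ E₂ B)
      ≈⟨ R.trans (⟦⟧-× (E ≤? 𝟏 {n} ∣ 𝟏 {m}) ((E₁ ≟ A) ×-dec (E₂ ≟ B))) (R.*-congˡ (⟦⟧-× (E₁ ≟ A) (E₂ ≟ B))) ⟨
    ⟦ (E ≤? 𝟏 {n} ∣ 𝟏 {m}) ×-dec ((E₁ ≟ A) ×-dec (E₂ ≟ B)) ⟧
      ≡⟨ ⟦⟧-⇔ (≡∣⇔ E A B) (E ≟ A ∣ B) ((E ≤? 𝟏 {n} ∣ 𝟏 {m}) ×-dec ((E₁ ≟ A) ×-dec (E₂ ≟ B))) ⟨
    δ E (A ∣ B)
      ≈⟨ χ-e E (A ∣ B) ⟨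
    χ E (e K (A ∣ B)) ∎

  -- The left factor is compared in `kΠ`, where `χ (A ∣ B)` alone does not decide equality. A
  -- multiple of `e A ⊗ e B` acts on the vector `unit 1#` as a scalar; moved across the tensor it
  -- becomes a multiple of `e (A ∣ B)`, which annihilates all other characters of the left factor.
  induction : (A : SetPartition n) (B : SetPartition m) → Ind K n m (_⊠_ K (V K A) (V K B)) ≅ V K (A ∣ B)
  induction {n} {m} A B = ≅V⁺ (Ind K n m W) (A ∣ B) T.pairing
    (T.pairing-cong
      (λ {u} {v} → χ-cong (A ∣ B) {u} {v}) (Scalars.linear-++ (ζ (A ∣ B))) R.refl χ²-cong χ²-++ R.refl
      λ x y z → begin
        χ (A ∣ B) (_∧ₖ_ K x (ρ K y)) * χ² A B z      ≈⟨ R.*-congʳ (χ-∧ (A ∣ B) x (ρ K y)) ⟩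
        (χ (A ∣ B) x * χ (A ∣ B) (ρ K y)) * χ² A B z ≈⟨ R.*-assoc _ _ _ ⟩
        χ (A ∣ B) x * (χ (A ∣ B) (ρ K y) * χ² A B z) ≈⟨ R.*-congˡ (R.*-congʳ (χ-∣-ρ A B y)) ⟩
        χ (A ∣ B) x * (χ² A B y * χ² A B z)          ≈⟨ R.*-congˡ (χ²-*ₗ y z) ⟨
        χ (A ∣ B) x * χ² A B (RawBimodule._*ₗ_ W y z) ∎)
    T.pairing-++ R.refl (T.pairing-neg (linear-neg (ζ (A ∣ B))))
    (λ x → T.pairing-*ₗ x (χ-∧ (A ∣ B) x))
    (λ {y} {z} eq → ≋-trans (≈ᴹ-generator y) (≋-trans (generator-cong (R.*-congʳ eq)) (≋-sym (≈ᴹ-generator z))))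
    (λ x → generator x , (begin
      T.pairing (generator x)                      ≈⟨ R.+-identityʳ _ ⟩
      χ (A ∣ B) (x · e K (A ∣ B)) * χ² A B (unit 1#) ≈⟨ R.*-cong (Scalars.linear-*ₗ (ζ (A ∣ B)) x (e K
          (A ∣ B))) (χ²-unit 1#) ⟩
      (x * χ (A ∣ B) (e K (A ∣ B))) * 1#           ≈⟨ R.*-identityʳ _ ⟩
      x * χ (A ∣ B) (e K (A ∣ B))                  ≈⟨ R.*-congˡ (χ-e-self (A ∣ B)) ⟩
      x * 1#                                       ≈⟨ R.*-identityʳ x ⟩
      x                                            ∎))
    where
    W = _⊠_ K (V K A) (V K B)
    open External A B
    open RawBimodule (Ind K n m W) using (_≈ᴹ_)
    module T = Tensor (restricted K n m) W (χ (A ∣ B)) (χ² A B)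

    _·_ : ∀ {l} → k → ∣kΠ∣ K l → ∣kΠ∣ K l
    x · y = map (λ (a , C) → x * a , C) y

    generator : k → RawBimodule.Carrierᴹ (Ind K n m W)
    generator x = [ x · e K (A ∣ B) , unit 1# ]

    unit-refl : RawBimodule._≈ᴹ_ W (unit 1#) (unit 1#)
    unit-refl = ≋-refl

    ⊗unit-cong : ∀ u x → (∀ E → χ E u ≈ x * χ E (e K (A ∣ B))) → [ u , unit 1# ] ≈ᴹ generator x
    ⊗unit-cong u x χu = relation (⊗-cong
      (χ-separates u (x · e K (A ∣ B)) λ E → R.trans (χu E) (R.sym (Scalars.linear-*ₗ (ζ E) x (e K (A ∣ B)))))
      unit-refl)

    generator-cong : ∀ {x y} → x * 1# ≈ y * 1# → generator x ≈ᴹ generator y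
    generator-cong {x} {y} x≈y = ⊗unit-cong (x · e K (A ∣ B)) y λ E →
      R.trans (Scalars.linear-*ₗ (ζ E) x (e K (A ∣ B)))
        (R.*-congʳ (R.trans (R.sym (R.*-identityʳ x)) (R.trans x≈y (R.*-identityʳ y))))

    -- x ⊗ w = x ⊗ y·unit = x ∧ ρ y ⊗ unit, where y is a multiple of e A ⊗ e B.
    generate : ∀ g → [ g ] ≈ᴹ generator (χ (A ∣ B) (proj₁ g) * χ² A B (proj₂ g))
    generate (x , w) = ≋-trans
      (relation (⊗-cong {x = x} (χ-separates x x λ _ → R.refl) (χ²-injective {w} {RawBimodule._*ₗ_ W y
          (unit 1#)} (R.sym χ²y·unit))))
      (≋-trans (≋-sym (relation (⊗-balanced x y (unit 1#)))) (⊗unit-cong (_∧ₖ_ K x (ρ K y)) _ λ E → begin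
        χ E (_∧ₖ_ K x (ρ K y))                             ≈⟨ χ-∧ E x (ρ K y) ⟩
        χ E x * χ E (ρ K y)                                ≈⟨ R.*-congˡ (R.trans (χ-ρ-*ₗ E (χ² A B w) (e K A)
            (e K B)) (R.*-congˡ (χ-cong E (ρ-e A B)))) ⟩
        χ E x * (χ² A B w * χ E (e K (A ∣ B)))             ≈⟨ R.*-assoc _ _ _ ⟨
        (χ E x * χ² A B w) * χ E (e K (A ∣ B))             ≈⟨ concentrated E (E ≟ A ∣ B) ⟩
        (χ (A ∣ B) x * χ² A B w) * χ E (e K (A ∣ B))       ∎))
      where
      y = [ χ² A B w · e K A , e K B ]
      χ²y·unit : χ² A B (RawBimodule._*ₗ_ W y (unit 1#)) ≈ χ² A B w
      χ²y·unit = begin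
        χ² A B (RawBimodule._*ₗ_ W y (unit 1#))             ≈⟨ χ²-*ₗ y (unit 1#) ⟩
        χ² A B y * χ² A B (unit 1#)                         ≈⟨ R.*-congˡ (χ²-unit 1#) ⟩
        χ² A B y * 1#                                       ≈⟨ R.*-identityʳ _ ⟩
        χ² A B y                                            ≈⟨ R.+-identityʳ _ ⟩
        χ A (χ² A B w · e K A) * χ B (e K B)                ≈⟨ R.*-cong (R.trans (Scalars.linear-*ₗ (ζ A) _
            (e K A)) (R.*-congˡ (χ-e-self A))) (χ-e-self B) ⟩
        (χ² A B w * 1#) * 1#                                ≈⟨ R.trans (R.*-identityʳ _) (R.*-identityʳ _) ⟩
        χ² A B w                                            ∎
      concentrated : ∀ E → Dec (E ≡ A ∣ B) →
        (χ E x * χ² A B w) * χ E (e K (A ∣ B)) ≈ (χ (A ∣ B) x * χ² A B w) * χ E (e K (A ∣ B))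
      concentrated E (yes refl) = R.refl
      concentrated E (no E≢)    = R.trans (R.trans (R.*-congˡ χ≈0) (R.zeroʳ _)) (R.sym (R.trans
          (R.*-congˡ χ≈0) (R.zeroʳ _)))
        where
        χ≈0 : χ E (e K (A ∣ B)) ≈ 0#
        χ≈0 = R.trans (χ-e E (A ∣ B)) (R.reflexive (⟦⟧-no (E ≟ A ∣ B) E≢))

    ≈ᴹ-generator : ∀ z → z ≈ᴹ generator (T.pairing z)
    ≈ᴹ-generator = normal-form _ generator
      (≋-trans (≋-sym (relation (⊗-zeroˡ (unit 1#)))) (⊗unit-cong [] 0# λ E → R.sym (R.zeroˡ _)))
      (λ x y → ≋-trans (≋-sym (relation (⊗-addˡ (x · e K (A ∣ B)) (y · e K (A ∣ B)) (unit 1#))))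
        (⊗unit-cong (x · e K (A ∣ B) ++ y · e K (A ∣ B)) (x + y) λ E → R.trans
          (Scalars.linear-++ (ζ E) (x · e K (A ∣ B)) (y · e K (A ∣ B))) (R.trans
          (R.+-cong (Scalars.linear-*ₗ (ζ E) x (e K (A ∣ B))) (Scalars.linear-*ₗ (ζ E) y (e K (A ∣ B))))
          (R.sym (R.distribʳ _ x y)))))
      generate

  -- e A acts as the identity on V A, and as zero on V B for every other B.
  V-injective : ¬ 1# ≈ 0# → {A B : SetPartition n} → V K A ≅ V K B → A ≡ B
  V-injective 1≉0 {A} {B} (f , f-iso) = split (A ≟ B)
    where
    open LeftModuleMorphisms.IsLeftModuleIsomorphism f-iso
    split : Dec (A ≡ B) → A ≡ B
    split (yes A≡B) = A≡B
    -- The image of `𝟏` vanishes in `V B`, so by injectivity `𝟏` vanishes in `V A`, although its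
    -- coordinate there is 1.
    split (no A≢B)  = ⊥-elim (1≉0 (R.trans (R.sym (χ-𝟏 A 1#)) (V-≈⁻ A (basis K 𝟏) [] (injective f𝟏≈f0))))
      where
      χf𝟏≈0 : χ B (f (basis K 𝟏)) ≈ 0#
      χf𝟏≈0 = begin
        χ B (f (basis K 𝟏))
          ≈⟨ V-≈⁻ B (f (basis K 𝟏)) (f (_∧ₖ_ K (e K A) (basis K 𝟏))) (⟦⟧-cong {basis K 𝟏} {_∧ₖ_ K (e K A)
              (basis K 𝟏)} (V-≈⁺ A (basis K 𝟏) (_∧ₖ_ K (e K A) (basis K 𝟏)) (R.sym
               (R.trans (χ-∧ A (e K A) (basis K 𝟏)) (R.trans (R.*-congʳ (χ-e-self A)) (R.*-identityˡ _)))))) ⟩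
        χ B (f (_∧ₖ_ K (e K A) (basis K 𝟏)))
          ≈⟨ V-≈⁻ B (f (_∧ₖ_ K (e K A) (basis K 𝟏))) (_∧ₖ_ K (e K A) (f (basis K 𝟏))) (*ₗ-homo (e K A) (basis K 𝟏)) ⟩
        χ B (_∧ₖ_ K (e K A) (f (basis K 𝟏)))
          ≈⟨ χ-∧ B (e K A) (f (basis K 𝟏)) ⟩
        χ B (e K A) * χ B (f (basis K 𝟏))
          ≈⟨ R.*-congʳ (R.trans (χ-e B A) (R.reflexive (⟦⟧-no (B ≟ A) (A≢B ∘ sym)))) ⟩
        0# * χ B (f (basis K 𝟏))
          ≈⟨ R.zeroˡ _ ⟩
        0# ∎
      f𝟏≈f0 : RawBimodule._≈ᴹ_ (V K B) (f (basis K 𝟏)) (f [])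
      f𝟏≈f0 = V-≈⁺ B (f (basis K 𝟏)) (f []) (R.trans χf𝟏≈0 (R.sym (V-≈⁻ B (f []) [] 0ᴹ-homo)))

-- The vector spaces G₀ and NCSym

module Isomorphism {c ℓ₁ ℓ₂} (K : HeytingField c ℓ₁ ℓ₂) where
  open LinearAlgebra K
  open Möbius K
  open Characters K
  open Modules K

  private variable
    a j ℓ : Level
    J : Set j

  _≟∃_ : DecidableEquality (∃ SetPartition)
  _≟∃_ = ≡-dec ℕ._≟_ _≟_

  -- A word occurs in exactly one `𝐦`, that of its kernel. The decision `x?` is arbitrary, so that
  -- the case split on degrees does not have to reduce the one for dependent pairs.
  𝐦-coefficient-kernel : (w : Vec ℕ n) → ∀ x (x? : Dec (x ≡ (n , kernel w))) → 𝐦-coefficient K w x ≡ ⟦ x? ⟧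
  𝐦-coefficient-kernel {n} w (d , A) x? with d ℕ.≟ n
  ... | yes refl = ⟦⟧-⇔ occurs⇔ (occurs? K w A) x?
    where
    occurs⇔ : Occurs K w A ⇔ (d , A) ≡ (d , kernel w)
    occurs⇔ = mk⇔
      (λ occ → cong (d ,_) (sym (kernel-unique w A λ i j → mk⇔
        (mk∼ ∘ proj₁ (occ i j)) (proj₂ (occ i j) ∘ _∼[_]_.∈part))))
      λ { refl i j → _∼[_]_.∈part ∘ Equivalence.from (∼-kernel w) , Equivalence.to (∼-kernel w) ∘ mk∼ }
  ... | no d≢n = sym (⟦⟧-no x? (d≢n ∘ cong proj₁))

  coefficient-kernel : (w : Vec ℕ n) → ∀ f →
    coefficient K w f ≈ linear K (scalars K) (λ x → ⟦ x ≟∃ (n , kernel w) ⟧) f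
  coefficient-kernel w = Scalars.linear-cong λ x → R.reflexive (𝐦-coefficient-kernel w x (x ≟∃ _))

  -- A record, so that f and g can be inferred from f ≈ₙ g.
  record _≈ₙ_ (f g : List (k × ∃ SetPartition)) : Set ℓ₁ where
    constructor mk≈
    field coefficients : RawBimodule._≈ᴹ_ (NCSymModule K) f g

  open _≈ₙ_ public

  infix 4 _≈ₙ_

  N : RawModule k _ _
  N = record { RawBimodule (NCSymModule K) ; _≈ᴹ_ = _≈ₙ_ }

  ≋⇒≈ₙ : ∀ {f g} → Presented (FreeRelation K _≡_) f g → f ≈ₙ g
  ≋⇒≈ₙ f≋g = mk≈ λ w → Scalars.linear-respects (𝐦-coefficient K w) (λ { refl → R.refl }) f≋g

  -- Linear independence of the series `𝐦 A`: for a word with kernel `A`, its coefficient in a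
  -- series is the coefficient at `A`.
  ≈ₙ⇒coefficients : ∀ f g → f ≈ₙ g → ∀ x →
    linear K (scalars K) (λ y → ⟦ y ≟∃ x ⟧) f ≈ linear K (scalars K) (λ y → ⟦ y ≟∃ x ⟧) g
  ≈ₙ⇒coefficients f g f≈g (n , A) with kernel-surjective A
  ... | w , refl = R.trans (R.sym (coefficient-kernel w f)) (R.trans (coefficients f≈g w) (coefficient-kernel w g))

  N-isVectorSpace : IsVectorSpace N
  N-isVectorSpace = record
    { +ᴹ-isCommutativeMonoid = record
      { isMonoid = record
        { isSemigroup = record
          { isMagma = record
            { isEquivalence = record
              { refl  = mk≈ λ _ → R.refl
              ; sym   = λ p → mk≈ λ w → R.sym (coefficients p w)
              ; trans = λ p q → mk≈ λ w → R.trans (coefficients p w) (coefficients q w) }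
            ; ∙-cong = λ {f} {f′} {g} {g′} p q → mk≈ λ w → R.trans (Scalars.linear-++ _ f g)
                (R.trans (R.+-cong (coefficients p w) (coefficients q w)) (R.sym (Scalars.linear-++ _ f′ g′))) }
          ; assoc = λ f g h → ≋⇒≈ₙ (Fr.+ᴹ-assoc f g h) }
        ; identity = (λ f → ≋⇒≈ₙ (Fr.+ᴹ-identityˡ f)) , λ f → ≋⇒≈ₙ (Fr.+ᴹ-identityʳ f) }
      ; comm = λ f g → ≋⇒≈ₙ (Fr.+ᴹ-comm f g) }
    ; isPreleftSemimodule = record
      { *ₗ-cong = λ {x} {y} {f} {g} x≈y p → mk≈ λ w → R.trans (Scalars.linear-*ₗ _ x f)
          (R.trans (R.*-cong x≈y (coefficients p w)) (R.sym (Scalars.linear-*ₗ _ y g)))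
      ; *ₗ-zeroˡ = λ f → ≋⇒≈ₙ (Fr.*ₗ-zeroˡ f)
      ; *ₗ-distribʳ = λ f x y → ≋⇒≈ₙ (Fr.*ₗ-distribʳ f x y)
      ; *ₗ-identityˡ = λ f → ≋⇒≈ₙ (Fr.*ₗ-identityˡ f)
      ; *ₗ-assoc = λ x y f → ≋⇒≈ₙ (Fr.*ₗ-assoc x y f)
      ; *ₗ-zeroʳ = λ x → ≋⇒≈ₙ (Fr.*ₗ-zeroʳ x)
      ; *ₗ-distribˡ = λ x f g → ≋⇒≈ₙ (Fr.*ₗ-distribˡ x f g) } }
    where module Fr = IsLeftSemimodule (free-isVectorSpace {_≃′_ = _≡_ {A = ∃ SetPartition}} refl)

  ≃-refl : ∀ {x} → _≃_ K x x
  ≃-refl {n , A} = iso (≅V⁺ (V K A) A (χ A) (λ {u} {v} → V-≈⁻ A u v) (Scalars.linear-++ (ζ A)) R.refl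
    (linear-neg (ζ A)) (χ-∧ A) (λ {u} {v} → V-≈⁺ A u v) λ x → [ x , 𝟏 ] , χ-𝟏 A x)

  G : RawModule k _ _
  G = Free K (_≃_ K)

  G-isVectorSpace : IsVectorSpace G
  G-isVectorSpace = free-isVectorSpace ≃-refl

  -- Tensor squares and Möbius inversion with vector coefficients

  module _ (M : RawModule k a ℓ) (isVectorSpace : IsVectorSpace M) where
    open RawBimodule M
    open Sums M isVectorSpace
    open SetoidReasoning ≈ᴹ-setoid

    -- Scalars act on the left factor, so respecting the balancing relation requires them to commute
    -- with the right action; the hypothesis reduces this to commutativity of the field.
    ⊗-isVectorSpace : (∀ x u → (u *ᵣ x) ≈ᴹ (x *ₗ u)) → IsVectorSpace (M ⊗ M)
    ⊗-isVectorSpace *ᵣ≈*ₗ = record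
      { +ᴹ-isCommutativeMonoid = presented-isCommutativeMonoid
      ; isPreleftSemimodule = record
        { *ₗ-cong = λ {_} {_} {y} x≈x′ y≋z → ≋-trans
            (map≋map _ _ (λ _ → relation (⊗-cong (*ₗ-cong x≈x′ ≈ᴹ-refl) ≈ᴹ-refl)) y)
            (map-respects _ scale y≋z)
        ; *ₗ-zeroˡ = map≋[] _ λ (u , v) → ≋-trans (relation (⊗-cong (*ₗ-zeroˡ u) ≈ᴹ-refl)) (relation (⊗-zeroˡ v))
        ; *ₗ-distribʳ = λ z x y → map≋++ _ _ _ (λ (u , v) → ≋-trans
            (relation (⊗-cong (*ₗ-distribʳ u x y) ≈ᴹ-refl)) (relation (⊗-addˡ _ _ v))) z
        ; *ₗ-identityˡ = λ z → ≋-trans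
            (map≋map _ id (λ (u , v) → relation (⊗-cong (*ₗ-identityˡ u) ≈ᴹ-refl)) z) (≡⇒≋ (List.map-id z))
        ; *ₗ-assoc = λ x y z → ≋-trans
            (map≋map _ _ (λ (u , v) → relation (⊗-cong (*ₗ-assoc x y u) ≈ᴹ-refl)) z) (≡⇒≋ (List.map-∘ z))
        ; *ₗ-zeroʳ = λ _ → ≋-refl
        ; *ₗ-distribˡ = λ x y z → ≡⇒≋ (List.map-++ _ y z) } }
      where
      ≡⇒≋ : ∀ {y z} → y ≡ z → Presented (TensorRelation M M) y z
      ≡⇒≋ refl = ≋-refl
      scale : ∀ {x y z} → TensorRelation M M y z →
        Presented (TensorRelation M M) (map (λ (u , v) → x *ₗ u , v) y) (map (λ (u , v) → x *ₗ u , v) z)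
      scale (⊗-cong p q) = relation (⊗-cong (*ₗ-cong R.refl p) q)
      scale {x} (⊗-addˡ u u′ v) =
        ≋-trans (relation (⊗-cong (*ₗ-distribˡ x u u′) ≈ᴹ-refl)) (relation (⊗-addˡ _ _ v))
      scale (⊗-addʳ u v v′) = relation (⊗-addʳ _ v v′)
      scale {x} (⊗-zeroˡ v) = ≋-trans (relation (⊗-cong (*ₗ-zeroʳ x) ≈ᴹ-refl)) (relation (⊗-zeroˡ v))
      scale (⊗-zeroʳ u) = relation (⊗-zeroʳ _)
      scale {x} (⊗-balanced u y v) = ≋-trans
        (relation (⊗-cong (≈ᴹ-trans (*ₗ-cong R.refl (*ᵣ≈*ₗ y u))
          (≈ᴹ-trans (*ₗ-*ₗ-comm x y u) (≈ᴹ-sym (*ᵣ≈*ₗ y (x *ₗ u))))) ≈ᴹ-refl))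
        (relation (⊗-balanced (x *ₗ u) y v))

    -- Collects the coefficient of each `v j`; common to Möbius inversion and to the product and
    -- coproduct computations.
    ∑-exchange : (φ : SetPartition n → k) (js : List J) (X : J → SetPartition n → k) (v : J → Carrierᴹ) →
      ∑ K M (partitions n) (λ B → φ B *ₗ ∑ K M js (λ j → X j B *ₗ v j)) ≈ᴹ
      ∑ K M js (λ j → Σ[ (λ B → X j B * φ B) ] *ₗ v j)
    ∑-exchange {n} φ js X v = begin
      ∑ K M (partitions n) (λ B → φ B *ₗ ∑ K M js (λ j → X j B *ₗ v j))
        ≈⟨ ∑-cong (λ B → ≈ᴹ-trans (*ₗ-∑ (φ B) js _) (∑-cong (λ j → ≈ᴹ-trans
             (≈ᴹ-sym (*ₗ-assoc (φ B) (X j B) (v j))) (*ₗ-cong (R.*-comm (φ B) (X j B)) ≈ᴹ-refl)) js)) (partitions n) ⟩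
      ∑ K M (partitions n) (λ B → ∑ K M js (λ j → (X j B * φ B) *ₗ v j))
        ≈⟨ ∑-swap (partitions n) js _ ⟩
      ∑ K M js (λ j → ∑ K M (partitions n) (λ B → (X j B * φ B) *ₗ v j))
        ≈⟨ ∑-cong (λ j → ∑-*ₗ (partitions n) _ (v j)) js ⟨
      ∑ K M js (λ j → Σ[ (λ B → X j B * φ B) ] *ₗ v j) ∎

    -- Groups the indices by their value under `g`. Products and coproducts of the `𝐦` are sums over
    -- such fibres, namely of the restrictions and of the meet.
    ∑-fibre : (φ : SetPartition n → k) (js : List J) (g : J → SetPartition n) (v : J → Carrierᴹ) →
      ∑ K M (partitions n) (λ B → φ B *ₗ ∑ K M js (λ j → δ (g j) B *ₗ v j)) ≈ᴹ
      ∑ K M js (λ j → φ (g j) *ₗ v j)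
    ∑-fibre φ js g v = ≈ᴹ-trans (∑-exchange φ js (λ j → δ (g j)) v)
      (∑-cong (λ j → *ₗ-cong (Σ-δˡ (g j) φ) ≈ᴹ-refl) js)

    -- With the two triangles of μ and ζ this inverts both sums over lower and
    -- sums over upper intervals.
    ∑-inverse : (φ ψ : SetPartition n → SetPartition n → k) → (∀ A B → (φ ⊙ ψ) A B ≈ δ A B) →
      (v : SetPartition n → Carrierᴹ) (B : SetPartition n) →
      ∑ K M (partitions n) (λ C → ψ C B *ₗ ∑ K M (partitions n) (λ A → φ A C *ₗ v A)) ≈ᴹ v B
    ∑-inverse {n} φ ψ φψ≈δ v B = ≈ᴹ-trans (∑-exchange (λ C → ψ C B) (partitions n) φ v) (≈ᴹ-trans
      (∑-cong (λ A → *ₗ-cong (R.trans (φψ≈δ A B) (R.reflexive (δ-sym A B))) ≈ᴹ-refl) (partitions n))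
      (∑-partitions-δ B v))

    ∑-inverse′ : (φ ψ : SetPartition n → SetPartition n → k) → (∀ A B → (φ ⊙ ψ) A B ≈ δ A B) →
      (v : SetPartition n → Carrierᴹ) (A : SetPartition n) →
      ∑ K M (partitions n) (λ C → φ A C *ₗ ∑ K M (partitions n) (λ B → ψ C B *ₗ v B)) ≈ᴹ v A
    ∑-inverse′ φ ψ φψ≈δ = ∑-inverse (λ A C → ψ C A) (λ C B → φ B C) λ A B →
      R.trans (Σ-cong λ C → R.*-comm (ψ C A) (φ B C)) (R.trans (φψ≈δ B A) (R.reflexive (δ-sym B A)))

    ∑-lower : (A : SetPartition n) (v : SetPartition n → Carrierᴹ) →
      ∑ K M (filter (_≤? A) (partitions n)) (λ B → μ K B A *ₗ v B) ≈ᴹ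
      ∑ K M (partitions n) (λ B → μ K B A *ₗ v B)
    ∑-lower {n} A v = ≈ᴹ-trans (∑-filter (_≤? A) (partitions n) _) (∑-cong (λ B → ≈ᴹ-trans
      (≈ᴹ-sym (*ₗ-assoc (ζ B A) (μ K B A) (v B))) (*ₗ-cong (ζ*μ≈μ B A) ≈ᴹ-refl)) (partitions n))

    ∑-tensor : ∀ {i} {I : Set i} (is : List I) (js : List J) (φ : I → Carrierᴹ) (ψ : J → Carrierᴹ) →
      Presented (TensorRelation M M) [ ∑ K M is φ , ∑ K M js ψ ]
        (∑ K (M ⊗ M) is (λ i → ∑ K (M ⊗ M) js (λ j → [ φ i , ψ j ])))
    ∑-tensor []       js φ ψ = relation (⊗-zeroˡ _)
    ∑-tensor (i ∷ is) js φ ψ = ≋-trans (relation (⊗-addˡ _ _ _)) (++-cong (right-sum js) (∑-tensor is js φ ψ))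
      where
      right-sum : ∀ js → Presented (TensorRelation M M) [ φ i , ∑ K M js ψ ] (∑ K (M ⊗ M) js (λ j → [ φ i , ψ j ]))
      right-sum []       = relation (⊗-zeroʳ _)
      right-sum (j ∷ js) = ≋-trans (relation (⊗-addʳ _ _ _)) (++-cong {x = [ _ ]} {x′ = [ _ ]} ≋-refl (right-sum js))

-- The isomorphism of bialgebras

module Bialgebra {c ℓ₁ ℓ₂} (K : HeytingField c ℓ₁ ℓ₂) where
  open LinearAlgebra K
  open Möbius K
  open Characters K
  open Modules K
  open Isomorphism K

  N-*ᵣ≈*ₗ : ∀ x f → RawBimodule._≈ᴹ_ N (RawBimodule._*ᵣ_ N f x) (RawBimodule._*ₗ_ N x f)
  N-*ᵣ≈*ₗ x f = ≋⇒≈ₙ (*ᵣ≋*ₗ refl x f)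

  N⊗N-isVectorSpace : IsVectorSpace (N ⊗ N)
  N⊗N-isVectorSpace = ⊗-isVectorSpace N N-isVectorSpace N-*ᵣ≈*ₗ

  module NS = Sums N N-isVectorSpace
  module GS = Sums G G-isVectorSpace
  module TS = Sums (N ⊗ N) N⊗N-isVectorSpace

  module NR = SetoidReasoning NS.≈ᴹ-setoid
  module GR = SetoidReasoning GS.≈ᴹ-setoid
  module TR = SetoidReasoning TS.≈ᴹ-setoid

  open RawBimodule N using () renaming (_*ₗ_ to _·ₙ_)
  open RawBimodule G using () renaming (_≈ᴹ_ to _≈₀_; _*ₗ_ to _·₀_)
  open RawBimodule (N ⊗ N) using () renaming (_≈ᴹ_ to _≈ₜ_; _*ₗ_ to _·ₜ_)
  open RawBialgebra (NCSym K) using () renaming (_·_ to _⋆_; Δ to Δₙ; ε to εₙ)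

  ∑ₙ : (SetPartition n → RawBimodule.Carrierᴹ N) → RawBimodule.Carrierᴹ N
  ∑ₙ {n} = ∑ K N (partitions n)

  𝐱-μ : (A : SetPartition n) → 𝐱 K A ≈ₙ ∑ₙ (λ B → μ K B A ·ₙ 𝐩 K B)
  𝐱-μ A = ∑-lower N N-isVectorSpace A (𝐩 K)

  𝐩-ζ : (B : SetPartition n) → 𝐩 K B ≈ₙ ∑ₙ (λ C → ζ B C ·ₙ 𝐦 K C)
  𝐩-ζ B = NS.∑-filter (B ≤?_) (partitions _) (𝐦 K)

  𝐩-𝐱 : (B : SetPartition n) → 𝐩 K B ≈ₙ ∑ₙ (λ E → ζ E B ·ₙ 𝐱 K E)
  𝐩-𝐱 {n} B = NS.≈ᴹ-sym (NS.≈ᴹ-trans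
    (NS.∑-cong (λ E → NS.*ₗ-cong R.refl (𝐱-μ E)) (partitions n))
    (∑-inverse N N-isVectorSpace (μ K) ζ μζ≈δ (𝐩 K) B))

  𝐦-𝐩 : (A : SetPartition n) → ∑ₙ (λ B → μ K A B ·ₙ 𝐩 K B) ≈ₙ 𝐦 K A
  𝐦-𝐩 {n} A = NS.≈ᴹ-trans
    (NS.∑-cong (λ B → NS.*ₗ-cong R.refl (𝐩-ζ B)) (partitions n))
    (∑-inverse′ N N-isVectorSpace (μ K) ζ μζ≈δ (𝐦 K) A)

  -- F and its inverse

  private
    𝐱∃ : ∃ SetPartition → RawBimodule.Carrierᴹ N
    𝐱∃ (_ , A) = 𝐱 K A

  F-basis : (A : SetPartition n) → F K (basis K (n , A)) ≈ₙ 𝐱 K A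
  F-basis {n} A = NS.linear-basis 𝐱∃ (n , A)

  -- The preimage of `𝐩 B` under `F`.
  lower : (B : SetPartition n) → RawBimodule.Carrierᴹ G
  lower {n} B = ∑ K G (filter (_≤? B) (partitions n)) (λ E → basis K (n , E))

  -- The expansion of `𝐦 A` in the `𝐩 B`, with each `𝐩 B` replaced by its preimage.
  inverse : ∃ SetPartition → RawBimodule.Carrierᴹ G
  inverse (n , A) = ∑ K G (partitions n) (λ B → μ K A B ·₀ lower B)

  F-∑ : ∀ {i} {I : Set i} (is : List I) (φ : I → k) (v : I → RawBimodule.Carrierᴹ G) →
    F K (∑ K G is (λ i → φ i ·₀ v i)) ≈ₙ ∑ K N is (λ i → φ i ·ₙ F K (v i))
  F-∑ is φ v = NS.≈ᴹ-trans (NS.linear-∑ {_≃′_ = _≃_ K} 𝐱∃ is _) (NS.∑-cong (λ i → NS.linear-*ₗ 𝐱∃ (φ i) (v i)) is)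

  F-lower : (B : SetPartition n) → F K (lower B) ≈ₙ 𝐩 K B
  F-lower {n} B = begin
    F K (lower B)
      ≈⟨ NS.linear-∑ {_≃′_ = _≃_ K} 𝐱∃ (filter (_≤? B) (partitions n)) _ ⟩
    ∑ K N (filter (_≤? B) (partitions n)) (λ E → F K (basis K (n , E)))
      ≈⟨ NS.∑-filter (_≤? B) (partitions n) _ ⟩
    ∑ₙ (λ E → ζ E B ·ₙ F K (basis K (n , E)))
      ≈⟨ NS.∑-cong (λ E → NS.*ₗ-cong R.refl (F-basis E)) (partitions n) ⟩
    ∑ₙ (λ E → ζ E B ·ₙ 𝐱 K E)
      ≈⟨ 𝐩-𝐱 B ⟨
    𝐩 K B ∎
    where open NR

  F-inverse : ∀ f → F K (linear K G inverse f) ≈ₙ f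
  F-inverse f = begin
    F K (linear K G inverse f)
      ≈⟨ NS.linear-linear {_≃′_ = _≃_ K} _ inverse f ⟩
    linear K N (λ x → F K (inverse x)) f
      ≈⟨ NS.linear-cong (λ (n , A) → F-inverse-basis A) f ⟩
    linear K N (basis K) f
      ≈⟨ ≋⇒≈ₙ (linear-basis-identity refl f) ⟩
    f ∎
    where
    open NR
    F-inverse-basis : (A : SetPartition n) → F K (inverse (n , A)) ≈ₙ 𝐦 K A
    F-inverse-basis {n} A = NS.≈ᴹ-trans (F-∑ (partitions n) (μ K A) lower)
      (NS.≈ᴹ-trans (NS.∑-cong (λ B → NS.*ₗ-cong R.refl (F-lower B)) (partitions n)) (𝐦-𝐩 A))

  -- Both inversions here use `ζ ⊙ μ = δ`, while `F-inverse` rests on `μ ⊙ ζ = δ`.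
  inverse-𝐱 : (A : SetPartition n) → linear K G inverse (𝐱 K A) ≈₀ basis K (n , A)
  inverse-𝐱 {n} A = begin
    H (𝐱 K A)
      ≈⟨ GS.linear-∑ {_≃′_ = _≡_} inverse (filter (_≤? A) (partitions n)) _ ⟩
    ∑ K G (filter (_≤? A) (partitions n)) (λ B → H (μ K B A ·ₙ 𝐩 K B))
      ≈⟨ GS.∑-cong (λ B → ≋-trans (GS.linear-*ₗ inverse (μ K B A) (𝐩 K B)) (GS.*ₗ-cong R.refl (H-𝐩 B)))
           (filter (_≤? A) (partitions n)) ⟩
    ∑ K G (filter (_≤? A) (partitions n)) (λ B → μ K B A ·₀ lower B)
      ≈⟨ ∑-lower G G-isVectorSpace A lower ⟩
    ∑ K G (partitions n) (λ B → μ K B A ·₀ lower B)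
      ≈⟨ GS.∑-cong (λ B → GS.*ₗ-cong R.refl (GS.∑-filter (_≤? B) (partitions n) _)) (partitions n) ⟩
    ∑ K G (partitions n) (λ B → μ K B A ·₀ ∑ K G (partitions n) (λ E → ζ E B ·₀ basis K (n , E)))
      ≈⟨ ∑-inverse G G-isVectorSpace ζ (μ K) ζμ≈δ (λ E → basis K (n , E)) A ⟩
    basis K (n , A) ∎
    where
    open GR
    H : RawBimodule.Carrierᴹ N → RawBimodule.Carrierᴹ G
    H = linear K G inverse
    H-𝐩 : (B : SetPartition n) → H (𝐩 K B) ≈₀ lower B
    H-𝐩 B = begin
      H (𝐩 K B)
        ≈⟨ GS.linear-∑ {_≃′_ = _≡_} inverse (filter (B ≤?_) (partitions n)) (𝐦 K) ⟩
      ∑ K G (filter (B ≤?_) (partitions n)) (λ C → H (𝐦 K C))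
        ≈⟨ GS.∑-filter (B ≤?_) (partitions n) _ ⟩
      ∑ K G (partitions n) (λ C → ζ B C ·₀ H (𝐦 K C))
        ≈⟨ GS.∑-cong (λ C → GS.*ₗ-cong R.refl (GS.linear-basis inverse (n , C))) (partitions n) ⟩
      ∑ K G (partitions n) (λ C → ζ B C ·₀ inverse (n , C))
        ≈⟨ ∑-inverse′ G G-isVectorSpace ζ (μ K) ζμ≈δ lower B ⟩
      lower B ∎

  inverse-F : ∀ x → linear K G inverse (F K x) ≈₀ x
  inverse-F x = begin
    linear K G inverse (F K x)
      ≈⟨ GS.linear-linear {_≃′_ = _≡_} inverse 𝐱∃ x ⟩
    linear K G (λ (n , A) → linear K G inverse (𝐱 K A)) x
      ≈⟨ GS.linear-cong (λ (_ , A) → inverse-𝐱 A) x ⟩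
    linear K G (basis K) x
      ≈⟨ linear-basis-identity ≃-refl x ⟩
    x ∎
    where open GR

  -- `inverse` is extended to formal sums, whereas the hypothesis equates series; equal series have
  -- equal coefficients at the `𝐦 A`, which is enough for the extension to agree.
  F-injective : ∀ x y → F K x ≈ₙ F K y → x ≈₀ y
  F-injective x y Fx≈Fy = begin
    x                             ≈⟨ inverse-F x ⟨
    linear K G inverse (F K x)    ≈⟨ GS.linear-coefficients _≟∃_ inverse (F K x) (F K y) (≈ₙ⇒coefficients
        (F K x) (F K y) Fx≈Fy) ⟩
    linear K G inverse (F K y)    ≈⟨ inverse-F y ⟩
    y                             ∎
    where open GR

  -- Basis elements are identified along isomorphisms of modules, so `𝐱` must be constant on
  -- isomorphism classes.
  F-cong : ¬ 1# ≈ 0# → ∀ {x y} → x ≈₀ y → F K x ≈ₙ F K y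
  F-cong 1≉0 = NS.linear-respects 𝐱∃ λ where
    (iso V≅V) → NS.≈ᴹ-reflexive (cong (𝐱 K) (V-injective 1≉0 V≅V))

  -- The laws gathered for `N` are those of a semimodule and do not mention negation, so the
  -- coefficients of each word are compared.
  F-neg : ∀ x → F K (RawBimodule.-ᴹ_ G x) ≈ₙ RawBimodule.-ᴹ_ N (F K x)
  F-neg x = mk≈ λ w → let φ = λ (_ , A) → coefficient K w (𝐱 K A) in begin
    coefficient K w (F K (RawBimodule.-ᴹ_ G x))       ≈⟨ coefficient-F w (RawBimodule.-ᴹ_ G x) ⟩
    linear K (scalars K) φ (RawBimodule.-ᴹ_ G x)      ≈⟨ linear-neg φ x ⟩
    - linear K (scalars K) φ x                        ≈⟨ R.-‿cong (coefficient-F w x) ⟨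
    - coefficient K w (F K x)                         ≈⟨ linear-neg _ (F K x) ⟨
    coefficient K w (RawBimodule.-ᴹ_ N (F K x))       ∎
    where
    open SetoidReasoning R.setoid
    coefficient-F : (w : Vec ℕ n) → ∀ y →
      coefficient K w (F K y) ≈ linear K (scalars K) (λ (_ , A) → coefficient K w (𝐱 K A)) y
    coefficient-F w = Scalars.linear-linear {_≃′_ = _≡_} (𝐦-coefficient K w) 𝐱∃

  F-*ᵣ : ∀ a x → F K (RawBimodule._*ᵣ_ G x a) ≈ₙ RawBimodule._*ᵣ_ N (F K x) a
  F-*ᵣ a x = NS.≈ᴹ-trans
    (NS.linear-respects {_≃′_ = _≡_} 𝐱∃ (λ { refl → NS.≈ᴹ-refl }) (*ᵣ≋*ₗ refl a x))
    (NS.≈ᴹ-trans (NS.linear-*ₗ _ a x) (NS.≈ᴹ-sym (N-*ᵣ≈*ₗ a (F K x))))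

  F-isModuleIsomorphism : ¬ 1# ≈ 0# → ModuleMorphisms.IsModuleIsomorphism G (NCSymModule K) (F K)
  F-isModuleIsomorphism 1≉0 = record
    { isModuleMonomorphism = record
      { isModuleHomomorphism = record
        { isBimoduleHomomorphism = record
          { +ᴹ-isGroupHomomorphism = record
            { isMonoidHomomorphism = record
              { isMagmaHomomorphism = record
                { isRelHomomorphism = record { cong = λ x≈y → coefficients (F-cong 1≉0 x≈y) }
                ; homo = λ x y → coefficients (NS.linear-++ 𝐱∃ x y) }
              ; ε-homo = λ _ → R.refl }
            ; ⁻¹-homo = λ x → coefficients (F-neg x) }
          ; *ₗ-homo = λ a x → coefficients (NS.linear-*ₗ 𝐱∃ a x)
          ; *ᵣ-homo = λ a x → coefficients (F-*ᵣ a x) } }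
      ; injective = λ {x} {y} Fx≈Fy → F-injective x y (mk≈ Fx≈Fy) }
    ; surjective = λ y → linear K G inverse y ,
        λ z≈ → coefficients (NS.≈ᴹ-trans (F-cong 1≉0 z≈) (F-inverse y)) }

  -- Multiplicativity

  private
    product : ∃ SetPartition → ∃ SetPartition → RawBimodule.Carrierᴹ N
    product (d , A) (m , B) =
      ∑ K N (filter (λ C → (C ∧ (𝟏 {d} ∣ 𝟏 {m})) ≟ (A ∣ B)) (partitions (d ℕ.+ m))) (λ C → basis K (d ℕ.+ m , C))

  -- The brackets are nested in the order in which `𝐩-∣` removes them: the right restriction first,
  -- then the left.
  product-δ : (A : SetPartition n) (B : SetPartition m) →
    product (n , A) (m , B) ≈ₙ
    ∑ₙ (λ E → δ (resʳ n m E) B ·ₙ (δ (resˡ n m E) A ·ₙ 𝐦 K E))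
  product-δ {n} {m} A B = NS.≈ᴹ-trans (NS.∑-filter (λ C → (C ∧ (𝟏 {n} ∣ 𝟏 {m})) ≟ (A ∣ B)) (partitions
      (n ℕ.+ m)) (𝐦 K))
    (NS.∑-cong (λ E → NS.≈ᴹ-trans (NS.*ₗ-cong (factor E) NS.≈ᴹ-refl) (NS.*ₗ-assoc _ _ (𝐦 K E))) (partitions
        (n ℕ.+ m)))
    where
    factor : ∀ E → δ (E ∧ (𝟏 {n} ∣ 𝟏 {m})) (A ∣ B) ≈ δ (resʳ n m E) B * δ (resˡ n m E) A
    factor E = R.trans (R.reflexive (⟦⟧-⇔ (∧𝟏∣𝟏≡∣⇔ E A B) ((E ∧ (𝟏 {n} ∣ 𝟏 {m})) ≟ (A ∣ B))
        ((resˡ n m E ≟ A) ×-dec (resʳ n m E ≟ B))))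
      (R.trans (⟦⟧-× (resˡ n m E ≟ A) (resʳ n m E ≟ B)) (R.*-comm _ _))

  -- Each `E` arises from exactly one pair, its two restrictions. The weights left over combine to
  -- `ζ (A ∣ B) E` by the adjunction.
  𝐩-∣ : (A : SetPartition n) (B : SetPartition m) → (𝐩 K A ⋆ 𝐩 K B) ≈ₙ 𝐩 K (A ∣ B)
  𝐩-∣ {n} {m} A B = begin
    𝐩 K A ⋆ 𝐩 K B
      ≈⟨ NS.linear-∑ {_≃′_ = _≡_} _ (filter (A ≤?_) (partitions n)) (𝐦 K) ⟩
    ∑ K N (filter (A ≤?_) (partitions n)) (λ C → 𝐦 K C ⋆ 𝐩 K B)
      ≈⟨ NS.∑-filter (A ≤?_) (partitions n) _ ⟩
    ∑ₙ (λ C → ζ A C ·ₙ (𝐦 K C ⋆ 𝐩 K B))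
      ≈⟨ NS.∑-cong (λ C → NS.*ₗ-cong R.refl (inner C)) (partitions n) ⟩
    ∑ₙ (λ C → ζ A C ·ₙ ∑ₙ (λ E → δ (resˡ n m E) C ·ₙ (ζ B (resʳ n m E) ·ₙ 𝐦 K E)))
      ≈⟨ ∑-fibre N N-isVectorSpace (ζ A) (partitions (n ℕ.+ m)) (resˡ n m) _ ⟩
    ∑ₙ (λ E → ζ A (resˡ n m E) ·ₙ (ζ B (resʳ n m E) ·ₙ 𝐦 K E))
      ≈⟨ NS.∑-cong (λ E → NS.≈ᴹ-trans (NS.≈ᴹ-sym (NS.*ₗ-assoc _ _ (𝐦 K E))) (NS.*ₗ-cong (R.sym
          (factor E)) NS.≈ᴹ-refl)) (partitions (n ℕ.+ m)) ⟩
    ∑ₙ (λ E → ζ (A ∣ B) E ·ₙ 𝐦 K E)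
      ≈⟨ 𝐩-ζ (A ∣ B) ⟨
    𝐩 K (A ∣ B) ∎
    where
    open NR
    factor : ∀ E → ζ (A ∣ B) E ≈ ζ A (resˡ n m E) * ζ B (resʳ n m E)
    factor E = R.trans (R.reflexive (⟦⟧-⇔ (∣≤⇔ A B E) (A ∣ B ≤? E) ((A ≤? resˡ n m E) ×-dec (B ≤? resʳ n m E))))
      (⟦⟧-× (A ≤? resˡ n m E) (B ≤? resʳ n m E))
    inner : ∀ C → (𝐦 K C ⋆ 𝐩 K B) ≈ₙ ∑ₙ (λ E → δ (resˡ n m E) C ·ₙ (ζ B (resʳ n m E) ·ₙ 𝐦 K E))
    inner C = begin
      𝐦 K C ⋆ 𝐩 K B
        ≈⟨ NS.linear-basis (λ x → linear K N (product x) (𝐩 K B)) (n , C) ⟩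
      linear K N (product (n , C)) (𝐩 K B)
        ≈⟨ NS.linear-∑ {_≃′_ = _≡_} _ (filter (B ≤?_) (partitions m)) (𝐦 K) ⟩
      ∑ K N (filter (B ≤?_) (partitions m)) (λ D → linear K N (product (n , C)) (𝐦 K D))
        ≈⟨ NS.∑-filter (B ≤?_) (partitions m) _ ⟩
      ∑ₙ (λ D → ζ B D ·ₙ linear K N (product (n , C)) (𝐦 K D))
        ≈⟨ NS.∑-cong (λ D → NS.*ₗ-cong R.refl (NS.≈ᴹ-trans (NS.linear-basis (product (n , C)) (m , D))
            (product-δ C D))) (partitions m) ⟩
      ∑ₙ (λ D → ζ B D ·ₙ ∑ₙ (λ E → δ (resʳ n m E) D ·ₙ (δ (resˡ n m E) C ·ₙ 𝐦 K E)))
        ≈⟨ ∑-fibre N N-isVectorSpace (ζ B) (partitions (n ℕ.+ m)) (resʳ n m) _ ⟩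
      ∑ₙ (λ E → ζ B (resʳ n m E) ·ₙ (δ (resˡ n m E) C ·ₙ 𝐦 K E))
        ≈⟨ NS.∑-cong (λ E → NS.*ₗ-*ₗ-comm _ _ (𝐦 K E)) (partitions (n ℕ.+ m)) ⟩
      ∑ₙ (λ E → δ (resˡ n m E) C ·ₙ (ζ B (resʳ n m E) ·ₙ 𝐦 K E)) ∎

  power : ∣kΠ∣ K n → RawBimodule.Carrierᴹ N
  power = linear K N (𝐩 K)

  power-e : (A : SetPartition n) → power (e K A) ≈ₙ 𝐱 K A
  power-e {n} A = NS.≈ᴹ-trans (NS.linear-∑ {_≃′_ = _≡_} (𝐩 K) (filter (_≤? A) (partitions n)) _)
    (NS.∑-cong (λ B → NS.+ᴹ-identityʳ (μ K B A ·ₙ 𝐩 K B)) (filter (_≤? A) (partitions n)))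

  -- 𝐱 A ⋆ 𝐱 B is the image of ρ (e A ⊗ e B) = e (A ∣ B) under B ↦ 𝐩 B.
  𝐱-∣ : (A : SetPartition n) (B : SetPartition m) → (𝐱 K A ⋆ 𝐱 K B) ≈ₙ 𝐱 K (A ∣ B)
  𝐱-∣ {n} {m} A B = begin
    𝐱 K A ⋆ 𝐱 K B
      ≈⟨ ⋆-cong (power-e A) (power-e B) ⟨
    power (e K A) ⋆ power (e K B)
      ≈⟨ NS.bilinear-linear {_≃′_ = _≡_} product (𝐩 K) (𝐩 K) (e K A) (e K B) ⟩
    bilinear K N (λ C D → 𝐩 K C ⋆ 𝐩 K D) (e K A) (e K B)
      ≈⟨ NS.bilinear-cong (λ C D → NS.≈ᴹ-trans (𝐩-∣ C D) (NS.≈ᴹ-sym (NS.linear-basis (𝐩 K) (C ∣ D)))) (e K A)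
          (e K B) ⟩
    bilinear K N (λ C D → power (basis K (C ∣ D))) (e K A) (e K B)
      ≈⟨ NS.linear-bilinearᴹ {_≃′_ = _≡_} (𝐩 K) (λ C D → basis K (C ∣ D)) (e K A) (e K B) ⟨
    power (bilinear K (kΠ K (n ℕ.+ m)) (λ C D → basis K (C ∣ D)) (e K A) (e K B))
      -- `ρ` of a single tensor is this bilinear term followed by the empty sum.
      ≈⟨ NS.linear-respects {_≃′_ = _≡_} (𝐩 K) (λ { refl → NS.≈ᴹ-refl }) (≋-trans
           (≡⇒≋ (sym (List.++-identityʳ _))) (ρ-e A B)) ⟩
    power (e K (A ∣ B))
      ≈⟨ power-e (A ∣ B) ⟩
    𝐱 K (A ∣ B) ∎
    where
    open NR
    ≡⇒≋ : ∀ {l} {x y : ∣kΠ∣ K l} → x ≡ y → x ≋ y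
    ≡⇒≋ refl = ≋-refl
    ⋆-cong : ∀ {f f′ g g′} → f ≈ₙ f′ → g ≈ₙ g′ → (f ⋆ g) ≈ₙ (f′ ⋆ g′)
    ⋆-cong {f} {f′} {g} {g′} f≈f′ g≈g′ = NS.≈ᴹ-trans
      (NS.linear-coefficients _≟∃_ _ f f′ (≈ₙ⇒coefficients f f′ f≈f′))
      (NS.linear-cong (λ x → NS.linear-coefficients _≟∃_ (product x) g g′ (≈ₙ⇒coefficients g g′ g≈g′)) f′)

  F-homo : ∀ x y → F K (RawBialgebra._·_ (G₀ K) x y) ≈ₙ (F K x ⋆ F K y)
  F-homo x y = begin
    F K (RawBialgebra._·_ (G₀ K) x y)
      ≈⟨ NS.linear-bilinearᴹ {_≃′_ = _≃_ K} 𝐱∃ (λ (n , A) (m , B) → basis K (n ℕ.+ m , A ∣ B)) x y ⟩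
    bilinear K N (λ (n , A) (m , B) → F K (basis K (n ℕ.+ m , A ∣ B))) x y
      ≈⟨ NS.bilinear-cong (λ (_ , A) (_ , B) → NS.≈ᴹ-trans (F-basis (A ∣ B)) (NS.≈ᴹ-sym (𝐱-∣ A B))) x y ⟩
    bilinear K N (λ (_ , A) (_ , B) → 𝐱 K A ⋆ 𝐱 K B) x y
      ≈⟨ NS.bilinear-linear {_≃′_ = _≡_} product 𝐱∃ 𝐱∃ x y ⟨
    F K x ⋆ F K y ∎
    where
    open NR

  -- Unit and counit

  -- The empty set has a single set partition, so each sum has one term, with coefficient 1.
  F-𝟙 : F K (basis K (0 , 𝟎)) ≈ₙ basis K (0 , 𝟎)
  F-𝟙 = begin
    F K (basis K (0 , o))          ≈⟨ F-basis o ⟩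
    𝐱 K o                          ≈⟨ 𝐱-μ o ⟩
    ∑ₙ (λ B → μ K B o ·ₙ 𝐩 K B)    ≈⟨ singleton (λ B → μ K B o ·ₙ 𝐩 K B) ⟩
    μ K o o ·ₙ 𝐩 K o               ≈⟨ NS.*ₗ-cong (R.reflexive (μ-diagonal o)) NS.≈ᴹ-refl ⟩
    1# ·ₙ 𝐩 K o                    ≈⟨ NS.*ₗ-identityˡ _ ⟩
    𝐩 K o                          ≈⟨ 𝐩-ζ o ⟩
    ∑ₙ (λ C → ζ o C ·ₙ 𝐦 K C)      ≈⟨ singleton (λ C → ζ o C ·ₙ 𝐦 K C) ⟩
    ζ o o ·ₙ 𝐦 K o                 ≈⟨ NS.*ₗ-cong (R.reflexive (ζ-diagonal o)) NS.≈ᴹ-refl ⟩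
    1# ·ₙ 𝐦 K o                    ≈⟨ NS.*ₗ-identityˡ _ ⟩
    basis K (0 , o)                ∎
    where
    open NR
    o : SetPartition 0
    o = 𝟎
    only : (B : SetPartition 0) → o ≡ B
    only (mkSetPartition [] _) = refl
    singleton : (v : SetPartition 0 → RawBimodule.Carrierᴹ N) → ∑ₙ v ≈ₙ v o
    singleton v = NS.≈ᴹ-trans
      (NS.∑-cong (λ B → NS.≈ᴹ-trans (NS.≈ᴹ-sym (NS.*ₗ-identityˡ (v B)))
        (NS.*ₗ-cong (R.reflexive (sym (⟦⟧-yes (o ≟ B) (only B)))) NS.≈ᴹ-refl)) (partitions 0))
      (NS.∑-partitions-δ o v)

  private
    ε𝐦 : ∃ SetPartition → k
    ε𝐦 (_ , A) = δ A 𝟏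

  -- The counit of `NCSym` takes the value 1 at every `𝐩 B`. Written as `ζ 𝟎 B`, this value turns
  -- the counit of `𝐱 A` into the entry of `ζ ⊙ μ` at `𝟎` and `A`.
  F-ε : ∀ x → εₙ (F K x) ≈ RawBialgebra.ε (G₀ K) x
  F-ε x = R.trans (Scalars.linear-linear {_≃′_ = _≡_} _ 𝐱∃ x)
    (Scalars.linear-cong (λ (_ , A) → ε-𝐱 A) x)
    where
    open SetoidReasoning R.setoid
    ε-𝐩 : (B : SetPartition n) → εₙ (𝐩 K B) ≈ ζ 𝟎 B
    ε-𝐩 {n} B = begin
      εₙ (𝐩 K B)
        ≈⟨ Scalars.linear-∑ {_≃′_ = _≡_} _ (filter (B ≤?_) (partitions n)) (𝐦 K) ⟩
      ∑ K (scalars K) (filter (B ≤?_) (partitions n)) (λ C → εₙ (𝐦 K C))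
        ≈⟨ Scalars.∑-filter (B ≤?_) (partitions n) _ ⟩
      Σ[ (λ C → ζ B C * εₙ (𝐦 K C)) ]
        ≈⟨ Σ-cong (λ C → R.*-congˡ (Scalars.linear-basis ε𝐦 (n , C))) ⟩
      Σ[ (λ C → ζ B C * δ C 𝟏) ]
        ≈⟨ Σ-δʳ 𝟏 (ζ B) ⟩
      ζ B 𝟏
        ≡⟨ trans (⟦⟧-yes (B ≤? 𝟏) (≤𝟏 B)) (sym (⟦⟧-yes (𝟎 ≤? B) (𝟎≤ B))) ⟩
      ζ 𝟎 B ∎
    ε-𝐱 : (A : SetPartition n) → εₙ (𝐱 K A) ≈ δ A 𝟎
    ε-𝐱 {n} A = begin
      εₙ (𝐱 K A)
        ≈⟨ Scalars.linear-∑ {_≃′_ = _≡_} _ (filter (_≤? A) (partitions n)) _ ⟩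
      ∑ K (scalars K) (filter (_≤? A) (partitions n)) (λ B → εₙ (μ K B A ·ₙ 𝐩 K B))
        ≈⟨ Scalars.∑-cong (λ B → R.trans (Scalars.linear-*ₗ _ (μ K B A) (𝐩 K B)) (R.*-congˡ (ε-𝐩 B))) (filter
            (_≤? A) (partitions n)) ⟩
      ∑ K (scalars K) (filter (_≤? A) (partitions n)) (λ B → μ K B A * ζ 𝟎 B)
        ≈⟨ ∑-lower (scalars K) scalars-isVectorSpace A (ζ 𝟎) ⟩
      Σ[ (λ B → μ K B A * ζ 𝟎 B) ]
        ≈⟨ Σ-cong (λ B → R.*-comm (μ K B A) (ζ 𝟎 B)) ⟩
      (ζ ⊙ μ K) 𝟎 A
        ≈⟨ ζμ≈δ 𝟎 A ⟩
      δ 𝟎 A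
        ≡⟨ δ-sym 𝟎 A ⟩
      δ A 𝟎 ∎

  -- Comultiplicativity

  ∑ₜ : (SetPartition n × SetPartition n → RawBimodule.Carrierᴹ (N ⊗ N)) → RawBimodule.Carrierᴹ (N ⊗ N)
  ∑ₜ {n} = ∑ K (N ⊗ N) (cartesianProduct (partitions n) (partitions n))

  ∑ₜ-tensor : (φ ψ : SetPartition n → k) (u v : SetPartition n → RawBimodule.Carrierᴹ N) →
    [ ∑ₙ (λ A → φ A ·ₙ u A) , ∑ₙ (λ B → ψ B ·ₙ v B) ] ≈ₜ
    ∑ₜ (λ (A , B) → (φ A * ψ B) ·ₜ [ u A , v B ])
  ∑ₜ-tensor {n} φ ψ u v = ≋-trans
    (∑-tensor N N-isVectorSpace (partitions n) (partitions n) (λ A → φ A ·ₙ u A) (λ B → ψ B ·ₙ v B))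
    (≋-trans (≋-sym (TS.∑-cartesianProduct (partitions n) (partitions n) (λ (A , B) → [ φ A ·ₙ u A , ψ B ·ₙ v B ])))
      (TS.∑-cong (λ (A , B) → scale (φ A) (ψ B) (u A) (v B)) (cartesianProduct (partitions n) (partitions n))))
    where
    scale : ∀ a b f g → [ a ·ₙ f , b ·ₙ g ] ≈ₜ [ (a * b) ·ₙ f , g ]
    scale a b f g = ≋-trans (≋-sym (relation (⊗-balanced (a ·ₙ f) b g))) (relation (⊗-cong
      (NS.≈ᴹ-trans (N-*ᵣ≈*ₗ b (a ·ₙ f)) (NS.≈ᴹ-trans (NS.*ₗ-*ₗ-comm b a f) (NS.≈ᴹ-sym (NS.*ₗ-assoc a b f))))
      (NS.≈ᴹ-refl {g})))

  private
    coproduct : ∃ SetPartition → RawBimodule.Carrierᴹ (N ⊗ N)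
    coproduct (n , A) = ∑ K (N ⊗ N)
      (filter (λ (B , C) → (B ∧ C) ≟ A) (cartesianProduct (partitions n) (partitions n)))
      (λ (B , C) → [ 𝐦 K B , 𝐦 K C ])

  -- Each pair `C`, `D` occurs in the coproduct of `𝐦 (C ∧ D)` only, and `A ≤ C ∧ D` factors into
  -- `A ≤ C` and `A ≤ D`; thus `𝐩 A` is group-like for the internal coproduct.
  Δ-𝐩 : (A : SetPartition n) → Δₙ (𝐩 K A) ≈ₜ [ 𝐩 K A , 𝐩 K A ]
  Δ-𝐩 {n} A = begin
    Δₙ (𝐩 K A)
      ≈⟨ TS.linear-∑ {_≃′_ = _≡_} _ (filter (A ≤?_) (partitions n)) (𝐦 K) ⟩
    ∑ K (N ⊗ N) (filter (A ≤?_) (partitions n)) (λ B → Δₙ (𝐦 K B))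
      ≈⟨ TS.∑-filter (A ≤?_) (partitions n) _ ⟩
    ∑ K (N ⊗ N) (partitions n) (λ B → ζ A B ·ₜ Δₙ (𝐦 K B))
      ≈⟨ TS.∑-cong (λ B → TS.*ₗ-cong (R.refl {ζ A B}) (≋-trans (TS.linear-basis coproduct (n , B))
           (TS.∑-filter (λ (C , D) → (C ∧ D) ≟ B) (cartesianProduct (partitions n) (partitions n)) _)))
               (partitions n) ⟩
    ∑ K (N ⊗ N) (partitions n) (λ B → ζ A B ·ₜ ∑ₜ (λ (C , D) → δ (C ∧ D) B ·ₜ [ 𝐦 K C , 𝐦 K D ]))
      ≈⟨ ∑-fibre (N ⊗ N) N⊗N-isVectorSpace (ζ A) (cartesianProduct (partitions n) (partitions n)) (λ
          (C , D) → C ∧ D) (λ (C , D) → [ 𝐦 K C , 𝐦 K D ]) ⟩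
    ∑ₜ (λ (C , D) → ζ A (C ∧ D) ·ₜ [ 𝐦 K C , 𝐦 K D ])
      ≈⟨ TS.∑-cong (λ (C , D) → TS.*ₗ-cong (factor C D) (≋-refl {x = [ 𝐦 K C , 𝐦 K D ]})) (cartesianProduct
          (partitions n) (partitions n)) ⟩
    ∑ₜ (λ (C , D) → (ζ A C * ζ A D) ·ₜ [ 𝐦 K C , 𝐦 K D ])
      ≈⟨ ∑ₜ-tensor (ζ A) (ζ A) (𝐦 K) (𝐦 K) ⟨
    [ ∑ₙ (λ C → ζ A C ·ₙ 𝐦 K C) , ∑ₙ (λ C → ζ A C ·ₙ 𝐦 K C) ]
      ≈⟨ relation (⊗-cong (𝐩-ζ A) (𝐩-ζ A)) ⟨
    [ 𝐩 K A , 𝐩 K A ] ∎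
    where
    open TR
    factor : ∀ C D → ζ A (C ∧ D) ≈ ζ A C * ζ A D
    factor C D = R.trans (R.reflexive (⟦⟧-⇔ (≤∧⇔ C D A) (A ≤? C ∧ D) ((A ≤? C) ×-dec (A ≤? D)))) (⟦⟧-×
        (A ≤? C) (A ≤? D))

  Δ-𝐱 : (C : SetPartition n) → Δₙ (𝐱 K C) ≈ₜ
    ∑ K (N ⊗ N) (filter (λ (A , B) → (A ∨ B) ≟ C) (cartesianProduct (partitions n) (partitions n))) (λ
        (A , B) → [ 𝐱 K A , 𝐱 K B ])
  Δ-𝐱 {n} C = begin
    Δₙ (𝐱 K C)
      ≈⟨ TS.linear-∑ {_≃′_ = _≡_} _ (filter (_≤? C) (partitions n)) _ ⟩
    ∑ K (N ⊗ N) (filter (_≤? C) (partitions n)) (λ B → Δₙ (μ K B C ·ₙ 𝐩 K B))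
      ≈⟨ TS.∑-cong (λ B → ≋-trans (TS.linear-*ₗ _ (μ K B C) (𝐩 K B)) (TS.*ₗ-cong R.refl (≋-trans (Δ-𝐩 B)
          (expand B)))) (filter (_≤? C) (partitions n)) ⟩
    ∑ K (N ⊗ N) (filter (_≤? C) (partitions n)) (λ B → μ K B C ·ₜ ∑ₜ (λ (D , E) → ζ (D ∨ E) B ·ₜ [ 𝐱 K D , 𝐱 K E ]))
      ≈⟨ ∑-lower (N ⊗ N) N⊗N-isVectorSpace C _ ⟩
    ∑ K (N ⊗ N) (partitions n) (λ B → μ K B C ·ₜ ∑ₜ (λ (D , E) → ζ (D ∨ E) B ·ₜ [ 𝐱 K D , 𝐱 K E ]))
      ≈⟨ ∑-exchange (N ⊗ N) N⊗N-isVectorSpace (λ B → μ K B C) pairs (λ (D , E) → ζ (D ∨ E)) (λ (D , E) →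
          [ 𝐱 K D , 𝐱 K E ]) ⟩
    ∑ₜ (λ (D , E) → (ζ ⊙ μ K) (D ∨ E) C ·ₜ [ 𝐱 K D , 𝐱 K E ])
      ≈⟨ TS.∑-cong (λ (D , E) → TS.*ₗ-cong (ζμ≈δ (D ∨ E) C) (≋-refl {x = [ 𝐱 K D , 𝐱 K E ]})) pairs ⟩
    ∑ₜ (λ (D , E) → δ (D ∨ E) C ·ₜ [ 𝐱 K D , 𝐱 K E ])
      ≈⟨ TS.∑-filter (λ (A , B) → (A ∨ B) ≟ C) pairs _ ⟨
    ∑ K (N ⊗ N) (filter (λ (A , B) → (A ∨ B) ≟ C) pairs) (λ (A , B) → [ 𝐱 K A , 𝐱 K B ]) ∎
    where
    open TR
    pairs : List (SetPartition n × SetPartition n)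
    pairs = cartesianProduct (partitions n) (partitions n)
    factor : ∀ B D E → ζ D B * ζ E B ≈ ζ (D ∨ E) B
    factor B D E = R.sym (R.trans (R.reflexive (⟦⟧-⇔ (∨≤⇔ D E B) (D ∨ E ≤? B) ((D ≤? B) ×-dec (E ≤? B))))
        (⟦⟧-× (D ≤? B) (E ≤? B)))
    expand : ∀ B → [ 𝐩 K B , 𝐩 K B ] ≈ₜ ∑ₜ (λ (D , E) → ζ (D ∨ E) B ·ₜ [ 𝐱 K D , 𝐱 K E ])
    expand B = ≋-trans (relation (⊗-cong (𝐩-𝐱 B) (𝐩-𝐱 B))) (≋-trans
      (∑ₜ-tensor (λ E → ζ E B) (λ E → ζ E B) (𝐱 K) (𝐱 K))
      (TS.∑-cong (λ (D , E) → TS.*ₗ-cong (factor B D E) (≋-refl {x = [ 𝐱 K D , 𝐱 K E ]})) pairs))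

  F⊗F : RawBimodule.Carrierᴹ (G ⊗ G) → RawBimodule.Carrierᴹ (N ⊗ N)
  F⊗F = map (λ (y , z) → F K y , F K z)

  F-Δ : ∀ x → Δₙ (F K x) ≈ₜ F⊗F (RawBialgebra.Δ (G₀ K) x)
  F-Δ x = ≋-trans (TS.linear-linear {_≃′_ = _≡_} _ 𝐱∃ x) (F⊗F-Δ x)
    where
    F⊗F-*ₗ : ∀ a z → F⊗F (RawBimodule._*ₗ_ (G ⊗ G) a z) ≈ₜ a ·ₜ F⊗F z
    F⊗F-*ₗ a []            = ≋-refl
    F⊗F-*ₗ a ((u , v) ∷ z) = ++-cong {x = [ _ ]} {x′ = [ _ ]}
      (relation (⊗-cong (NS.linear-*ₗ 𝐱∃ a u) (NS.≈ᴹ-refl {F K v}))) (F⊗F-*ₗ a z)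
    F⊗F-basis : (ps : List (SetPartition n × SetPartition n)) →
      ∑ K (N ⊗ N) ps (λ (A , B) → [ 𝐱 K A , 𝐱 K B ]) ≈ₜ
      F⊗F (∑ K (G ⊗ G) ps (λ (A , B) → [ basis K (n , A) , basis K (n , B) ]))
    F⊗F-basis []             = ≋-refl
    F⊗F-basis ((A , B) ∷ ps) = ++-cong {x = [ _ ]} {x′ = [ _ ]}
      (≋-sym (relation (⊗-cong (F-basis A) (F-basis B)))) (F⊗F-basis ps)
    -- `F⊗F` acts on representing lists, so the comparison proceeds term by term along the formal
    -- sum.
    F⊗F-Δ : ∀ x → linear K (N ⊗ N) (λ (_ , A) → Δₙ (𝐱 K A)) x ≈ₜ F⊗F (RawBialgebra.Δ (G₀ K) x)
    F⊗F-Δ []                  = ≋-refl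
    F⊗F-Δ ((a , (n , A)) ∷ x) = ≋-trans
      (++-cong (≋-trans (TS.*ₗ-cong (R.refl {a}) (≋-trans (Δ-𝐱 A) (F⊗F-basis pairs))) (≋-sym (F⊗F-*ₗ a _))) (F⊗F-Δ x))
      (≡⇒≋ (sym (List.map-++ _ (RawBimodule._*ₗ_ (G ⊗ G) a _) (RawBialgebra.Δ (G₀ K) x))))
      where
      pairs : List (SetPartition n × SetPartition n)
      pairs = filter (λ (B , C) → (B ∨ C) ≟ A) (cartesianProduct (partitions n) (partitions n))
      ≡⇒≋ : ∀ {y z} → y ≡ z → y ≈ₜ z
      ≡⇒≋ refl = ≋-refl

  F-isBialgebraIsomorphism : ¬ 1# ≈ 0# → IsBialgebraIsomorphism K (G₀ K) (NCSym K) (F K)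
  F-isBialgebraIsomorphism 1≉0 = record
    { isModuleIsomorphism = F-isModuleIsomorphism 1≉0
    ; ·-homo = λ x y → coefficients (F-homo x y)
    ; 𝟙-homo = coefficients F-𝟙
    ; Δ-homo = λ x → presented-mono unwrap (F-Δ x)
    ; ε-homo = F-ε
    }
    where
    -- The two tensor squares differ only in whether equality of series is wrapped in the record
    -- `_≈ₙ_`.
    unwrap : ∀ {y z} → TensorRelation N N y z → Presented (TensorRelation (NCSymModule K) (NCSymModule K)) y z
    unwrap (⊗-cong p q)       = relation (⊗-cong (coefficients p) (coefficients q))
    unwrap (⊗-addˡ x x′ y)    = relation (⊗-addˡ x x′ y)
    unwrap (⊗-addʳ x y y′)    = relation (⊗-addʳ x y y′)
    unwrap (⊗-zeroˡ y)        = relation (⊗-zeroˡ y)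
    unwrap (⊗-zeroʳ x)        = relation (⊗-zeroʳ x)
    unwrap (⊗-balanced x a y) = relation (⊗-balanced x a y)

theorem2p6 : ∀ {c ℓ₁ ℓ₂} (K : HeytingField c ℓ₁ ℓ₂) → CharacteristicZero K →
    (∀ {n m} (A : SetPartition n) (B : SetPartition m) →
    Ind K n m (_⊠_ K (V K A) (V K B)) ≅ V K (A ∣ B))
    × (∀ {n} (A B : SetPartition n) → _⊗ᵈ_ K (V K A) (V K B) ≅ V K (A ∨ B))
    × IsBialgebraIsomorphism K (G₀ K) (NCSym K) (F K)
theorem2p6 K char0 = Modules.induction K , Modules.diagonal K , Bialgebra.F-isBialgebraIsomorphism K 1≉0
  where
  open LinearAlgebra K
  1≉0 : ¬ 1# ≈ 0#
  -- The instance `n = 0` of characteristic zero speaks of `suc 0` copies of `1#`, which unfold to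
  -- `1# + 0#`.
  1≉0 1≈0 = char0 0 (R.trans (R.+-identityʳ 1#) 1≈0)
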